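{- Let $p\geq 5$ be a prime number and $n$ a positive integer. Then \[ \binom{np-1}{p-1}_{3}\equiv \begin{cases} 1+2np\,q_{p}(2) \pmod{p^2} & \text{if } p\equiv 1 \pmod 4,\\[2pt] -\tfrac{1}{2}np\,q_{p}(2) \pmod{p^2} & \text{if } p\equiv 3 \pmod 4, \end{cases} \] and \[ \binom{np-1}{\frac{p-1}{2}}_{3}\equiv \begin{cases} 1+np\left(\tfrac{13}{4}q_{p}(2)+\chi_{p}\right) \pmod{p^2} & \text{if } p\equiv 1 \pmod 8,\\[2pt] -1-np\left(\tfrac{13}{4}q_{p}(2)+\chi_{p}\right) \pmod{p^2} & \text{if } p\equiv 3 \pmod 8,\\[2pt] -np\left(\tfrac{1}{4}q_{p}(2)-\chi_{p}\right) \pmod{p^2} & \text{if } p\equiv 5 \pmod 8,\\[2pt] np\left(\tfrac{1}{4}q_{p}(2)-\chi_{p}\right) \pmod{p^2} & \text{if } p\equiv 7 \pmod 8. \end{cases} \]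
   Context: For a nonnegative integer $m$, the quadrinomial coefficients $\binom{m}{k}_{3}$ are defined by $(1+x+x^2+x^3)^{m}=\sum_{k=0}^{3m}\binom{m}{k}_{3}x^{k}$. For an integer $a$ not divisible by $p$, $q_p(a)=\frac{a^{p-1}-1}{p}$ is the Fermat quotient. The Pell sequence is $P_0=0$, $P_1=1$, $P_{m+1}=2P_m+P_{m-1}$, and the Pell quotient is $\chi_p=P_{p-(\frac{2}{p})}/p$, where $(\frac{2}{p})$ is the Legendre symbol. Congruences between rational numbers whose denominators are coprime to $p$ are understood in the ring of $p$-integral rationals. -}

module Defs where

open import Data.Nat as ℕ using (ℕ; zero; suc; _+_; _*_; _∸_; _^_; NonZero; _≡ᵇ_; _%_)
open import Data.Integer as ℤ using (ℤ; +_)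
open import Data.Integer.Divisibility as ℤD using ()
open import Data.Rational as ℚ using (ℚ; ↥_)
open import Data.List using (upTo)
open import Data.Bool.ListAction using (any)
open import Data.Bool using (if_then_else_)

-- Quadrinomial coefficients: (1+x+x^2+x^3)^m = Σ_k quad m k x^k,
-- computed by expanding (1+x+x^2+x^3)^(m+1) = (1+x+x^2+x^3)^m * (1+x+x^2+x^3).
quad : ℕ → ℕ → ℕ
quad zero zero = 1
quad zero (suc k) = 0
quad (suc m) zero = quad m 0
quad (suc m) (suc zero) = quad m 1 + quad m 0
quad (suc m) (suc (suc zero)) = quad m 2 + quad m 1 + quad m 0
quad (suc m) (suc (suc (suc k))) =
  quad m (3 + k) + quad m (2 + k) + quad m (1 + k) + quad m k

ι : ℕ → ℚ
ι n = + n ℚ./ 1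

fermatQuot2 : (p : ℕ) → .{{NonZero p}} → ℚ
fermatQuot2 p = (+ (2 ^ (p ∸ 1)) ℤ.- + 1) ℚ./ p

pell : ℕ → ℕ
pell zero = 0
pell (suc zero) = 1
pell (suc (suc m)) = 2 * pell (suc m) + pell m

twoIsQR : (p : ℕ) → .{{NonZero p}} → Data.Bool.Bool
twoIsQR p = any (λ x → ((x * x) % p) ≡ᵇ (2 % p)) (upTo p)

-- p - (2/p) with (2/p) the Legendre symbol (p odd prime, so (2/p) = ±1)
pellIndex : (p : ℕ) → .{{NonZero p}} → ℕ
pellIndex p = if twoIsQR p then p ∸ 1 else p + 1

pellQuot : (p : ℕ) → .{{NonZero p}} → ℚ
pellQuot p = + (pell (pellIndex p)) ℚ./ p

-- Congruence of rationals modulo m (denominators coprime to the prime p,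
-- m = p^2): m divides the numerator of the reduced form of a - b.
-- (If m ∣ numerator then the reduced denominator is coprime to m.)
infix 4 _≡_[modℚ_]
_≡_[modℚ_] : ℚ → ℚ → ℕ → Set
a ≡ b [modℚ m ] = (+ m) ℤD.∣ (↥ (a ℚ.- b))

{-# OPTIONS --safe #-}
-- Write f = 1 + x + x² + x³ = (1 - x⁴)/(1 - x).  Modulo p² and x^p both (1 - x)^p and (1 - x⁴)^p are
-- 1 plus a multiple of p, so f^(np) ≡ 1 + n ((1 - x⁴)^p - (1 - x)^p), and dividing by f expresses the
-- coefficients of f^(np-1) by sums of (-1)^j (p choose j) over residue classes of j modulo 4.  As
-- (-1)^i (p choose i) ≡ -p/i, these become sums over residue classes modulo 8 without loss of precision.
-- The latter are read off from (1 - x)^p at x = ±1, ±i and at a primitive 8th root of unity ζ.  The values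
-- at ±1 and ±i are given by powers of 2, the norm (1 - ζ)(1 + ζ) = 1 - i gives one linear relation modulo
-- p² for the value at ζ, and (1 - ζ)(1 - ζ⁻¹) = 2 - √2 gives a second one that involves Pell numbers.
module Submission where

open import Defs
open import Data.Nat as ℕ using (ℕ; zero; suc; z≤n; s≤s; ⌊_/2⌋; _∸_; _≤_; _%_; NonZero)
open import Data.Nat.Primality using (Prime; ¬prime[1]; euclidsLemma)
open import Data.Nat.DivMod using (_/_; m≡m%n+[m/n]*n; [m+kn]%n≡m%n; m*n/n≡m)
open import Data.Nat.Tactic.RingSolver using () renaming (solve-∀ to ℕ-solve-∀)
open import Data.Integer as ℤ using (ℤ; +_; -[1+_])
open import Data.Integer.Divisibility.Signed
  using (_∣_; divides; ∣m∣n⇒∣m+n; ∣m∣n⇒∣m-n; ∣m⇒∣-m; ∣n⇒∣m*n; ∣m⇒∣m*n; ∣⇒∣ᵤ; ∣ᵤ⇒∣; *-cancelʳ-∣)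
open import Data.Integer.Tactic.RingSolver using (solve-∀)
open import Data.Bool as Bool using (true; false; if_then_else_)
open import Data.Bool.Properties using (T-≡; ¬-not)
open import Data.Empty using (⊥-elim)
open import Data.List using (upTo)
open import Data.List.Membership.Propositional using (_∈_; lose; find)
open import Data.List.Membership.Propositional.Properties using (∈-upTo⁺)
open import Data.List.Relation.Unary.Any.Properties using (any⁺; any⁻)
open import Data.Product using (_×_; _,_; proj₁; proj₂; ∃)
open import Data.Sum as Sum using (_⊎_; inj₁; inj₂)
open import Function using (_∘_)
open import Function.Bundles using (Equivalence)
open import Relation.Nullary using (¬_)
open import Relation.Binary.Definitions using (tri<; tri≈; tri>)
open import Relation.Binary.PropositionalEquality
import Data.Nat.Properties as ℕP
import Data.Nat.Divisibility as ℕD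
import Data.Integer.Properties as ℤP
import Data.Integer.DivMod as ℤDM

-- The obstacle is truncation. At index (p-1)/2 the sums that arise stop near p/2 or p/8 (near p/4
-- for one of the sums at index p-1), and values at roots of unity only see complete residue classes
-- below p. Replacing the coefficient at i by d times the coefficient at d i stretches a short sum
-- over a progression into a complete class: the classes r modulo 4 up to p/2 turn into the classes
-- 2r modulo 8 up to p. This is why 8th roots of unity enter, and why index p-1 needs only 4th
-- roots. The relations between these values are quadratic. Each value is 0 or 1 plus a multiple of
-- p, so modulo p² products of two errors vanish and the relations become linear. The numbers i, ζ
-- and √2 are never adjoined: they appear as integer coordinate sequences paired with the signed
-- binomial coefficients. Since the Pell quotient refers to a search for a square root of 2, the
-- quadratic character of 2 has to be established as well. The real part of (1 - i)^p is 2^((p-1)/2)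
-- up to a sign fixed by p modulo 8, and it is 1 modulo p; this settles every class except p ≡ 1
-- modulo 8, where a root is built from an 8th root of unity.

module IntegerCongruences where

  open import Data.Integer using (_+_; _*_; -_; _-_; _^_)

  -- Congruences between integers.

  infix 4 _≡_[mod_]

  -- A record rather than a synonym for the divisibility: unification cannot recover `a` and `b`
  -- from `a - b`, and the wrapper keeps them inferable.
  record _≡_[mod_] (a b m : ℤ) : Set where
    constructor congruent
    field difference : m ∣ a - b

  open _≡_[mod_] public

  ∣-by : ∀ {m a b} → a ≡ b → m ∣ b → m ∣ a
  ∣-by refl h = h

  ≡⇒mod : ∀ {m a b} → a ≡ b → a ≡ b [mod m ]
  ≡⇒mod {m} {a} refl = congruent (divides (+ 0) (ℤP.+-inverseʳ a))

  mod-refl : ∀ {m a} → a ≡ a [mod m ]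
  mod-refl = ≡⇒mod refl

  mod-sym : ∀ {m a b} → a ≡ b [mod m ] → b ≡ a [mod m ]
  mod-sym {m} {a} {b} (congruent h) = congruent (∣-by (lemma a b) (∣m⇒∣-m h))
    where
    lemma : ∀ a b → b - a ≡ - (a - b)
    lemma = solve-∀

  mod-trans : ∀ {m a b c} → a ≡ b [mod m ] → b ≡ c [mod m ] → a ≡ c [mod m ]
  mod-trans {m} {a} {b} {c} (congruent h) (congruent k) =
    congruent (∣-by (lemma a b c) (∣m∣n⇒∣m+n h k))
    where
    lemma : ∀ a b c → a - c ≡ (a - b) + (b - c)
    lemma = solve-∀

  mod-+ : ∀ {m a b c d} → a ≡ b [mod m ] → c ≡ d [mod m ] → a + c ≡ b + d [mod m ]
  mod-+ {m} {a} {b} {c} {d} (congruent h) (congruent k) =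
    congruent (∣-by (lemma a b c d) (∣m∣n⇒∣m+n h k))
    where
    lemma : ∀ a b c d → (a + c) - (b + d) ≡ (a - b) + (c - d)
    lemma = solve-∀

  mod-- : ∀ {m a b c d} → a ≡ b [mod m ] → c ≡ d [mod m ] → a - c ≡ b - d [mod m ]
  mod-- {m} {a} {b} {c} {d} (congruent h) (congruent k) =
    congruent (∣-by (lemma a b c d) (∣m∣n⇒∣m-n h k))
    where
    lemma : ∀ a b c d → (a - c) - (b - d) ≡ (a - b) - (c - d)
    lemma = solve-∀

  mod-* : ∀ {m a b c d} → a ≡ b [mod m ] → c ≡ d [mod m ] → a * c ≡ b * d [mod m ]
  mod-* {m} {a} {b} {c} {d} (congruent h) (congruent k) =
    congruent (∣-by (lemma a b c d) (∣m∣n⇒∣m+n (∣m⇒∣m*n c h) (∣n⇒∣m*n b k)))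
    where
    lemma : ∀ a b c d → a * c - b * d ≡ (a - b) * c + b * (c - d)
    lemma = solve-∀

  ∣⇒mod : ∀ {m a} → m ∣ a → a ≡ + 0 [mod m ]
  ∣⇒mod {m} {a} h = congruent (∣-by (ℤP.+-identityʳ a) h)

  mod⇒∣ : ∀ {m a} → a ≡ + 0 [mod m ] → m ∣ a
  mod⇒∣ {m} {a} (congruent h) = ∣-by (sym (ℤP.+-identityʳ a)) h

  -- Power series and the operators that multiply by fixed polynomials.

  Series : Set
  Series = ℕ → ℤ

  δ : Series
  δ zero    = + 1
  δ (suc _) = + 0

  -- Multiplication of power series by 1 - x, by 1 - x⁴ and by 1 + x + x² + x³.
  Δ Δ⁴ F : Series → Series
  Δ s zero    = s 0
  Δ s (suc k) = s (suc k) - s k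

  Δ⁴ s 0 = s 0
  Δ⁴ s 1 = s 1
  Δ⁴ s 2 = s 2
  Δ⁴ s 3 = s 3
  Δ⁴ s (suc (suc (suc (suc k)))) = s (4 ℕ.+ k) - s k

  F s 0 = s 0
  F s 1 = s 1 + s 0
  F s 2 = s 2 + s 1 + s 0
  F s (suc (suc (suc k))) = s (3 ℕ.+ k) + s (2 ℕ.+ k) + s (1 ℕ.+ k) + s k

  ΔF≗Δ⁴ : ∀ s → Δ (F s) ≗ Δ⁴ s
  ΔF≗Δ⁴ s 0 = refl
  ΔF≗Δ⁴ s 1 = lemma (s 0) (s 1)
    where
    lemma : ∀ a b → b + a - a ≡ b
    lemma = solve-∀
  ΔF≗Δ⁴ s 2 = lemma (s 0) (s 1) (s 2)
    where
    lemma : ∀ a b c → c + b + a - (b + a) ≡ c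
    lemma = solve-∀
  ΔF≗Δ⁴ s 3 = lemma (s 0) (s 1) (s 2) (s 3)
    where
    lemma : ∀ a b c d → d + c + b + a - (c + b + a) ≡ d
    lemma = solve-∀
  ΔF≗Δ⁴ s (suc (suc (suc (suc k)))) = lemma (s k) (s (1 ℕ.+ k)) (s (2 ℕ.+ k)) (s (3 ℕ.+ k)) (s (4 ℕ.+ k))
    where
    lemma : ∀ a b c d e → e + d + c + b - (d + c + b + a) ≡ e - a
    lemma = solve-∀

  ΔΔ⁴≗Δ⁴Δ : ∀ s → Δ (Δ⁴ s) ≗ Δ⁴ (Δ s)
  ΔΔ⁴≗Δ⁴Δ s 0 = refl
  ΔΔ⁴≗Δ⁴Δ s 1 = refl
  ΔΔ⁴≗Δ⁴Δ s 2 = refl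
  ΔΔ⁴≗Δ⁴Δ s 3 = refl
  ΔΔ⁴≗Δ⁴Δ s 4 = lemma (s 0) (s 3) (s 4)
    where
    lemma : ∀ a b c → c - a - b ≡ c - b - a
    lemma = solve-∀
  ΔΔ⁴≗Δ⁴Δ s (suc (suc (suc (suc (suc k))))) = lemma (s k) (s (1 ℕ.+ k)) (s (4 ℕ.+ k)) (s (5 ℕ.+ k))
    where
    lemma : ∀ a b c d → d - b - (c - a) ≡ d - c - (b - a)
    lemma = solve-∀

  Δ-cong : ∀ {s t} → s ≗ t → Δ s ≗ Δ t
  Δ-cong h zero    = h 0
  Δ-cong h (suc k) = cong₂ _-_ (h (suc k)) (h k)

  Δ⁴-cong : ∀ {s t} → s ≗ t → Δ⁴ s ≗ Δ⁴ t
  Δ⁴-cong h 0 = h 0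
  Δ⁴-cong h 1 = h 1
  Δ⁴-cong h 2 = h 2
  Δ⁴-cong h 3 = h 3
  Δ⁴-cong h (suc (suc (suc (suc k)))) = cong₂ _-_ (h (4 ℕ.+ k)) (h k)

  iter : (Series → Series) → ℕ → Series → Series
  iter f zero    s = s
  iter f (suc n) s = f (iter f n s)

  iter-+ : ∀ f m n s → iter f (m ℕ.+ n) s ≡ iter f m (iter f n s)
  iter-+ f zero    n s = refl
  iter-+ f (suc m) n s = cong f (iter-+ f m n s)

  iterΔ-cong : ∀ n {s t} → s ≗ t → iter Δ n s ≗ iter Δ n t
  iterΔ-cong zero    h = h
  iterΔ-cong (suc n) h = Δ-cong (iterΔ-cong n h)

  iterΔ-Δ : ∀ n s → iter Δ n (Δ s) ≡ Δ (iter Δ n s)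
  iterΔ-Δ zero    s = refl
  iterΔ-Δ (suc n) s = cong Δ (iterΔ-Δ n s)

  iterΔ-Δ⁴ : ∀ n s → iter Δ n (Δ⁴ s) ≗ Δ⁴ (iter Δ n s)
  iterΔ-Δ⁴ zero    s k = refl
  iterΔ-Δ⁴ (suc n) s k = trans (Δ-cong (iterΔ-Δ⁴ n s) k) (ΔΔ⁴≗Δ⁴Δ (iter Δ n s) k)

  -- This is `(1 - x)^n f^n = (1 - x⁴)^n`, applied to `s`. It trades the power of the quadrinomial
  -- for two powers of binomials, whose coefficients are accessible when the exponent is prime.
  iterΔ-iterF : ∀ n s → iter Δ n (iter F n s) ≗ iter Δ⁴ n s
  iterΔ-iterF zero    s k = refl
  iterΔ-iterF (suc n) s k = begin
    Δ (iter Δ n (F t)) k ≡⟨ cong (λ z → z k) (iterΔ-Δ n (F t)) ⟨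
    iter Δ n (Δ (F t)) k ≡⟨ iterΔ-cong n (ΔF≗Δ⁴ t) k ⟩
    iter Δ n (Δ⁴ t) k    ≡⟨ iterΔ-Δ⁴ n t k ⟩
    Δ⁴ (iter Δ n t) k    ≡⟨ Δ⁴-cong (iterΔ-iterF n s) k ⟩
    Δ⁴ (iter Δ⁴ n s) k   ∎
    where
    open ≡-Reasoning
    t = iter F n s

  F-cong : ∀ {s t} → s ≗ t → F s ≗ F t
  F-cong h 0 = h 0
  F-cong h 1 = cong₂ _+_ (h 1) (h 0)
  F-cong h 2 = cong₂ _+_ (cong₂ _+_ (h 2) (h 1)) (h 0)
  F-cong h (suc (suc (suc k))) =
    cong₂ _+_ (cong₂ _+_ (cong₂ _+_ (h (3 ℕ.+ k)) (h (2 ℕ.+ k))) (h (1 ℕ.+ k))) (h k)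

  quad-iterF : ∀ m k → + quad m k ≡ iter F m δ k
  quad-iterF zero    zero    = refl
  quad-iterF zero    (suc k) = refl
  quad-iterF (suc m) k = trans (step k) (F-cong (quad-iterF m) k)
    where
    -- The clauses of `F` copy those of `quad`, so every case of the recursion holds by computation.
    step : ∀ k → + quad (suc m) k ≡ F (λ i → + quad m i) k
    step 0 = refl
    step 1 = refl
    step 2 = refl
    step (suc (suc (suc k))) = refl

  infixl 7 _∗_

  -- The Cauchy product, read off from `s = s 0 + x (s ∘ suc)`: induction on the index removes the
  -- lowest coefficient of the left factor.
  _∗_ : Series → Series → Series
  (s ∗ t) zero    = s 0 * t 0
  (s ∗ t) (suc k) = s 0 * t (suc k) + ((s ∘ suc) ∗ t) k

  ∗-distribʳ-- : ∀ a b t k → ((λ i → a i - b i) ∗ t) k ≡ (a ∗ t) k - (b ∗ t) k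
  ∗-distribʳ-- a b t zero = lemma (a 0) (b 0) (t 0)
    where
    lemma : ∀ a b c → (a - b) * c ≡ a * c - b * c
    lemma = solve-∀
  ∗-distribʳ-- a b t (suc k) =
    trans (cong (λ z → (a 0 - b 0) * t (suc k) + z) (∗-distribʳ-- (a ∘ suc) (b ∘ suc) t k))
          (lemma (a 0) (b 0) (t (suc k)) (((a ∘ suc) ∗ t) k) (((b ∘ suc) ∗ t) k))
    where
    lemma : ∀ a b c d e → (a - b) * c + (d - e) ≡ a * c + d - (b * c + e)
    lemma = solve-∀

  ∗-linearʳ : ∀ s a c b k → (s ∗ (λ i → a i + c * b i)) k ≡ (s ∗ a) k + c * (s ∗ b) k
  ∗-linearʳ s a c b zero = lemma (s 0) (a 0) c (b 0)
    where
    lemma : ∀ s a c b → s * (a + c * b) ≡ s * a + c * (s * b)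
    lemma = solve-∀
  ∗-linearʳ s a c b (suc k) =
    trans (cong (λ z → s 0 * (a (suc k) + c * b (suc k)) + z) (∗-linearʳ (s ∘ suc) a c b k))
          (lemma (s 0) (a (suc k)) c (b (suc k)) (((s ∘ suc) ∗ a) k) (((s ∘ suc) ∗ b) k))
    where
    lemma : ∀ s a c b x y → s * (a + c * b) + (x + c * y) ≡ s * a + x + c * (s * b + y)
    lemma = solve-∀

  ∗δ : ∀ s → s ∗ δ ≗ s
  ∗δ s zero    = ℤP.*-identityʳ (s 0)
  ∗δ s (suc k) = trans (cong₂ _+_ (ℤP.*-zeroʳ (s 0)) (∗δ (s ∘ suc) k)) (ℤP.+-identityˡ _)

  0∗ : ∀ t k → ((λ _ → + 0) ∗ t) k ≡ + 0
  0∗ t zero    = refl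
  0∗ t (suc k) = trans (ℤP.+-identityˡ _) (0∗ t k)

  δ∗ : ∀ t → δ ∗ t ≗ t
  δ∗ t zero    = ℤP.*-identityˡ (t 0)
  δ∗ t (suc k) = trans (cong₂ _+_ (ℤP.*-identityˡ (t (suc k))) (0∗ t k)) (ℤP.+-identityʳ _)

  Δ∗ : ∀ s t → Δ s ∗ t ≗ Δ (s ∗ t)
  Δ∗ s t zero    = refl
  Δ∗ s t (suc k) = trans (cong (λ z → s 0 * t (suc k) + z) (∗-distribʳ-- (s ∘ suc) s t k))
    (sym (ℤP.+-assoc (s 0 * t (suc k)) (((s ∘ suc) ∗ t) k) (- (s ∗ t) k)))

  Δ⁴∗ : ∀ s t → Δ⁴ s ∗ t ≗ Δ⁴ (s ∗ t)
  Δ⁴∗ s t 0 = refl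
  Δ⁴∗ s t 1 = refl
  Δ⁴∗ s t 2 = refl
  Δ⁴∗ s t 3 = refl
  Δ⁴∗ s t (suc (suc (suc (suc k)))) =
    trans (cong (λ z → a + (b + (c + (d + z)))) (∗-distribʳ-- (λ i → s (4 ℕ.+ i)) s t k))
          (lemma a b c d (((λ i → s (4 ℕ.+ i)) ∗ t) k) ((s ∗ t) k))
    where
    a = s 0 * t (4 ℕ.+ k)
    b = s 1 * t (3 ℕ.+ k)
    c = s 2 * t (2 ℕ.+ k)
    d = s 3 * t (1 ℕ.+ k)
    lemma : ∀ a b c d x y → a + (b + (c + (d + (x - y)))) ≡ a + (b + (c + (d + x))) - y
    lemma = solve-∀

  -- Turns an iterated operator into multiplication by one series, so that divisibility of the
  -- coefficients of `(1 - x)^n` can be brought to bear on the result.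
  iterΔ∗ : ∀ n t → iter Δ n t ≗ iter Δ n δ ∗ t
  iterΔ∗ zero    t k = sym (δ∗ t k)
  iterΔ∗ (suc n) t k = trans (Δ-cong (iterΔ∗ n t) k) (sym (Δ∗ (iter Δ n δ) t k))

  iterΔ⁴∗ : ∀ n t → iter Δ⁴ n t ≗ iter Δ⁴ n δ ∗ t
  iterΔ⁴∗ zero    t k = sym (δ∗ t k)
  iterΔ⁴∗ (suc n) t k = trans (Δ⁴-cong (iterΔ⁴∗ n t) k) (sym (Δ⁴∗ (iter Δ⁴ n δ) t k))

  ∗-congˡ : ∀ {s s′} → s ≗ s′ → ∀ t → s ∗ t ≗ s′ ∗ t
  ∗-congˡ h t zero    = cong (_* t 0) (h 0)
  ∗-congˡ h t (suc k) = cong₂ _+_ (cong (_* t (suc k)) (h 0)) (∗-congˡ (h ∘ suc) t k)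

  ∗-mod : ∀ {m} s {t t′} k → (∀ i → i ℕ.≤ k → t i ≡ t′ i [mod m ]) → (s ∗ t) k ≡ (s ∗ t′) k [mod m ]
  ∗-mod s zero    h = mod-* (mod-refl {a = s 0}) (h 0 z≤n)
  ∗-mod s (suc k) h =
    mod-+ (mod-* (mod-refl {a = s 0}) (h (suc k) ℕP.≤-refl)) (∗-mod (s ∘ suc) k (λ i le → h i (ℕP.m≤n⇒m≤1+n le)))

  product-∣ : ∀ {p a b} → p ∣ a → p ∣ b → p * p ∣ a * b
  product-∣ {p} (divides q refl) (divides r refl) = divides (q * r) (lemma q r p)
    where
    lemma : ∀ q r p → (q * p) * (r * p) ≡ (q * r) * (p * p)
    lemma = solve-∀

  ∗-divides-square : ∀ {p} s t k → (∀ i → i ℕ.≤ k → p ∣ s i) → (∀ i → i ℕ.≤ k → p ∣ t i) →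
    p * p ∣ (s ∗ t) k
  ∗-divides-square s t zero    hs ht = product-∣ (hs 0 z≤n) (ht 0 z≤n)
  ∗-divides-square s t (suc k) hs ht =
    ∣m∣n⇒∣m+n (product-∣ (hs 0 z≤n) (ht (suc k) ℕP.≤-refl))
      (∗-divides-square (s ∘ suc) t k (λ i h → hs (suc i) (s≤s h)) (λ i h → ht i (ℕP.m≤n⇒m≤1+n h)))

  -- If `s` is 1 plus a multiple of p and `t` is a multiple of p, then `s ∗ t` and `t` differ by
  -- terms with two factors p. Everything is confined to indices up to `k`, since the coefficient of
  -- `(1 - x)^p` at p is a unit.
  ∗-near-δ : ∀ {p} s t k → s 0 ≡ + 1 → (∀ i → suc i ℕ.≤ k → p ∣ s (suc i)) → (∀ i → i ℕ.≤ k → p ∣ t i) →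
    (s ∗ t) k ≡ t k [mod p * p ]
  ∗-near-δ s t zero    h hs ht = ≡⇒mod (trans (cong (_* t 0) h) (ℤP.*-identityˡ (t 0)))
  ∗-near-δ {p} s t (suc k) h hs ht = mod-trans
    (mod-+ (≡⇒mod (trans (cong (_* t (suc k)) h) (ℤP.*-identityˡ (t (suc k)))))
           (∣⇒mod (∗-divides-square (s ∘ suc) t k (λ i i≤k → hs i (s≤s i≤k)) (λ i i≤k → ht i (ℕP.m≤n⇒m≤1+n i≤k)))))
    (≡⇒mod (ℤP.+-identityʳ (t (suc k))))

  -- The constant term of `1 - x` is 1, so this factor can be divided out of a congruence of
  -- truncated series within the truncation.
  Δ-injective-mod : ∀ {m} N {s t} → (∀ k → k ℕ.≤ N → Δ s k ≡ Δ t k [mod m ]) → ∀ k → k ℕ.≤ N → s k ≡ t k [mod m ]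
  Δ-injective-mod N h zero    le = h 0 le
  Δ-injective-mod {m} N {s} {t} h (suc k) le =
    mod-trans (≡⇒mod (lemma (s (suc k)) (s k)))
      (mod-trans (mod-+ (h (suc k) le) (Δ-injective-mod N h k (ℕP.<⇒≤ le)))
        (≡⇒mod (sym (lemma (t (suc k)) (t k)))))
    where
    lemma : ∀ a b → a ≡ a - b + b
    lemma = solve-∀

  iterΔ-injective-mod : ∀ {m} N n {s t} → (∀ k → k ℕ.≤ N → iter Δ n s k ≡ iter Δ n t k [mod m ]) →
    ∀ k → k ℕ.≤ N → s k ≡ t k [mod m ]
  iterΔ-injective-mod N zero    h = h
  iterΔ-injective-mod N (suc n) h = iterΔ-injective-mod N n (Δ-injective-mod N h)

  -- Signed binomial coefficients.

  -- e n k = (-1)^k (n choose k).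
  e : ℕ → Series
  e n = iter Δ n δ

  e-zero : ∀ n → e n 0 ≡ + 1
  e-zero zero    = refl
  e-zero (suc n) = e-zero n

  e-vanish : ∀ {n k} → n ℕ.< k → e n k ≡ + 0
  e-vanish {zero}  {suc k} _        = refl
  e-vanish {suc n} {suc k} (s≤s lt) = cong₂ _-_ (e-vanish (ℕP.m<n⇒m<1+n lt)) (e-vanish lt)

  -- Absorption, `k (n choose k) = n (n-1 choose k-1)`, with signs. For prime upper index it yields
  -- both the divisibility by p and the finer value `-p/k` modulo p².
  e-absorption : ∀ n k → + suc k * e (suc n) (suc k) ≡ - (+ suc n * e n k)
  e-absorption zero    zero    = refl
  e-absorption zero    (suc k) = ℤP.*-zeroʳ (+ suc (suc k))
  e-absorption (suc n) zero    = begin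
    + 1 * (e (suc n) 1 - e (suc n) 0)     ≡⟨ lemma₁ (e (suc n) 1) (e (suc n) 0) ⟩
    + 1 * e (suc n) 1 - e (suc n) 0       ≡⟨ cong (_- e (suc n) 0) (e-absorption n 0) ⟩
    - (+ suc n * e n 0) - e n 0           ≡⟨ lemma₂ (+ suc n) (e n 0) ⟩
    - ((+ 1 + + suc n) * e n 0)           ∎
    where
    open ≡-Reasoning
    lemma₁ : ∀ a b → + 1 * (a - b) ≡ + 1 * a - b
    lemma₁ = solve-∀
    lemma₂ : ∀ m a → - (m * a) - a ≡ - ((+ 1 + m) * a)
    lemma₂ = solve-∀
  e-absorption (suc n) (suc k) = begin
    (+ 1 + + suc k) * (e (suc n) (2 ℕ.+ k) - e₁)
      ≡⟨ lemma₁ (+ suc k) (e (suc n) (2 ℕ.+ k)) e₁ ⟩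
    (+ 1 + + suc k) * e (suc n) (2 ℕ.+ k) - + suc k * e₁ - e₁
      ≡⟨ cong₂ (λ a b → a - b - e₁) (e-absorption n (suc k)) (e-absorption n k) ⟩
    - (+ suc n * e n (suc k)) - - (+ suc n * e n k) - e₁
      ≡⟨ lemma₂ (+ suc n) (e n (suc k)) (e n k) ⟩
    - ((+ 1 + + suc n) * e₁) ∎
    where
    open ≡-Reasoning
    e₁ = e (suc n) (suc k)
    lemma₁ : ∀ k a b → (+ 1 + k) * (a - b) ≡ (+ 1 + k) * a - k * b - b
    lemma₁ = solve-∀
    lemma₂ : ∀ m a b → - (m * a) - - (m * b) - (a - b) ≡ - ((+ 1 + m) * (a - b))
    lemma₂ = solve-∀

  -- The substitution of `x⁴` for `x`. Recursion in steps of four avoids any test of divisibility of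
  -- the index.
  spread : Series → Series
  spread s 0 = s 0
  spread s 1 = + 0
  spread s 2 = + 0
  spread s 3 = + 0
  spread s (suc (suc (suc (suc k)))) = spread (s ∘ suc) k

  spread-- : ∀ a b k → spread (λ i → a i - b i) k ≡ spread a k - spread b k
  spread-- a b 0 = refl
  spread-- a b 1 = refl
  spread-- a b 2 = refl
  spread-- a b 3 = refl
  spread-- a b (suc (suc (suc (suc k)))) = spread-- (a ∘ suc) (b ∘ suc) k

  Δ⁴-spread : ∀ s → Δ⁴ (spread s) ≗ spread (Δ s)
  Δ⁴-spread s 0 = refl
  Δ⁴-spread s 1 = refl
  Δ⁴-spread s 2 = refl
  Δ⁴-spread s 3 = refl
  Δ⁴-spread s (suc (suc (suc (suc k)))) = sym (spread-- (s ∘ suc) s k)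

  spread-0 : ∀ k → spread (λ _ → + 0) k ≡ + 0
  spread-0 0 = refl
  spread-0 1 = refl
  spread-0 2 = refl
  spread-0 3 = refl
  spread-0 (suc (suc (suc (suc k)))) = spread-0 k

  spread-δ : δ ≗ spread δ
  spread-δ 0 = refl
  spread-δ 1 = refl
  spread-δ 2 = refl
  spread-δ 3 = refl
  spread-δ (suc (suc (suc (suc k)))) = sym (spread-0 k)

  iterΔ⁴-δ : ∀ n → iter Δ⁴ n δ ≗ spread (e n)
  iterΔ⁴-δ zero    k = spread-δ k
  iterΔ⁴-δ (suc n) k = trans (Δ⁴-cong (iterΔ⁴-δ n) k) (Δ⁴-spread (e n) k)

  spread-∣ : ∀ {m} s k → (∀ j → j ℕ.≤ k → m ∣ s j) → m ∣ spread s k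
  spread-∣ s 0 h = h 0 z≤n
  spread-∣ s 1 h = divides (+ 0) refl
  spread-∣ s 2 h = divides (+ 0) refl
  spread-∣ s 3 h = divides (+ 0) refl
  spread-∣ s (suc (suc (suc (suc k)))) h =
    spread-∣ (s ∘ suc) k (λ j le → h (suc j) (s≤s (ℕP.≤-trans le (ℕP.m≤n+m k 3))))

  -- Powers of the quadrinomial modulo p², below degree p.

  module PrimeModulus (n : ℕ) (pr : Prime (suc n)) where

    p : ℕ
    p = suc n

    p² : ℤ
    p² = + p * + p

    euclid : ∀ a b → + p ∣ a * b → + p ∣ a ⊎ + p ∣ b
    euclid a b h with euclidsLemma ℤ.∣ a ∣ ℤ.∣ b ∣ pr (subst (p ℕD.∣_) (ℤP.abs-* a b) (∣⇒∣ᵤ h))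
    ... | inj₁ x = inj₁ (∣ᵤ⇒∣ x)
    ... | inj₂ x = inj₂ (∣ᵤ⇒∣ x)

    cancel-∣ : ∀ {a} b → ¬ + p ∣ a → + p ∣ a * b → + p ∣ b
    cancel-∣ {a} b p∤a h with euclid a b h
    ... | inj₁ x = ⊥-elim (p∤a x)
    ... | inj₂ x = x

    p²∣⇒p∣ : ∀ {a} → p² ∣ a → + p ∣ a
    p²∣⇒p∣ {a} (divides q refl) = divides (q * + p) (sym (ℤP.*-assoc q (+ p) (+ p)))

    -- Euclid's lemma speaks of the prime only, so one factor p of `b` is split off and cancelled,
    -- and the argument is repeated on the quotient.
    cancel-∣² : ∀ {a} b → ¬ + p ∣ a → p² ∣ a * b → p² ∣ b
    cancel-∣² {a} b p∤a h with cancel-∣ b p∤a (p²∣⇒p∣ h)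
    ... | divides c refl with cancel-∣ c p∤a (*-cancelʳ-∣ (+ p) {+ p} {a * c} (∣-by (ℤP.*-assoc a c (+ p)) h))
    ... | divides d refl = divides d (ℤP.*-assoc d (+ p) (+ p))

    p∤small : ∀ {k} → suc k ℕ.< p → ¬ + p ∣ + suc k
    p∤small lt h = ℕP.<⇒≱ lt (ℕD.∣⇒≤ (∣⇒∣ᵤ h))

    e-∣ : ∀ {j} → j ≢ 0 → j ≢ p → + p ∣ e p j
    e-∣ {zero}  j≢0 j≢p = ⊥-elim (j≢0 refl)
    e-∣ {suc k} j≢0 j≢p with ℕP.<-cmp (suc k) p
    ... | tri< lt _ _ = cancel-∣ (e p (suc k)) (p∤small lt)
      (∣-by (e-absorption n k) (∣m⇒∣-m (∣m⇒∣m*n (e n k) (divides (+ 1) (sym (ℤP.*-identityˡ (+ p)))))))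
    ... | tri≈ _ eq _ = ⊥-elim (j≢p eq)
    ... | tri> _ _ gt = ∣-by (e-vanish gt) (divides (+ 0) refl)

    e-∣-< : ∀ {k} → suc k ℕ.< p → + p ∣ e p (suc k)
    e-∣-< lt = e-∣ (λ ()) (ℕP.<⇒≢ lt)

    -- In Pascal's rule `e p (k + 1) = e n (k + 1) - e n k` the left side is divisible by p, so
    -- neighbours in row p - 1 agree modulo p.
    e-pred : ∀ k → k ℕ.< p → e n k ≡ + 1 [mod + p ]
    e-pred zero    _  = ≡⇒mod (e-zero n)
    e-pred (suc k) lt = mod-trans (≡⇒mod (lemma (e n (suc k)) (e n k)))
      (mod-+ (∣⇒mod (e-∣-< lt)) (e-pred k (ℕP.<⇒≤ lt)))
      where
      lemma : ∀ a b → a ≡ a - b + b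
      lemma = solve-∀

    -- Absorption gives exactly `-p` times an entry of row p - 1. That entry is known only modulo p,
    -- but the factor p raises the precision to p².
    index-e : ∀ j → 0 ℕ.< j → j ℕ.< p → + j * e p j ≡ - + p [mod p² ]
    index-e (suc k) _ lt with difference (e-pred k (ℕP.<⇒≤ lt))
    ... | divides q eq = congruent (divides (- q) (begin
      + suc k * e p (suc k) - - + p    ≡⟨ cong (_- - + p) (e-absorption n k) ⟩
      - (+ p * e n k) - - + p          ≡⟨ lemma₁ (+ p) (e n k) ⟩
      - (+ p * (e n k - + 1))          ≡⟨ cong (λ z → - (+ p * z)) eq ⟩
      - (+ p * (q * + p))              ≡⟨ lemma₂ (+ p) q ⟩
      - q * p²                         ∎))
      where
      open ≡-Reasoning
      lemma₁ : ∀ p a → - (p * a) - - p ≡ - (p * (a - + 1))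
      lemma₁ = solve-∀
      lemma₂ : ∀ p q → - (p * (q * p)) ≡ - q * (p * p)
      lemma₂ = solve-∀

    -- Both sides are -p/i modulo p².
    e-scale : ∀ d i → 0 ℕ.< i → i ℕ.< p → 0 ℕ.< d ℕ.* i → d ℕ.* i ℕ.< p → e p i ≡ + d * e p (d ℕ.* i) [mod p² ]
    e-scale d (suc i) i>0 i<p di>0 di<p = congruent (cancel-∣² _ (p∤small i<p)
      (∣-by eq (difference (mod-trans (index-e (suc i) i>0 i<p) (mod-sym (index-e (d ℕ.* suc i) di>0 di<p))))))
      where
      lemma : ∀ i x d y → i * (x - d * y) ≡ i * x - (d * i) * y
      lemma = solve-∀
      eq : + suc i * (e p (suc i) - + d * e p (d ℕ.* suc i)) ≡ + suc i * e p (suc i) - + (d ℕ.* suc i) * e p (d ℕ.* suc i)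
      eq = trans (lemma (+ suc i) (e p (suc i)) (+ d) (e p (d ℕ.* suc i)))
        (cong (λ z → + suc i * e p (suc i) - z * e p (d ℕ.* suc i)) (sym (ℤP.pos-* d (suc i))))

    -- (1 + x + x² + x³)^p ≡ 1 + τ modulo (p², x^p).
    τ : Series
    τ k = spread (e p) k - e p k

    spread-e-∣ : ∀ k → suc k ℕ.< p → + p ∣ spread (e p) (suc k)
    spread-e-∣ 0 _ = divides (+ 0) refl
    spread-e-∣ 1 _ = divides (+ 0) refl
    spread-e-∣ 2 _ = divides (+ 0) refl
    spread-e-∣ (suc (suc (suc k))) lt =
      spread-∣ (e p ∘ suc) k (λ j le → e-∣-< (ℕP.≤-<-trans (s≤s le) (ℕP.≤-<-trans (s≤s (ℕP.m≤n+m k 3)) lt)))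

    τ-∣ : ∀ k → k ℕ.< p → + p ∣ τ k
    τ-∣ zero    _  = divides (+ 0) (ℤP.+-inverseʳ (e p 0))
    τ-∣ (suc k) lt = ∣m∣n⇒∣m-n (spread-e-∣ k lt) (e-∣-< lt)

    -- Induction on `N` after multiplying both sides by `(1 - x)^p`. The left side becomes
    -- `(1 - x⁴)^p (1 + N τ)` and the right side `(1 - x)^p (1 + (N + 1) τ)`. As `τ` is a multiple
    -- of p, each factor in front acts on it like 1, and both sides reduce to `common`.
    F^p : ∀ N k → k ℕ.≤ n → iter F (N ℕ.* p) δ k ≡ δ k + + N * τ k [mod p² ]
    F^p zero    k _  = ≡⇒mod (sym (trans (cong (λ z → δ k + z) (ℤP.*-zeroˡ (τ k))) (ℤP.+-identityʳ (δ k))))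
    F^p (suc N) = iterΔ-injective-mod n p (λ k le → mod-trans (left k le) (mod-sym (right k le)))
      where
      g = iter F (N ℕ.* p) δ
      common : Series
      common k = spread (e p) k + + N * τ k

      ∗-δ+τ : ∀ s c → s 0 ≡ + 1 → (∀ i → suc i ℕ.≤ n → + p ∣ s (suc i)) →
        ∀ k → k ℕ.≤ n → (s ∗ (λ i → δ i + c * τ i)) k ≡ s k + c * τ k [mod p² ]
      ∗-δ+τ s c h hs k le = mod-trans (≡⇒mod (∗-linearʳ s δ c τ k))
        (mod-+ (≡⇒mod (∗δ s k)) (mod-* (mod-refl {a = c})
          (∗-near-δ s τ k h (λ i i≤k → hs i (ℕP.≤-trans i≤k le)) (λ i i≤k → τ-∣ i (s≤s (ℕP.≤-trans i≤k le))))))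

      left : ∀ k → k ℕ.≤ n → iter Δ p (iter F (suc N ℕ.* p) δ) k ≡ common k [mod p² ]
      left k le = mod-trans
        (≡⇒mod (begin
          iter Δ p (iter F (p ℕ.+ N ℕ.* p) δ) k ≡⟨ cong (λ s → iter Δ p s k) (iter-+ F p (N ℕ.* p) δ) ⟩
          iter Δ p (iter F p g) k               ≡⟨ iterΔ-iterF p g k ⟩
          iter Δ⁴ p g k                         ≡⟨ iterΔ⁴∗ p g k ⟩
          (iter Δ⁴ p δ ∗ g) k                   ≡⟨ ∗-congˡ (iterΔ⁴-δ p) g k ⟩
          (spread (e p) ∗ g) k                  ∎))
        (mod-trans (∗-mod (spread (e p)) k (λ i i≤k → F^p N i (ℕP.≤-trans i≤k le)))
          (∗-δ+τ (spread (e p)) (+ N) (e-zero p) (λ i i≤n → spread-e-∣ i (s≤s i≤n)) k le))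
        where open ≡-Reasoning
      right : ∀ k → k ℕ.≤ n → iter Δ p (λ i → δ i + + suc N * τ i) k ≡ common k [mod p² ]
      right k le = mod-trans (≡⇒mod (iterΔ∗ p (λ i → δ i + + suc N * τ i) k))
        (mod-trans (∗-δ+τ (e p) (+ suc N) (e-zero p) (λ i i≤n → e-∣-< (s≤s i≤n)) k le)
          (≡⇒mod (lemma (e p k) (+ N) (spread (e p) k))))
        where
        lemma : ∀ a N b → a + (+ 1 + N) * (b - a) ≡ b + N * (b - a)
        lemma = solve-∀

  -- Finite sums, and division by the quadrinomial as sums over classes modulo 4.

  Σ : ℕ → Series → ℤ
  Σ zero    g = + 0
  Σ (suc N) g = Σ N g + g N

  Σ-cong : ∀ N {g h} → g ≗ h → Σ N g ≡ Σ N h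
  Σ-cong zero    eq = refl
  Σ-cong (suc N) eq = cong₂ _+_ (Σ-cong N eq) (eq N)

  Σ-+-distrib : ∀ N g h → Σ N (λ i → g i + h i) ≡ Σ N g + Σ N h
  Σ-+-distrib zero    g h = refl
  Σ-+-distrib (suc N) g h =
    trans (cong (_+ (g N + h N)) (Σ-+-distrib N g h)) (lemma (Σ N g) (Σ N h) (g N) (h N))
    where
    lemma : ∀ a b c d → a + b + (c + d) ≡ a + c + (b + d)
    lemma = solve-∀

  Σ---distrib : ∀ N g h → Σ N (λ i → g i - h i) ≡ Σ N g - Σ N h
  Σ---distrib zero    g h = refl
  Σ---distrib (suc N) g h =
    trans (cong (_+ (g N - h N)) (Σ---distrib N g h)) (lemma (Σ N g) (Σ N h) (g N) (h N))
    where
    lemma : ∀ a b c d → a - b + (c - d) ≡ a + c - (b + d)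
    lemma = solve-∀

  Σ-zero : ∀ N {g} → (∀ i → g i ≡ + 0) → Σ N g ≡ + 0
  Σ-zero zero    h = refl
  Σ-zero (suc N) h = cong₂ _+_ (Σ-zero N h) (h N)

  Σ-split : ∀ m k g → Σ (m ℕ.+ k) g ≡ Σ k g + Σ m (λ s → g (s ℕ.+ k))
  Σ-split zero    k g = sym (ℤP.+-identityʳ (Σ k g))
  Σ-split (suc m) k g = trans (cong (_+ g (m ℕ.+ k)) (Σ-split m k g)) (ℤP.+-assoc (Σ k g) _ _)

  Σ-scale : ∀ {m} d N {g h} → (∀ i → i ℕ.< N → g i ≡ d * h i [mod m ]) → Σ N g ≡ d * Σ N h [mod m ]
  Σ-scale d zero    eq = ≡⇒mod (sym (ℤP.*-zeroʳ d))
  Σ-scale d (suc N) {h = h} eq = mod-trans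
    (mod-+ (Σ-scale d N (λ i lt → eq i (ℕP.m<n⇒m<1+n lt))) (eq N ℕP.≤-refl))
    (≡⇒mod (sym (ℤP.*-distribˡ-+ d (Σ N h) (h N))))

  -- The term at 0 is kept apart: there both series equal 1, so scaling by `d` fails, whereas the
  -- remaining terms scale as in `Σ-scale`.
  Σ-scale-suc : ∀ {m} d N {g h} → g 0 ≡ + 1 → h 0 ≡ + 1 →
    (∀ i → 0 ℕ.< i → i ℕ.≤ N → g i ≡ d * h i [mod m ]) →
    Σ (suc N) g ≡ + 1 + d * (Σ (suc N) h - + 1) [mod m ]
  Σ-scale-suc d zero {g} {h} g0 h0 eq =
    ≡⇒mod (trans (trans (ℤP.+-identityˡ (g 0)) g0) (sym (trans (cong (λ z → + 1 + d * (+ 0 + z - + 1)) h0) (lemma d))))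
    where
    lemma : ∀ d → + 1 + d * (+ 0 + + 1 - + 1) ≡ + 1
    lemma = solve-∀
  Σ-scale-suc d (suc N) {g} {h} g0 h0 eq = mod-trans
    (mod-+ (Σ-scale-suc d N g0 h0 (λ i i>0 le → eq i i>0 (ℕP.m≤n⇒m≤1+n le))) (eq (suc N) (s≤s z≤n) ℕP.≤-refl))
    (≡⇒mod (lemma d (Σ (suc N) h) (h (suc N))))
    where
    lemma : ∀ d a b → + 1 + d * (a - + 1) + d * b ≡ + 1 + d * (a + b - + 1)
    lemma = solve-∀

  -- Division of a power series by 1 - x⁴.
  σ : Series → Series
  σ s 0 = s 0
  σ s 1 = s 1
  σ s 2 = s 2
  σ s 3 = s 3
  σ s (suc (suc (suc (suc k)))) = σ s k + s (4 ℕ.+ k)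

  σΔ⁴ : ∀ s → σ (Δ⁴ s) ≗ s
  σΔ⁴ s 0 = refl
  σΔ⁴ s 1 = refl
  σΔ⁴ s 2 = refl
  σΔ⁴ s 3 = refl
  σΔ⁴ s (suc (suc (suc (suc k)))) = trans (cong (_+ (s (4 ℕ.+ k) - s k)) (σΔ⁴ s k)) (lemma (s k) (s (4 ℕ.+ k)))
    where
    lemma : ∀ a b → a + (b - a) ≡ b
    lemma = solve-∀

  σ-cong : ∀ {s s′} → s ≗ s′ → σ s ≗ σ s′
  σ-cong h 0 = h 0
  σ-cong h 1 = h 1
  σ-cong h 2 = h 2
  σ-cong h 3 = h 3
  σ-cong h (suc (suc (suc (suc k)))) = cong₂ _+_ (σ-cong h k) (h (4 ℕ.+ k))

  σ-mod : ∀ {m} s s′ k → (∀ i → i ℕ.≤ k → s i ≡ s′ i [mod m ]) → σ s k ≡ σ s′ k [mod m ]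
  σ-mod s s′ 0 h = h 0 ℕP.≤-refl
  σ-mod s s′ 1 h = h 1 ℕP.≤-refl
  σ-mod s s′ 2 h = h 2 ℕP.≤-refl
  σ-mod s s′ 3 h = h 3 ℕP.≤-refl
  σ-mod s s′ (suc (suc (suc (suc k)))) h =
    mod-+ (σ-mod s s′ k (λ i le → h i (ℕP.≤-trans le (ℕP.m≤n+m k 4)))) (h (4 ℕ.+ k) ℕP.≤-refl)

  Δ-mod : ∀ {m} s s′ k → (∀ i → i ℕ.≤ k → s i ≡ s′ i [mod m ]) → Δ s k ≡ Δ s′ k [mod m ]
  Δ-mod s s′ zero    h = h 0 z≤n
  Δ-mod s s′ (suc k) h = mod-- (h (suc k) ℕP.≤-refl) (h k (ℕP.n≤1+n k))

  -- Division by 1 + x + x² + x³.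
  G : Series → Series
  G s = σ (Δ s)

  Δ-linear : ∀ a b c k → Δ (λ i → a i + c * b i) k ≡ Δ a k + c * Δ b k
  Δ-linear a b c zero    = refl
  Δ-linear a b c (suc k) = lemma (a (suc k)) (a k) (b (suc k)) (b k) c
    where
    lemma : ∀ a a′ b b′ c → a + c * b - (a′ + c * b′) ≡ a - a′ + c * (b - b′)
    lemma = solve-∀

  σ-linear : ∀ a b c k → σ (λ i → a i + c * b i) k ≡ σ a k + c * σ b k
  σ-linear a b c 0 = refl
  σ-linear a b c 1 = refl
  σ-linear a b c 2 = refl
  σ-linear a b c 3 = refl
  σ-linear a b c (suc (suc (suc (suc k)))) =
    trans (cong (_+ (a (4 ℕ.+ k) + c * b (4 ℕ.+ k))) (σ-linear a b c k))
          (lemma (a (4 ℕ.+ k)) (σ a k) (b (4 ℕ.+ k)) (σ b k) c)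
    where
    lemma : ∀ a a′ b b′ c → a′ + c * b′ + (a + c * b) ≡ a′ + a + c * (b′ + b)
    lemma = solve-∀

  G-linear : ∀ a b c k → G (λ i → a i + c * b i) k ≡ G a k + c * G b k
  G-linear a b c k = trans (σ-cong (Δ-linear a b c) k) (σ-linear (Δ a) (Δ b) c k)

  G-cong : ∀ {s s′} → s ≗ s′ → G s ≗ G s′
  G-cong h = σ-cong (Δ-cong h)

  G-- : ∀ a b k → G (λ i → a i - b i) k ≡ G a k - G b k
  G-- a b k = begin
    G (λ i → a i - b i) k              ≡⟨ G-cong (λ i → lemma (a i) (b i)) k ⟩
    G (λ i → a i + -[1+ 0 ] * b i) k   ≡⟨ G-linear a b -[1+ 0 ] k ⟩
    G a k + -[1+ 0 ] * G b k           ≡⟨ lemma (G a k) (G b k) ⟨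
    G a k - G b k                      ∎
    where
    open ≡-Reasoning
    lemma : ∀ a b → a - b ≡ a + -[1+ 0 ] * b
    lemma = solve-∀

  GF : ∀ s → G (F s) ≗ s
  GF s k = trans (σ-cong (ΔF≗Δ⁴ s) k) (σΔ⁴ s k)

  σ-0 : ∀ s t → σ s (t ℕ.* 4) ≡ Σ (suc t) (λ i → s (i ℕ.* 4))
  σ-0 s zero    = sym (ℤP.+-identityˡ (s 0))
  σ-0 s (suc t) = cong (_+ s (suc t ℕ.* 4)) (σ-0 s t)

  σ-1 : ∀ s t → σ s (1 ℕ.+ t ℕ.* 4) ≡ Σ (suc t) (λ i → s (1 ℕ.+ i ℕ.* 4))
  σ-1 s zero    = sym (ℤP.+-identityˡ (s 1))
  σ-1 s (suc t) = cong (_+ s (1 ℕ.+ suc t ℕ.* 4)) (σ-1 s t)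

  σ-2 : ∀ s t → σ s (2 ℕ.+ t ℕ.* 4) ≡ Σ (suc t) (λ i → s (2 ℕ.+ i ℕ.* 4))
  σ-2 s zero    = sym (ℤP.+-identityˡ (s 2))
  σ-2 s (suc t) = cong (_+ s (2 ℕ.+ suc t ℕ.* 4)) (σ-2 s t)

  σ-3 : ∀ s t → σ s (3 ℕ.+ t ℕ.* 4) ≡ Σ (suc t) (λ i → s (3 ℕ.+ i ℕ.* 4))
  σ-3 s zero    = sym (ℤP.+-identityˡ (s 3))
  σ-3 s (suc t) = cong (_+ s (3 ℕ.+ suc t ℕ.* 4)) (σ-3 s t)

  G-0 : ∀ s t → G s (t ℕ.* 4) ≡ Σ (suc t) (λ i → s (i ℕ.* 4)) - Σ t (λ i → s (3 ℕ.+ i ℕ.* 4))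
  G-0 s zero    = lemma (s 0)
    where
    lemma : ∀ a → a ≡ + 0 + a - + 0
    lemma = solve-∀
  G-0 s (suc t) = trans (cong (_+ (s (suc t ℕ.* 4) - s (3 ℕ.+ t ℕ.* 4))) (G-0 s t))
    (lemma (Σ (suc t) (λ i → s (i ℕ.* 4))) (Σ t (λ i → s (3 ℕ.+ i ℕ.* 4))) (s (suc t ℕ.* 4)) (s (3 ℕ.+ t ℕ.* 4)))
    where
    lemma : ∀ a b c d → a - b + (c - d) ≡ a + c - (b + d)
    lemma = solve-∀

  G-1 : ∀ s t → G s (1 ℕ.+ t ℕ.* 4) ≡ Σ (suc t) (λ i → s (1 ℕ.+ i ℕ.* 4)) - Σ (suc t) (λ i → s (i ℕ.* 4))
  G-1 s t = trans (σ-1 (Δ s) t) (Σ---distrib (suc t) (λ i → s (1 ℕ.+ i ℕ.* 4)) (λ i → s (i ℕ.* 4)))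

  G-2 : ∀ s t → G s (2 ℕ.+ t ℕ.* 4) ≡ Σ (suc t) (λ i → s (2 ℕ.+ i ℕ.* 4)) - Σ (suc t) (λ i → s (1 ℕ.+ i ℕ.* 4))
  G-2 s t = trans (σ-2 (Δ s) t) (Σ---distrib (suc t) (λ i → s (2 ℕ.+ i ℕ.* 4)) (λ i → s (1 ℕ.+ i ℕ.* 4)))

  G-3 : ∀ s t → G s (3 ℕ.+ t ℕ.* 4) ≡ Σ (suc t) (λ i → s (3 ℕ.+ i ℕ.* 4)) - Σ (suc t) (λ i → s (2 ℕ.+ i ℕ.* 4))
  G-3 s t = trans (σ-3 (Δ s) t) (Σ---distrib (suc t) (λ i → s (3 ℕ.+ i ℕ.* 4)) (λ i → s (2 ℕ.+ i ℕ.* 4)))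

  spread-at-0 : ∀ s i → spread s (i ℕ.* 4) ≡ s i
  spread-at-0 s zero    = refl
  spread-at-0 s (suc i) = spread-at-0 (s ∘ suc) i

  spread-at-1 : ∀ s i → spread s (1 ℕ.+ i ℕ.* 4) ≡ + 0
  spread-at-1 s zero    = refl
  spread-at-1 s (suc i) = spread-at-1 (s ∘ suc) i

  spread-at-2 : ∀ s i → spread s (2 ℕ.+ i ℕ.* 4) ≡ + 0
  spread-at-2 s zero    = refl
  spread-at-2 s (suc i) = spread-at-2 (s ∘ suc) i

  spread-at-3 : ∀ s i → spread s (3 ℕ.+ i ℕ.* 4) ≡ + 0
  spread-at-3 s zero    = refl
  spread-at-3 s (suc i) = spread-at-3 (s ∘ suc) i

  G-spread-0 : ∀ s t → G (spread s) (t ℕ.* 4) ≡ Σ (suc t) s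
  G-spread-0 s t = trans (G-0 (spread s) t)
    (trans (cong₂ _-_ (Σ-cong (suc t) (spread-at-0 s)) (Σ-zero t (spread-at-3 s))) (ℤP.+-identityʳ (Σ (suc t) s)))

  G-spread-1 : ∀ s t → G (spread s) (1 ℕ.+ t ℕ.* 4) ≡ - Σ (suc t) s
  G-spread-1 s t = trans (G-1 (spread s) t)
    (trans (cong₂ _-_ (Σ-zero (suc t) (spread-at-1 s)) (Σ-cong (suc t) (spread-at-0 s))) (ℤP.+-identityˡ (- Σ (suc t) s)))

  G-spread-2 : ∀ s t → G (spread s) (2 ℕ.+ t ℕ.* 4) ≡ + 0
  G-spread-2 s t = trans (G-2 (spread s) t) (cong₂ _-_ (Σ-zero (suc t) (spread-at-2 s)) (Σ-zero (suc t) (spread-at-1 s)))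

  G-spread-3 : ∀ s t → G (spread s) (3 ℕ.+ t ℕ.* 4) ≡ + 0
  G-spread-3 s t = trans (G-3 (spread s) t) (cong₂ _-_ (Σ-zero (suc t) (spread-at-3 s)) (Σ-zero (suc t) (spread-at-2 s)))

  Σ-δ : ∀ t → Σ (suc t) δ ≡ + 1
  Σ-δ zero    = refl
  Σ-δ (suc t) = cong (_+ + 0) (Σ-δ t)

  -- Quadrinomial coefficients as sums of signed binomial coefficients.

  module QuadModulus (n : ℕ) (pr : Prime (suc n)) where

    open PrimeModulus n pr public

    -- The upper index computes to `n + N * p`, so one more factor `F` completes the exponent to
    -- `(N + 1) p`, where `F^p` applies; `G` then divides this factor out again.
    quad-mod : ∀ N k → k ℕ.≤ n →
      + quad (suc N ℕ.* p ℕ.∸ 1) k ≡ G (spread δ) k + + suc N * (G (spread (e p)) k - G (e p) k) [mod p² ]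
    quad-mod N k le = mod-trans (≡⇒mod (begin
        + quad (n ℕ.+ N ℕ.* p) k ≡⟨ quad-iterF (n ℕ.+ N ℕ.* p) k ⟩
        g k                      ≡⟨ GF g k ⟨
        G (F g) k                ∎))
      (mod-trans (σ-mod (Δ (F g)) (Δ T) k (λ i i≤k → Δ-mod (F g) T i (λ j j≤i →
          F^p (suc N) j (ℕP.≤-trans j≤i (ℕP.≤-trans i≤k le)))))
        (≡⇒mod (trans (G-linear δ τ (+ suc N) k)
          (cong₂ (λ a b → a + + suc N * b) (G-cong spread-δ k) (G-- (spread (e p)) (e p) k)))))
      where
      open ≡-Reasoning
      g T : Series
      g = iter F (n ℕ.+ N ℕ.* p) δ
      T i = δ i + + suc N * τ i

    quad-mod-0 : ∀ N t → t ℕ.* 4 ℕ.≤ n → + quad (suc N ℕ.* p ℕ.∸ 1) (t ℕ.* 4) ≡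
      + 1 + + suc N * (Σ (suc t) (e p) - (Σ (suc t) (λ i → e p (i ℕ.* 4)) - Σ t (λ i → e p (3 ℕ.+ i ℕ.* 4)))) [mod p² ]
    quad-mod-0 N t le = mod-trans (quad-mod N (t ℕ.* 4) le)
      (≡⇒mod (cong₂ (λ a b → a + + suc N * b) (trans (G-spread-0 δ t) (Σ-δ t))
        (cong₂ _-_ (G-spread-0 (e p) t) (G-0 (e p) t))))

    quad-mod-1 : ∀ N t → 1 ℕ.+ t ℕ.* 4 ℕ.≤ n → + quad (suc N ℕ.* p ℕ.∸ 1) (1 ℕ.+ t ℕ.* 4) ≡
      - + 1 + + suc N * (- Σ (suc t) (e p) - (Σ (suc t) (λ i → e p (1 ℕ.+ i ℕ.* 4)) - Σ (suc t) (λ i → e p (i ℕ.* 4)))) [mod p² ]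
    quad-mod-1 N t le = mod-trans (quad-mod N (1 ℕ.+ t ℕ.* 4) le)
      (≡⇒mod (cong₂ (λ a b → a + + suc N * b) (trans (G-spread-1 δ t) (cong -_ (Σ-δ t)))
        (cong₂ _-_ (G-spread-1 (e p) t) (G-1 (e p) t))))

    quad-mod-2 : ∀ N t → 2 ℕ.+ t ℕ.* 4 ℕ.≤ n → + quad (suc N ℕ.* p ℕ.∸ 1) (2 ℕ.+ t ℕ.* 4) ≡
      + 0 + + suc N * (+ 0 - (Σ (suc t) (λ i → e p (2 ℕ.+ i ℕ.* 4)) - Σ (suc t) (λ i → e p (1 ℕ.+ i ℕ.* 4)))) [mod p² ]
    quad-mod-2 N t le = mod-trans (quad-mod N (2 ℕ.+ t ℕ.* 4) le)
      (≡⇒mod (cong₂ (λ a b → a + + suc N * b) (G-spread-2 δ t)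
        (cong₂ _-_ (G-spread-2 (e p) t) (G-2 (e p) t))))

    quad-mod-3 : ∀ N t → 3 ℕ.+ t ℕ.* 4 ℕ.≤ n → + quad (suc N ℕ.* p ℕ.∸ 1) (3 ℕ.+ t ℕ.* 4) ≡
      + 0 + + suc N * (+ 0 - (Σ (suc t) (λ i → e p (3 ℕ.+ i ℕ.* 4)) - Σ (suc t) (λ i → e p (2 ℕ.+ i ℕ.* 4)))) [mod p² ]
    quad-mod-3 N t le = mod-trans (quad-mod N (3 ℕ.+ t ℕ.* 4) le)
      (≡⇒mod (cong₂ (λ a b → a + + suc N * b) (G-spread-3 δ t)
        (cong₂ _-_ (G-spread-3 (e p) t) (G-3 (e p) t))))

    -- Stretches an initial segment of row p into the multiples of `d`. Taking `t` to be the integer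
    -- part of `p/d` makes the right side a complete residue class below p.
    Σ-e-multiples : ∀ d t → 0 ℕ.< d → d ℕ.* t ℕ.< p →
      Σ (suc t) (e p) ≡ + 1 + + d * (Σ (suc t) (λ i → e p (d ℕ.* i)) - + 1) [mod p² ]
    Σ-e-multiples d@(suc d′) t _ lt = Σ-scale-suc (+ d) t (e-zero p) (trans (cong (e p) (ℕP.*-zeroʳ d)) (e-zero p))
      (λ { i@(suc i′) i>0 le → e-scale d i i>0
        (ℕP.≤-<-trans (ℕP.≤-trans le (ℕP.m≤m+n t (d′ ℕ.* t))) lt) (s≤s z≤n) (ℕP.≤-<-trans (ℕP.*-monoʳ-≤ d le) lt) })

    -- Stretches a class modulo 4 running up to about p/2 into a class modulo 8 running up to p,
    -- which the values at 8th roots of unity can evaluate.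
    Σ-e-double : ∀ N r → (∀ i → i ℕ.< N → 0 ℕ.< r ℕ.+ i ℕ.* 4) → (∀ i → i ℕ.< N → 2 ℕ.* r ℕ.+ i ℕ.* 8 ℕ.< p) →
      Σ N (λ i → e p (r ℕ.+ i ℕ.* 4)) ≡ + 2 * Σ N (λ i → e p (2 ℕ.* r ℕ.+ i ℕ.* 8)) [mod p² ]
    Σ-e-double N r pos small = Σ-scale (+ 2) N λ i lt →
      subst (λ j → e p (r ℕ.+ i ℕ.* 4) ≡ + 2 * e p j [mod p² ]) (double i)
        (e-scale 2 (r ℕ.+ i ℕ.* 4) (pos i lt) (ℕP.≤-<-trans (ℕP.m≤n*m (r ℕ.+ i ℕ.* 4) 2) (bound i lt))
          (ℕP.<-≤-trans (pos i lt) (ℕP.m≤n*m (r ℕ.+ i ℕ.* 4) 2)) (bound i lt))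
      where
      identity : ∀ r i → 2 ℕ.* (r ℕ.+ i ℕ.* 4) ≡ 2 ℕ.* r ℕ.+ i ℕ.* 8
      identity = ℕ-solve-∀
      double : ∀ i → 2 ℕ.* (r ℕ.+ i ℕ.* 4) ≡ 2 ℕ.* r ℕ.+ i ℕ.* 8
      double i = identity r i
      bound : ∀ i → i ℕ.< N → 2 ℕ.* (r ℕ.+ i ℕ.* 4) ℕ.< p
      bound i lt = subst (ℕ._< p) (sym (double i)) (small i lt)

    Σ-e-double-0 : ∀ t → t ℕ.* 8 ℕ.< p →
      Σ (suc t) (λ i → e p (i ℕ.* 4)) ≡ + 1 + + 2 * (Σ (suc t) (λ i → e p (i ℕ.* 8)) - + 1) [mod p² ]
    Σ-e-double-0 t lt = Σ-scale-suc (+ 2) t (e-zero p) (e-zero p)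
      λ { i@(suc i′) i>0 le →
        let bound = ℕP.≤-<-trans (ℕP.*-monoˡ-≤ 8 le) lt in
        subst (λ j → e p (i ℕ.* 4) ≡ + 2 * e p j [mod p² ]) (identity i)
          (e-scale 2 (i ℕ.* 4) (s≤s z≤n) (ℕP.≤-<-trans (ℕP.*-monoʳ-≤ i (ℕP.m≤m+n 4 4)) bound) (s≤s z≤n)
            (subst (ℕ._< p) (sym (identity i)) bound)) }
      where
      identity : ∀ i → 2 ℕ.* (i ℕ.* 4) ≡ i ℕ.* 8
      identity = ℕ-solve-∀

  -- Values of `(1 - x)^n` at roots of unity, in integer coordinates.

  -- ℒ n χ = Σ_j (-1)^j (n choose j) χ(j).
  ℒ : ℕ → Series → ℤ
  ℒ zero    χ = χ 0
  ℒ (suc n) χ = ℒ n χ - ℒ n (χ ∘ suc)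

  -- `ℒ n` is the n-th power of identity minus shift, evaluated at 0; Pascal's rule expands it. The
  -- bound `N` is free above `n` because the extra binomial coefficients vanish, which later allows
  -- `N` to be a multiple of the period of `χ`.
  ℒ-Σ : ∀ n N χ → n ℕ.< N → ℒ n χ ≡ Σ N (λ j → e n j * χ j)
  ℒ-Σ zero (suc N) χ _ = sym (delta N)
    where
    delta : ∀ N → Σ (suc N) (λ j → δ j * χ j) ≡ χ 0
    delta zero    = trans (ℤP.+-identityˡ _) (ℤP.*-identityˡ (χ 0))
    delta (suc N) = trans (cong (_+ (+ 0 * χ (suc N))) (delta N)) (ℤP.+-identityʳ (χ 0))
  ℒ-Σ (suc n) (suc N) χ (s≤s lt) =
    trans (cong₂ _-_ (ℒ-Σ n (suc N) χ (ℕP.m<n⇒m<1+n lt)) (ℒ-Σ n N (χ ∘ suc) lt)) (pascal N)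
    where
    pascal : ∀ N → Σ (suc N) (λ j → e n j * χ j) - Σ N (λ j → e n j * χ (suc j)) ≡ Σ (suc N) (λ j → e (suc n) j * χ j)
    pascal zero    = ℤP.+-identityʳ _
    pascal (suc N) = trans
      (lemma (Σ (suc N) (λ j → e n j * χ j)) (Σ N (λ j → e n j * χ (suc j))) (e n (suc N)) (e n N) (χ (suc N)))
      (cong (_+ e (suc n) (suc N) * χ (suc N)) (pascal N))
      where
      lemma : ∀ a b c d x → a + c * x - (b + d * x) ≡ a - b + (c - d) * x
      lemma = solve-∀

  ℒ-neg : ∀ n χ → ℒ n (λ j → - χ j) ≡ - ℒ n χ
  ℒ-neg zero    χ = refl
  ℒ-neg (suc n) χ = trans (cong₂ _-_ (ℒ-neg n χ) (ℒ-neg n (χ ∘ suc))) (lemma (ℒ n χ) (ℒ n (χ ∘ suc)))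
    where
    lemma : ∀ a b → - a - - b ≡ - (a - b)
    lemma = solve-∀

  -- Coordinates of ζ^j in the basis 1, ζ, ζ², ζ³, where ζ⁴ = -1.
  ζ₀ ζ₁ ζ₂ ζ₃ : Series
  ζ₀ zero    = + 1
  ζ₀ (suc j) = - ζ₃ j
  ζ₁ zero    = + 0
  ζ₁ (suc j) = ζ₀ j
  ζ₂ zero    = + 0
  ζ₂ (suc j) = ζ₁ j
  ζ₃ zero    = + 0
  ζ₃ (suc j) = ζ₂ j

  -- Real and imaginary parts of i^j.
  re im : Series
  re zero    = + 1
  re (suc j) = - im j
  im zero    = + 0
  im (suc j) = re j

  -- The functions `(1 ± (-1)^j)/2`: they encode the values at 1 and -1 without a division by 2.
  even odd : Series
  even zero    = + 1
  even (suc j) = odd j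
  odd zero     = + 0
  odd (suc j)  = even j

  -- (1 - ζ)^n = a₀ n + a₁ n ζ + a₂ n ζ² + a₃ n ζ³ and (1 - i)^n = u n + v n i.
  a₀ a₁ a₂ a₃ u v : ℕ → ℤ
  a₀ n = ℒ n ζ₀
  a₁ n = ℒ n ζ₁
  a₂ n = ℒ n ζ₂
  a₃ n = ℒ n ζ₃
  u n = ℒ n re
  v n = ℒ n im

  a₀-suc : ∀ n → a₀ (suc n) ≡ a₀ n + a₃ n
  a₀-suc n = trans (cong (λ z → a₀ n - z) (ℒ-neg n ζ₃)) (cong (λ z → a₀ n + z) (ℤP.neg-involutive (a₃ n)))

  u-suc : ∀ n → u (suc n) ≡ u n + v n
  u-suc n = trans (cong (λ z → u n - z) (ℒ-neg n im)) (cong (λ z → u n + z) (ℤP.neg-involutive (v n)))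

  even-ℒ : ∀ n → ℒ (suc n) even ≡ (+ 2) ^ n × ℒ (suc n) odd ≡ - ((+ 2) ^ n)
  even-ℒ zero    = refl , refl
  even-ℒ (suc n) = trans (cong₂ _-_ (proj₁ (even-ℒ n)) (proj₂ (even-ℒ n))) (lemma₁ ((+ 2) ^ n))
    , trans (cong₂ _-_ (proj₂ (even-ℒ n)) (proj₁ (even-ℒ n))) (lemma₂ ((+ 2) ^ n))
    where
    lemma₁ : ∀ a → a - - a ≡ + 2 * a
    lemma₁ = solve-∀
    lemma₂ : ∀ a → - a - a ≡ - (+ 2 * a)
    lemma₂ = solve-∀

  a₀-2+ : ∀ n → a₀ (2 ℕ.+ n) ≡ a₀ n + + 2 * a₃ n - a₂ n
  a₀-2+ n = trans (a₀-suc (suc n)) (trans (cong (_+ (a₃ n - a₂ n)) (a₀-suc n)) (lemma (a₀ n) (a₂ n) (a₃ n)))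
    where
    lemma : ∀ a b c → a + c + (c - b) ≡ a + + 2 * c - b
    lemma = solve-∀

  a₁-2+ : ∀ n → a₁ (2 ℕ.+ n) ≡ a₁ n - + 2 * a₀ n - a₃ n
  a₁-2+ n = trans (cong (λ z → a₁ n - a₀ n - z) (a₀-suc n)) (lemma (a₀ n) (a₁ n) (a₃ n))
    where
    lemma : ∀ a b c → b - a - (a + c) ≡ b - + 2 * a - c
    lemma = solve-∀

  a₂-2+ : ∀ n → a₂ (2 ℕ.+ n) ≡ a₂ n - + 2 * a₁ n + a₀ n
  a₂-2+ n = lemma (a₀ n) (a₁ n) (a₂ n)
    where
    lemma : ∀ a b c → c - b - (b - a) ≡ c - + 2 * b + a
    lemma = solve-∀

  a₃-2+ : ∀ n → a₃ (2 ℕ.+ n) ≡ a₃ n - + 2 * a₂ n + a₁ n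
  a₃-2+ n = lemma (a₁ n) (a₂ n) (a₃ n)
    where
    lemma : ∀ a b c → c - b - (b - a) ≡ c - + 2 * b + a
    lemma = solve-∀

  u-2+ : ∀ n → u (2 ℕ.+ n) ≡ + 2 * v n
  u-2+ n = trans (u-suc (suc n)) (trans (cong (_+ (v n - u n)) (u-suc n)) (lemma (u n) (v n)))
    where
    lemma : ∀ a b → a + b + (b - a) ≡ + 2 * b
    lemma = solve-∀

  v-2+ : ∀ n → v (2 ℕ.+ n) ≡ - (+ 2 * u n)
  v-2+ n = trans (cong (λ z → v n - u n - z) (u-suc n)) (lemma (u n) (v n))
    where
    lemma : ∀ a b → b - a - (a + b) ≡ - (+ 2 * a)
    lemma = solve-∀

  -- (1 - ζ)(1 + ζ) = 1 - i, where 1 + ζ is obtained from 1 - ζ by ζ ↦ -ζ.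
  norm-relations : ∀ n → (a₀ n * a₀ n - a₂ n * a₂ n + + 2 * (a₁ n * a₃ n) ≡ u n)
    × (+ 2 * (a₀ n * a₂ n) - a₁ n * a₁ n + a₃ n * a₃ n ≡ v n)
  norm-relations zero    = refl , refl
  norm-relations (suc n) rewrite a₀-suc n | u-suc n
    | sym (proj₁ (norm-relations n)) | sym (proj₂ (norm-relations n)) =
    lemma₁ (a₀ n) (a₁ n) (a₂ n) (a₃ n) , lemma₂ (a₀ n) (a₁ n) (a₂ n) (a₃ n)
    where
    lemma₁ : ∀ a b c d → (a + d) * (a + d) - (c - b) * (c - b) + + 2 * ((b - a) * (d - c))
      ≡ a * a - c * c + + 2 * (b * d) + (+ 2 * (a * c) - b * b + d * d)
    lemma₁ = solve-∀
    lemma₂ : ∀ a b c d → + 2 * ((a + d) * (c - b)) - (b - a) * (b - a) + (d - c) * (d - c)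
      ≡ + 2 * (a * c) - b * b + d * d - (a * a - c * c + + 2 * (b * d))
    lemma₂ = solve-∀

  data Odd : ℕ → Set where
    one : Odd 1
    ss  : ∀ {n} → Odd n → Odd (suc (suc n))

  -- For odd `n` this is the common absolute value of `u n` and `v n`; for an odd prime it is also
  -- the power of 2 in Euler's criterion.
  h : ℕ → ℤ
  h n = (+ 2) ^ ⌊ n /2⌋

  -- Since `(1 - i)² = -2i`, two steps exchange `u` and `v` up to sign and double them.
  u²-odd : ∀ {n} → Odd n → (u n * u n ≡ (+ 2) ^ ℕ.pred n) × (v n * v n ≡ (+ 2) ^ ℕ.pred n)
  u²-odd one = refl , refl
  u²-odd (ss {suc n} o) rewrite u-2+ (suc n) | v-2+ (suc n) =
    trans (lemma₁ (v (suc n))) (cong (λ z → + 2 * (+ 2 * z)) (proj₂ (u²-odd o))) ,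
    trans (lemma₂ (u (suc n))) (cong (λ z → + 2 * (+ 2 * z)) (proj₁ (u²-odd o)))
    where
    lemma₁ : ∀ a → + 2 * a * (+ 2 * a) ≡ + 2 * (+ 2 * (a * a))
    lemma₁ = solve-∀
    lemma₂ : ∀ a → - (+ 2 * a) * - (+ 2 * a) ≡ + 2 * (+ 2 * (a * a))
    lemma₂ = solve-∀

  -- (1 - ζ)(1 - ζ⁻¹) = 2 - √2, and the powers of 2 + √2 = √2 (1 + √2) are given by Pell numbers.
  pell-relations : ∀ {n} → Odd n →
    (a₀ n * a₀ n + a₁ n * a₁ n + a₂ n * a₂ n + a₃ n * a₃ n ≡ + 2 * (h n * + pell n))
    × (a₃ n * a₀ n - a₀ n * a₁ n - a₁ n * a₂ n - a₂ n * a₃ n ≡ h n * (+ pell n + + pell (ℕ.pred n)))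
  pell-relations one = refl , refl
  pell-relations (ss {suc n} o) rewrite a₀-2+ (suc n) | a₁-2+ (suc n) | a₂-2+ (suc n) | a₃-2+ (suc n) =
    (begin
      -- The coefficients come from `(2 + √2)² = 6 + 4√2`: the product `(X + Y√2)(6 + 4√2)` is
      -- `(6X + 8Y) + (4X + 6Y)√2`.
      _ ≡⟨ lemma₁ (a₀ (suc n)) (a₁ (suc n)) (a₂ (suc n)) (a₃ (suc n)) ⟩
      + 6 * X + + 8 * Y
        ≡⟨ cong₂ (λ x y → + 6 * x + + 8 * y) (proj₁ (pell-relations o)) (proj₂ (pell-relations o)) ⟩
      + 6 * (+ 2 * (h (suc n) * P)) + + 8 * (h (suc n) * (P + P′))
        ≡⟨ lemma₃ (h (suc n)) P P′ ⟩
      + 2 * (+ 2 * h (suc n) * (+ 2 * (+ 2 * P + P′) + P))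
        ≡⟨ cong (λ z → + 2 * (+ 2 * h (suc n) * z)) (sym pell³) ⟩
      + 2 * (h (3 ℕ.+ n) * + pell (3 ℕ.+ n)) ∎) ,
    (begin
      _ ≡⟨ lemma₂ (a₀ (suc n)) (a₁ (suc n)) (a₂ (suc n)) (a₃ (suc n)) ⟩
      + 4 * X + + 6 * Y
        ≡⟨ cong₂ (λ x y → + 4 * x + + 6 * y) (proj₁ (pell-relations o)) (proj₂ (pell-relations o)) ⟩
      + 4 * (+ 2 * (h (suc n) * P)) + + 6 * (h (suc n) * (P + P′))
        ≡⟨ lemma₄ (h (suc n)) P P′ ⟩
      + 2 * h (suc n) * (+ 2 * (+ 2 * P + P′) + P + (+ 2 * P + P′))
        ≡⟨ cong₂ (λ y z → + 2 * h (suc n) * (y + z)) (sym pell³) (sym pell²) ⟩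
      h (3 ℕ.+ n) * (+ pell (3 ℕ.+ n) + + pell (2 ℕ.+ n)) ∎)
    where
    open ≡-Reasoning
    P  = + pell (suc n)
    P′ = + pell n
    X = a₀ (suc n) * a₀ (suc n) + a₁ (suc n) * a₁ (suc n) + a₂ (suc n) * a₂ (suc n) + a₃ (suc n) * a₃ (suc n)
    Y = a₃ (suc n) * a₀ (suc n) - a₀ (suc n) * a₁ (suc n) - a₁ (suc n) * a₂ (suc n) - a₂ (suc n) * a₃ (suc n)
    pell² : + pell (2 ℕ.+ n) ≡ + 2 * P + P′
    pell² = cong (_+ P′) (ℤP.pos-* 2 (pell (suc n)))
    pell³ : + pell (3 ℕ.+ n) ≡ + 2 * (+ 2 * P + P′) + P
    pell³ = cong (_+ P) (trans (ℤP.pos-* 2 (pell (2 ℕ.+ n))) (cong (+ 2 *_) pell²))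
    lemma₁ : ∀ a b c d →
      (a + + 2 * d - c) * (a + + 2 * d - c) + (b - + 2 * a - d) * (b - + 2 * a - d)
        + (c - + 2 * b + a) * (c - + 2 * b + a) + (d - + 2 * c + b) * (d - + 2 * c + b)
      ≡ + 6 * (a * a + b * b + c * c + d * d) + + 8 * (d * a - a * b - b * c - c * d)
    lemma₁ = solve-∀
    lemma₂ : ∀ a b c d →
      (d - + 2 * c + b) * (a + + 2 * d - c) - (a + + 2 * d - c) * (b - + 2 * a - d)
        - (b - + 2 * a - d) * (c - + 2 * b + a) - (c - + 2 * b + a) * (d - + 2 * c + b)
      ≡ + 4 * (a * a + b * b + c * c + d * d) + + 6 * (d * a - a * b - b * c - c * d)
    lemma₂ = solve-∀
    lemma₃ : ∀ h P P′ → + 6 * (+ 2 * (h * P)) + + 8 * (h * (P + P′)) ≡ + 2 * (+ 2 * h * (+ 2 * (+ 2 * P + P′) + P))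
    lemma₃ = solve-∀
    lemma₄ : ∀ h P P′ → + 4 * (+ 2 * (h * P)) + + 6 * (h * (P + P′)) ≡ + 2 * h * (+ 2 * (+ 2 * P + P′) + P + (+ 2 * P + P′))
    lemma₄ = solve-∀

  -- The relation (1 - ζ)^n = -ζ^n (1 - ζ⁻¹)^n in coordinates, and the value of (1 - i)^n, depend on n modulo 8.
  record Twist (n : ℕ) (b₁ b₃ ε η : ℤ) : Set where
    field
      a₁-eq : a₁ n ≡ b₁
      a₃-eq : a₃ n ≡ b₃
      u-eq  : u n ≡ ε * h n
      v-eq  : v n ≡ η * h n

  -- Only `a₀` and `a₂` remain as unknowns in each class. Multiplication by `(1 - ζ)²` permutes the
  -- four shapes cyclically, so the base case n = 1 suffices.
  Residue₁ Residue₃ Residue₅ Residue₇ : ℕ → Set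
  Residue₁ n = Twist n (- a₀ n) (a₂ n) (+ 1) (- + 1)
  Residue₃ n = Twist n (- a₂ n) (- a₀ n) (- + 1) (- + 1)
  Residue₅ n = Twist n (a₀ n) (- a₂ n) (- + 1) (+ 1)
  Residue₇ n = Twist n (a₂ n) (a₀ n) (+ 1) (+ 1)

  u-double : ∀ {n b₁ b₃ ε η} → Twist n b₁ b₃ ε η → u (2 ℕ.+ n) ≡ η * h (2 ℕ.+ n)
  u-double {n} {η = η} tw = trans (u-2+ n) (trans (cong (+ 2 *_) (Twist.v-eq tw)) (lemma η (h n)))
    where
    lemma : ∀ η h → + 2 * (η * h) ≡ η * (+ 2 * h)
    lemma = solve-∀

  v-double : ∀ {n b₁ b₃ ε η} → Twist n b₁ b₃ ε η → v (2 ℕ.+ n) ≡ - ε * h (2 ℕ.+ n)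
  v-double {n} {ε = ε} tw = trans (v-2+ n) (trans (cong (λ z → - (+ 2 * z)) (Twist.u-eq tw)) (lemma ε (h n)))
    where
    lemma : ∀ ε h → - (+ 2 * (ε * h)) ≡ - ε * (+ 2 * h)
    lemma = solve-∀

  1⇒3 : ∀ {n} → Residue₁ n → Residue₃ (2 ℕ.+ n)
  1⇒3 {n} tw = record
    { a₁-eq = a₁-eq ; a₃-eq = a₃-eq ; u-eq = u-double tw ; v-eq = v-double tw }
    where
    a₁-eq : a₁ (2 ℕ.+ n) ≡ - a₂ (2 ℕ.+ n)
    a₁-eq rewrite a₁-2+ n | a₂-2+ n | Twist.a₁-eq tw | Twist.a₃-eq tw = lemma (a₀ n) (a₂ n)
      where
      lemma : ∀ a c → - a - + 2 * a - c ≡ - (c - + 2 * - a + a)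
      lemma = solve-∀
    a₃-eq : a₃ (2 ℕ.+ n) ≡ - a₀ (2 ℕ.+ n)
    a₃-eq rewrite a₃-2+ n | a₀-2+ n | Twist.a₁-eq tw | Twist.a₃-eq tw = lemma (a₀ n) (a₂ n)
      where
      lemma : ∀ a c → c - + 2 * c + - a ≡ - (a + + 2 * c - c)
      lemma = solve-∀

  3⇒5 : ∀ {n} → Residue₃ n → Residue₅ (2 ℕ.+ n)
  3⇒5 {n} tw = record
    { a₁-eq = a₁-eq ; a₃-eq = a₃-eq ; u-eq = u-double tw ; v-eq = v-double tw }
    where
    a₁-eq : a₁ (2 ℕ.+ n) ≡ a₀ (2 ℕ.+ n)
    a₁-eq rewrite a₁-2+ n | a₀-2+ n | Twist.a₁-eq tw | Twist.a₃-eq tw = lemma (a₀ n) (a₂ n)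
      where
      lemma : ∀ a c → - c - + 2 * a - - a ≡ a + + 2 * - a - c
      lemma = solve-∀
    a₃-eq : a₃ (2 ℕ.+ n) ≡ - a₂ (2 ℕ.+ n)
    a₃-eq rewrite a₃-2+ n | a₂-2+ n | Twist.a₁-eq tw | Twist.a₃-eq tw = lemma (a₀ n) (a₂ n)
      where
      lemma : ∀ a c → - a - + 2 * c + - c ≡ - (c - + 2 * - c + a)
      lemma = solve-∀

  5⇒7 : ∀ {n} → Residue₅ n → Residue₇ (2 ℕ.+ n)
  5⇒7 {n} tw = record
    { a₁-eq = a₁-eq ; a₃-eq = a₃-eq ; u-eq = u-double tw ; v-eq = v-double tw }
    where
    a₁-eq : a₁ (2 ℕ.+ n) ≡ a₂ (2 ℕ.+ n)
    a₁-eq rewrite a₁-2+ n | a₂-2+ n | Twist.a₁-eq tw | Twist.a₃-eq tw = lemma (a₀ n) (a₂ n)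
      where
      lemma : ∀ a c → a - + 2 * a - - c ≡ c - + 2 * a + a
      lemma = solve-∀
    a₃-eq : a₃ (2 ℕ.+ n) ≡ a₀ (2 ℕ.+ n)
    a₃-eq rewrite a₃-2+ n | a₀-2+ n | Twist.a₁-eq tw | Twist.a₃-eq tw = lemma (a₀ n) (a₂ n)
      where
      lemma : ∀ a c → - c - + 2 * c + a ≡ a + + 2 * - c - c
      lemma = solve-∀

  7⇒1 : ∀ {n} → Residue₇ n → Residue₁ (2 ℕ.+ n)
  7⇒1 {n} tw = record
    { a₁-eq = a₁-eq ; a₃-eq = a₃-eq ; u-eq = u-double tw ; v-eq = v-double tw }
    where
    a₁-eq : a₁ (2 ℕ.+ n) ≡ - a₀ (2 ℕ.+ n)
    a₁-eq rewrite a₁-2+ n | a₀-2+ n | Twist.a₁-eq tw | Twist.a₃-eq tw = lemma (a₀ n) (a₂ n)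
      where
      lemma : ∀ a c → c - + 2 * a - a ≡ - (a + + 2 * a - c)
      lemma = solve-∀
    a₃-eq : a₃ (2 ℕ.+ n) ≡ a₂ (2 ℕ.+ n)
    a₃-eq rewrite a₃-2+ n | a₂-2+ n | Twist.a₁-eq tw | Twist.a₃-eq tw = lemma (a₀ n) (a₂ n)
      where
      lemma : ∀ a c → a - + 2 * c + c ≡ c - + 2 * c + a
      lemma = solve-∀

  residue₁ : ∀ t → Residue₁ (1 ℕ.+ t ℕ.* 8)
  residue₁ zero    = record { a₁-eq = refl ; a₃-eq = refl ; u-eq = refl ; v-eq = refl }
  residue₁ (suc t) = 7⇒1 (5⇒7 (3⇒5 (1⇒3 (residue₁ t))))

  residue₃ : ∀ t → Residue₃ (3 ℕ.+ t ℕ.* 8)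
  residue₃ t = 1⇒3 (residue₁ t)

  residue₅ : ∀ t → Residue₅ (5 ℕ.+ t ℕ.* 8)
  residue₅ t = 3⇒5 (residue₃ t)

  residue₇ : ∀ t → Residue₇ (7 ℕ.+ t ℕ.* 8)
  residue₇ t = 5⇒7 (residue₅ t)

  -- Here s = (-1)^((n-1)/2) and X is the Pell number of index n - (2/n).
  record Relations (n : ℕ) (s X : ℤ) : Set where
    field
      u-norm : u n ≡ a₀ n * a₀ n - a₂ n * a₂ n - + 2 * s * (a₀ n * a₂ n)
      u-pell : u n * X ≡ + 2 * s * (a₀ n * a₂ n) - + 2 * (a₂ n * a₂ n)

  pell-suc : ∀ {n} → Odd n → + pell (suc n) ≡ + 2 * + pell n + + pell (ℕ.pred n)
  pell-suc one        = refl
  pell-suc (ss {n} _) = cong (_+ + pell (suc n)) (ℤP.pos-* 2 (pell (2 ℕ.+ n)))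

  module _ {n : ℕ} (o : Odd n) where

    -- Here `u n = h n`, and `P_n` is eliminated from the two Pell relations: `2h P_(n-1)` is twice
    -- the second minus the first.
    pell-below : ∀ {b₁ b₃ η} → Twist n b₁ b₃ (+ 1) η →
      + 2 * (u n * + pell (ℕ.pred n)) ≡
      + 2 * (b₃ * a₀ n - a₀ n * b₁ - b₁ * a₂ n - a₂ n * b₃) - (a₀ n * a₀ n + b₁ * b₁ + a₂ n * a₂ n + b₃ * b₃)
    pell-below tw rewrite Twist.u-eq tw | sym (Twist.a₁-eq tw) | sym (Twist.a₃-eq tw)
      | proj₁ (pell-relations o) | proj₂ (pell-relations o) = lemma (h n) (+ pell n) (+ pell (ℕ.pred n))
      where
      lemma : ∀ h P P′ → + 2 * (+ 1 * h * P′) ≡ + 2 * (h * (P + P′)) - + 2 * (h * P)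
      lemma = solve-∀

    -- Here `u n = - h n`. Since `P_(n+1) = 2 P_n + P_(n-1)`, the number `2h P_(n+1)` is twice the
    -- second Pell relation plus the first.
    pell-above : ∀ {b₁ b₃ η} → Twist n b₁ b₃ (- + 1) η →
      + 2 * (u n * + pell (suc n)) ≡
      - (+ 2 * (b₃ * a₀ n - a₀ n * b₁ - b₁ * a₂ n - a₂ n * b₃) + (a₀ n * a₀ n + b₁ * b₁ + a₂ n * a₂ n + b₃ * b₃))
    pell-above tw = trans (cong (λ z → + 2 * (u n * z)) (pell-suc o)) (pell-above′ tw)
      where
      pell-above′ : ∀ {b₁ b₃ η} → Twist n b₁ b₃ (- + 1) η →
        + 2 * (u n * (+ 2 * + pell n + + pell (ℕ.pred n))) ≡
        - (+ 2 * (b₃ * a₀ n - a₀ n * b₁ - b₁ * a₂ n - a₂ n * b₃) + (a₀ n * a₀ n + b₁ * b₁ + a₂ n * a₂ n + b₃ * b₃))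
      pell-above′ tw rewrite Twist.u-eq tw | sym (Twist.a₁-eq tw) | sym (Twist.a₃-eq tw)
        | proj₁ (pell-relations o) | proj₂ (pell-relations o) = lemma (h n) (+ pell n) (+ pell (ℕ.pred n))
        where
        lemma : ∀ h P P′ → + 2 * (- + 1 * h * (+ 2 * P + P′)) ≡ - (+ 2 * (h * (P + P′)) + + 2 * (h * P))
        lemma = solve-∀

    u-twist : ∀ {b₁ b₃ ε η} → Twist n b₁ b₃ ε η → u n ≡ a₀ n * a₀ n - a₂ n * a₂ n + + 2 * (b₁ * b₃)
    u-twist tw rewrite sym (Twist.a₁-eq tw) | sym (Twist.a₃-eq tw) = sym (proj₁ (norm-relations n))

    relations₁ : Residue₁ n → Relations n (+ 1) (+ pell (ℕ.pred n))
    relations₁ tw = record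
      { u-norm = trans (u-twist tw) (lemma₁ (a₀ n) (a₂ n))
      ; u-pell = ℤP.*-cancelˡ-≡ (+ 2) _ _ (trans (pell-below tw) (lemma₂ (a₀ n) (a₂ n))) }
      where
      lemma₁ : ∀ a c → a * a - c * c + + 2 * (- a * c) ≡ a * a - c * c - + 2 * + 1 * (a * c)
      lemma₁ = solve-∀
      lemma₂ : ∀ a c → + 2 * (c * a - a * - a - - a * c - c * c) - (a * a + - a * - a + c * c + c * c)
        ≡ + 2 * (+ 2 * + 1 * (a * c) - + 2 * (c * c))
      lemma₂ = solve-∀

    relations₇ : Residue₇ n → Relations n (- + 1) (+ pell (ℕ.pred n))
    relations₇ tw = record
      { u-norm = trans (u-twist tw) (lemma₁ (a₀ n) (a₂ n))
      ; u-pell = ℤP.*-cancelˡ-≡ (+ 2) _ _ (trans (pell-below tw) (lemma₂ (a₀ n) (a₂ n))) }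
      where
      lemma₁ : ∀ a c → a * a - c * c + + 2 * (c * a) ≡ a * a - c * c - + 2 * - + 1 * (a * c)
      lemma₁ = solve-∀
      lemma₂ : ∀ a c → + 2 * (a * a - a * c - c * c - c * a) - (a * a + c * c + c * c + a * a)
        ≡ + 2 * (+ 2 * - + 1 * (a * c) - + 2 * (c * c))
      lemma₂ = solve-∀

    relations₃ : Residue₃ n → Relations n (- + 1) (+ pell (suc n))
    relations₃ tw = record
      { u-norm = trans (u-twist tw) (lemma₁ (a₀ n) (a₂ n))
      ; u-pell = ℤP.*-cancelˡ-≡ (+ 2) _ _ (trans (pell-above tw) (lemma₂ (a₀ n) (a₂ n))) }
      where
      lemma₁ : ∀ a c → a * a - c * c + + 2 * (- c * - a) ≡ a * a - c * c - + 2 * - + 1 * (a * c)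
      lemma₁ = solve-∀
      lemma₂ : ∀ a c → - (+ 2 * (- a * a - a * - c - - c * c - c * - a) + (a * a + - c * - c + c * c + - a * - a))
        ≡ + 2 * (+ 2 * - + 1 * (a * c) - + 2 * (c * c))
      lemma₂ = solve-∀

    relations₅ : Residue₅ n → Relations n (+ 1) (+ pell (suc n))
    relations₅ tw = record
      { u-norm = trans (u-twist tw) (lemma₁ (a₀ n) (a₂ n))
      ; u-pell = ℤP.*-cancelˡ-≡ (+ 2) _ _ (trans (pell-above tw) (lemma₂ (a₀ n) (a₂ n))) }
      where
      lemma₁ : ∀ a c → a * a - c * c + + 2 * (a * - c) ≡ a * a - c * c - + 2 * + 1 * (a * c)
      lemma₁ = solve-∀
      lemma₂ : ∀ a c → - (+ 2 * (- c * a - a * a - a * c - c * - c) + (a * a + a * a + c * c + - c * - c))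
        ≡ + 2 * (+ 2 * + 1 * (a * c) - + 2 * (c * c))
      lemma₂ = solve-∀

  periodic : ∀ m (f : Series) → (∀ j → f (m ℕ.+ j) ≡ f j) → ∀ s N → f (s ℕ.+ N ℕ.* m) ≡ f s
  periodic m f per s zero    = cong f (ℕP.+-identityʳ s)
  periodic m f per s (suc N) = trans (cong f (begin
      s ℕ.+ (m ℕ.+ N ℕ.* m)   ≡⟨ ℕP.+-assoc s m (N ℕ.* m) ⟨
      s ℕ.+ m ℕ.+ N ℕ.* m     ≡⟨ cong (ℕ._+ N ℕ.* m) (ℕP.+-comm s m) ⟩
      m ℕ.+ s ℕ.+ N ℕ.* m     ≡⟨ ℕP.+-assoc m s (N ℕ.* m) ⟩
      m ℕ.+ (s ℕ.+ N ℕ.* m)   ∎))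
    (trans (per (s ℕ.+ N ℕ.* m)) (periodic m f per s N))
    where open ≡-Reasoning

  -- Pairing with a periodic sequence only depends on the sums of `g` over residue classes; this
  -- links the values at roots of unity to those sums.
  Σ-periodic : ∀ m N (g f : Series) → (∀ j → f (m ℕ.+ j) ≡ f j) →
    Σ (N ℕ.* m) (λ j → g j * f j) ≡ Σ m (λ s → Σ N (λ i → g (s ℕ.+ i ℕ.* m)) * f s)
  Σ-periodic m zero    g f per = sym (Σ-zero m (λ s → ℤP.*-zeroˡ (f s)))
  Σ-periodic m (suc N) g f per = begin
    Σ (m ℕ.+ N ℕ.* m) (λ j → g j * f j)
      ≡⟨ Σ-split m (N ℕ.* m) (λ j → g j * f j) ⟩
    Σ (N ℕ.* m) (λ j → g j * f j) + Σ m (λ s → g (s ℕ.+ N ℕ.* m) * f (s ℕ.+ N ℕ.* m))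
      ≡⟨ cong₂ _+_ (Σ-periodic m N g f per) (Σ-cong m (λ s → cong (g (s ℕ.+ N ℕ.* m) *_) (periodic m f per s N))) ⟩
    Σ m (λ s → B s * f s) + Σ m (λ s → g (s ℕ.+ N ℕ.* m) * f s)
      ≡⟨ Σ-+-distrib m (λ s → B s * f s) (λ s → g (s ℕ.+ N ℕ.* m) * f s) ⟨
    Σ m (λ s → B s * f s + g (s ℕ.+ N ℕ.* m) * f s)
      ≡⟨ Σ-cong m (λ s → sym (ℤP.*-distribʳ-+ (f s) (B s) (g (s ℕ.+ N ℕ.* m)))) ⟩
    Σ m (λ s → (B s + g (s ℕ.+ N ℕ.* m)) * f s) ∎
    where
    open ≡-Reasoning
    B : Series
    B s = Σ N (λ i → g (s ℕ.+ i ℕ.* m))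

  odd-1+4t : ∀ t → Odd (1 ℕ.+ t ℕ.* 4)
  odd-1+4t zero    = one
  odd-1+4t (suc t) = ss (ss (odd-1+4t t))

  odd-1+8t : ∀ t → Odd (1 ℕ.+ t ℕ.* 8)
  odd-1+8t zero    = one
  odd-1+8t (suc t) = ss (ss (ss (ss (odd-1+8t t))))

  uv-1+4t : ∀ t → v (1 ℕ.+ t ℕ.* 4) ≡ - u (1 ℕ.+ t ℕ.* 4)
  uv-1+4t zero    = refl
  uv-1+4t (suc t) = begin
    v (4 ℕ.+ m)                ≡⟨ v-2+ (2 ℕ.+ m) ⟩
    - (+ 2 * u (2 ℕ.+ m))      ≡⟨ cong (λ z → - (+ 2 * z)) (trans (u-2+ m) (trans (cong (+ 2 *_) (uv-1+4t t)) (lemma (u m)))) ⟩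
    - (+ 2 * - (+ 2 * u m))    ≡⟨ cong (λ z → - (+ 2 * z)) (v-2+ m) ⟨
    - (+ 2 * v (2 ℕ.+ m))      ≡⟨ cong -_ (u-2+ (2 ℕ.+ m)) ⟨
    - u (4 ℕ.+ m)              ∎
    where
    open ≡-Reasoning
    m = 1 ℕ.+ t ℕ.* 4
    lemma : ∀ a → + 2 * - a ≡ - (+ 2 * a)
    lemma = solve-∀

  uv-3+4t : ∀ t → v (3 ℕ.+ t ℕ.* 4) ≡ u (3 ℕ.+ t ℕ.* 4)
  uv-3+4t t = trans (v-2+ m) (trans (lemma (u m)) (trans (cong (+ 2 *_) (sym (uv-1+4t t))) (sym (u-2+ m))))
    where
    m = 1 ℕ.+ t ℕ.* 4
    lemma : ∀ a → - (+ 2 * a) ≡ + 2 * - a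
    lemma = solve-∀

  re-odd : ∀ {n} → Odd n → re n ≡ + 0
  re-odd one    = refl
  re-odd (ss o) = cong -_ (re-odd o)

  ζ-odd : ∀ {n} → Odd n → ζ₀ n ≡ + 0 × ζ₂ n ≡ + 0
  ζ-odd one    = refl , refl
  ζ-odd (ss o) = cong -_ (proj₂ (ζ-odd o)) , proj₁ (ζ-odd o)

  infixr 4 _⊕_
  infixr 5 _⊗_

  -- Together with `_⊗_` this lets a divisibility proof be written as the linear combination that
  -- proves it. Both are right associative, and the accompanying ring identities nest their sums
  -- accordingly.
  _⊕_ : ∀ {m a b} → m ∣ a → m ∣ b → m ∣ a + b
  _⊕_ = ∣m∣n⇒∣m+n

  _⊗_ : ∀ {m b} a → m ∣ b → m ∣ a * b
  a ⊗ h = ∣n⇒∣m*n a h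

  -- Linear relations modulo p² between the values at roots of unity.

  module OddModulus (n : ℕ) (pr : Prime (suc n)) (o : Odd (suc n)) where

    open QuadModulus n pr public

    e-diagonal : ∀ {m} → Odd m → e m m ≡ - + 1
    e-diagonal one             = refl
    e-diagonal (ss {suc m} o′) = begin
      e (2 ℕ.+ m) (3 ℕ.+ m) - (e (suc m) (2 ℕ.+ m) - e (suc m) (suc m))
        ≡⟨ cong₂ (λ a b → a - (b - e (suc m) (suc m))) (e-vanish (ℕP.n<1+n (2 ℕ.+ m))) (e-vanish (ℕP.n<1+n (suc m))) ⟩
      + 0 - (+ 0 - e (suc m) (suc m))
        ≡⟨ cong (λ a → + 0 - (+ 0 - a)) (e-diagonal o′) ⟩
      - + 1 ∎
      where open ≡-Reasoning

    -- The congruence `(1 - x)^p ≡ 1 - x^p` modulo p, paired with `χ`: only the two end terms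
    -- survive.
    ℒ-mod : ∀ χ → ℒ p χ ≡ χ 0 - χ p [mod + p ]
    ℒ-mod χ = mod-trans (≡⇒mod (ℒ-Σ p (suc p) χ ℕP.≤-refl))
      (mod-+ (go n ℕP.≤-refl) (≡⇒mod (trans (cong (_* χ p) (e-diagonal o)) (ℤP.-1*i≡-i (χ p)))))
      where
      go : ∀ N → N ℕ.≤ n → Σ (suc N) (λ j → e p j * χ j) ≡ χ 0 [mod + p ]
      go zero    _  = ≡⇒mod (trans (ℤP.+-identityˡ (e p 0 * χ 0)) (trans (cong (_* χ 0) (e-zero p)) (ℤP.*-identityˡ (χ 0))))
      go (suc N) le = mod-trans
        (mod-+ (go N (ℕP.<⇒≤ le)) (∣⇒mod (∣m⇒∣m*n (χ (suc N)) (e-∣-< (s≤s le)))))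
        (≡⇒mod (ℤP.+-identityʳ (χ 0)))

    ℒ-mod-0 : ∀ χ → χ p ≡ + 0 → ℒ p χ ≡ χ 0 [mod + p ]
    ℒ-mod-0 χ χp = mod-trans (ℒ-mod χ) (≡⇒mod (trans (cong (λ z → χ 0 - z) χp) (ℤP.+-identityʳ (χ 0))))

    -- `Q` is p times the Fermat quotient of 2. Modulo p the other three are 1, 1 and 0, which is
    -- the starting point of every linearisation below.
    U A₀ A₂ Q : ℤ
    U  = u p
    A₀ = a₀ p
    A₂ = a₂ p
    Q  = (+ 2) ^ n - + 1

    U≡1 : + p ∣ U - + 1
    U≡1 = difference (ℒ-mod-0 re (re-odd o))

    A₀≡1 : + p ∣ A₀ - + 1
    A₀≡1 = difference (ℒ-mod-0 ζ₀ (proj₁ (ζ-odd o)))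

    A₂≡0 : + p ∣ A₂
    A₂≡0 = mod⇒∣ (ℒ-mod-0 ζ₂ (proj₂ (ζ-odd o)))

    -- `U² = 2^(p-1) = 1 + Q`, and the square of `U - 1` is 0 modulo p².
    U-Q : p² ∣ + 2 * (U - + 1) - Q
    U-Q = ∣-by (trans (cong (λ z → + 2 * (U - + 1) - (z - + 1)) (sym (proj₁ (u²-odd o)))) (lemma U))
      (-[1+ 0 ] ⊗ product-∣ U≡1 U≡1)
      where
      lemma : ∀ u → + 2 * (u - + 1) - (u * u - + 1) ≡ -[1+ 0 ] * ((u - + 1) * (u - + 1))
      lemma = solve-∀

    module Solve (s X : ℤ) (R : Relations p s X) where

      open Relations R

      X≡0 : + p ∣ X
      X≡0 = ∣-by (trans (lemma₁ U X) (trans (cong (_- (U - + 1) * X) u-pell) (lemma₂ s A₀ A₂ U X)))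
        ((+ 2 * s * A₀ - + 2 * A₂) ⊗ A₂≡0 ⊕ (- X) ⊗ U≡1)
        where
        lemma₁ : ∀ u x → x ≡ u * x - (u - + 1) * x
        lemma₁ = solve-∀
        lemma₂ : ∀ s a c u x → + 2 * s * (a * c) - + 2 * (c * c) - (u - + 1) * x
          ≡ (+ 2 * s * a - + 2 * c) * c + - x * (u - + 1)
        lemma₂ = solve-∀

      -- Linearises `u-pell` at `U = A₀ = 1` and `X = A₂ = 0`; the Pell number thereby determines
      -- `A₂`.
      X-A₂ : p² ∣ X - + 2 * s * A₂
      X-A₂ = ∣-by (trans (lemma₁ U X s A₂) (trans (cong (λ z → z - (U - + 1) * X - + 2 * s * A₂) u-pell) (lemma₂ s A₀ A₂ U X)))
        (+ 2 * s ⊗ product-∣ A₀≡1 A₂≡0 ⊕ (- + 2) ⊗ product-∣ A₂≡0 A₂≡0 ⊕ (- + 1) ⊗ product-∣ U≡1 X≡0)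
        where
        lemma₁ : ∀ u x s c → x - + 2 * s * c ≡ u * x - (u - + 1) * x - + 2 * s * c
        lemma₁ = solve-∀
        lemma₂ : ∀ s a c u x → + 2 * s * (a * c) - + 2 * (c * c) - (u - + 1) * x - + 2 * s * c
          ≡ + 2 * s * ((a - + 1) * c) + (- + 2 * (c * c) + - + 1 * ((u - + 1) * x))
        lemma₂ = solve-∀

      -- Linearises `u-norm` to `U - 1 ≡ 2 (A₀ - 1) - 2 s A₂`; doubling and `U-Q` replace `U` by
      -- `Q`.
      A₀-A₂ : p² ∣ + 4 * (A₀ - + 1) - Q - + 4 * s * A₂
      A₀-A₂ = ∣-by (trans (lemma₁ U A₀ Q s A₂) (trans (cong (λ z → + 2 * (U - + 1) - Q + (+ 4 * (A₀ - + 1) - + 2 * (z - + 1)) - + 4 * s * A₂) u-norm)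
          (lemma₂ A₀ s A₂ (+ 2 * (U - + 1) - Q))))
        (U-Q ⊕ - + 2 ⊗ product-∣ A₀≡1 A₀≡1 ⊕ + 2 ⊗ product-∣ A₂≡0 A₂≡0 ⊕ + 4 * s ⊗ product-∣ A₀≡1 A₂≡0)
        where
        lemma₁ : ∀ u a q s c → + 4 * (a - + 1) - q - + 4 * s * c
          ≡ + 2 * (u - + 1) - q + (+ 4 * (a - + 1) - + 2 * (u - + 1)) - + 4 * s * c
        lemma₁ = solve-∀
        lemma₂ : ∀ a s c w → w + (+ 4 * (a - + 1) - + 2 * (a * a - c * c - + 2 * s * (a * c) - + 1)) - + 4 * s * c
          ≡ w + (- + 2 * ((a - + 1) * (a - + 1)) + (+ 2 * (c * c) + + 4 * s * ((a - + 1) * c)))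
        lemma₂ = solve-∀

    -- Padding the row to `4N` entries adds only zeros and makes its length a multiple of the
    -- period, so each `D s` is a complete class.
    module Sums₄ (N : ℕ) (lt : p ℕ.< N ℕ.* 4) where

      D : Series
      D s = Σ N (λ i → e p (s ℕ.+ i ℕ.* 4))

      expand : ∀ χ → (∀ j → χ (4 ℕ.+ j) ≡ χ j) → ℒ p χ ≡ Σ 4 (λ s → D s * χ s)
      expand χ per = trans (ℒ-Σ p (N ℕ.* 4) χ lt) (Σ-periodic 4 N (e p) χ per)

      D₀-D₂ : U ≡ D 0 - D 2
      D₀-D₂ = trans (expand re (λ j → ℤP.neg-involutive (re j))) (lemma (D 0) (D 1) (D 2) (D 3))
        where
        lemma : ∀ a b c d → + 0 + a * + 1 + b * + 0 + c * - + 1 + d * + 0 ≡ a - c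
        lemma = solve-∀

      D₁-D₃ : v p ≡ D 1 - D 3
      D₁-D₃ = trans (expand im (λ j → ℤP.neg-involutive (im j))) (lemma (D 0) (D 1) (D 2) (D 3))
        where
        lemma : ∀ a b c d → + 0 + a * + 0 + b * + 1 + c * + 0 + d * - + 1 ≡ b - d
        lemma = solve-∀

      D₀+D₂ : D 0 + D 2 ≡ + 1 + Q
      D₀+D₂ = trans (sym (trans (expand even (λ j → refl)) (lemma (D 0) (D 1) (D 2) (D 3))))
        (trans (proj₁ (even-ℒ n)) (lemma′ ((+ 2) ^ n)))
        where
        lemma : ∀ a b c d → + 0 + a * + 1 + b * + 0 + c * + 1 + d * + 0 ≡ a + c
        lemma = solve-∀
        lemma′ : ∀ a → a ≡ + 1 + (a - + 1)
        lemma′ = solve-∀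

      D₁+D₃ : D 1 + D 3 ≡ - (+ 1 + Q)
      D₁+D₃ = trans (sym (trans (expand odd (λ j → refl)) (lemma (D 0) (D 1) (D 2) (D 3))))
        (trans (proj₂ (even-ℒ n)) (lemma′ ((+ 2) ^ n)))
        where
        lemma : ∀ a b c d → + 0 + a * + 0 + b * + 1 + c * + 0 + d * + 1 ≡ b + d
        lemma = solve-∀
        lemma′ : ∀ a → - a ≡ - (+ 1 + (a - + 1))
        lemma′ = solve-∀

    module Sums₈ (N : ℕ) (lt : p ℕ.< N ℕ.* 8) where

      B : Series
      B s = Σ N (λ i → e p (s ℕ.+ i ℕ.* 8))

      expand : ∀ χ → (∀ j → χ (8 ℕ.+ j) ≡ χ j) → ℒ p χ ≡ Σ 8 (λ s → B s * χ s)
      expand χ per = trans (ℒ-Σ p (N ℕ.* 8) χ lt) (Σ-periodic 8 N (e p) χ per)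

      B₀-B₄ : A₀ ≡ B 0 - B 4
      B₀-B₄ = trans (expand ζ₀ (λ j → ℤP.neg-involutive (ζ₀ j)))
        (lemma (B 0) (B 1) (B 2) (B 3) (B 4) (B 5) (B 6) (B 7))
        where
        lemma : ∀ a b c d a′ b′ c′ d′ → + 0 + a * + 1 + b * + 0 + c * + 0 + d * + 0
          + a′ * - + 1 + b′ * + 0 + c′ * + 0 + d′ * + 0 ≡ a - a′
        lemma = solve-∀

      B₂-B₆ : A₂ ≡ B 2 - B 6
      B₂-B₆ = trans (expand ζ₂ (λ j → ℤP.neg-involutive (ζ₂ j)))
        (lemma (B 0) (B 1) (B 2) (B 3) (B 4) (B 5) (B 6) (B 7))
        where
        lemma : ∀ a b c d a′ b′ c′ d′ → + 0 + a * + 0 + b * + 0 + c * + 1 + d * + 0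
          + a′ * + 0 + b′ * + 0 + c′ * - + 1 + d′ * + 0 ≡ c - c′
        lemma = solve-∀

      B-alternating : U ≡ B 0 - B 2 + B 4 - B 6
      B-alternating = trans (expand re (λ j → trans (ℤP.neg-involutive _) (ℤP.neg-involutive (re j))))
        (lemma (B 0) (B 1) (B 2) (B 3) (B 4) (B 5) (B 6) (B 7))
        where
        lemma : ∀ a b c d a′ b′ c′ d′ → + 0 + a * + 1 + b * + 0 + c * - + 1 + d * + 0
          + a′ * + 1 + b′ * + 0 + c′ * - + 1 + d′ * + 0 ≡ a - c + a′ - c′
        lemma = solve-∀

      B-sum : B 0 + B 2 + B 4 + B 6 ≡ + 1 + Q
      B-sum = trans (sym (trans (expand even (λ j → refl))
          (lemma (B 0) (B 1) (B 2) (B 3) (B 4) (B 5) (B 6) (B 7))))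
        (trans (proj₁ (even-ℒ n)) (lemma′ ((+ 2) ^ n)))
        where
        lemma : ∀ a b c d a′ b′ c′ d′ → + 0 + a * + 1 + b * + 0 + c * + 1 + d * + 0
          + a′ * + 1 + b′ * + 0 + c′ * + 1 + d′ * + 0 ≡ a + c + a′ + c′
        lemma = solve-∀
        lemma′ : ∀ a → a ≡ + 1 + (a - + 1)
        lemma′ = solve-∀

  module Solve₈ (n : ℕ) (pr : Prime (suc n)) (o : Odd (suc n)) (s X : ℤ) (R : Relations (suc n) s X)
    (N : ℕ) (lt : suc n ℕ.< N ℕ.* 8) where

    open OddModulus n pr o
    open Solve s X R
    open Sums₈ N lt

    -- The B s with s even are combinations of the values U, A₀, A₂ and 1 + Q of (1 - x)^p at roots of unity.
    B₀ : p² ∣ + 8 * (B 0 - + 1) - (+ 4 * Q + + 2 * X)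
    B₀ = ∣-by (trans (lemma₁ (B 0) (B 2) (B 4) (B 6) Q X)
        (trans (cong₂ (λ y z → y + + 4 * z - + 8 - (+ 4 * Q + + 2 * X))
            (cong₂ (λ y z → + 2 * y + + 2 * z) B-sum (sym B-alternating)) (sym B₀-B₄))
          (lemma₂ Q U A₀ A₂ s X)))
      (U-Q ⊕ A₀-A₂ ⊕ - + 2 ⊗ X-A₂)
      where
      lemma₁ : ∀ a b c d q x → + 8 * (a - + 1) - (+ 4 * q + + 2 * x) ≡
        + 2 * (a + b + c + d) + + 2 * (a - b + c - d) + + 4 * (a - c) - + 8 - (+ 4 * q + + 2 * x)
      lemma₁ = solve-∀
      lemma₂ : ∀ q u a₀ a₂ s x → + 2 * (+ 1 + q) + + 2 * u + + 4 * a₀ - + 8 - (+ 4 * q + + 2 * x) ≡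
        + 2 * (u - + 1) - q + (+ 4 * (a₀ - + 1) - q - + 4 * s * a₂ + - + 2 * (x - + 2 * s * a₂))
      lemma₂ = solve-∀

    B₄ : p² ∣ + 8 * B 4 - (+ 2 * Q - + 2 * X)
    B₄ = ∣-by (trans (lemma₁ (B 0) (B 2) (B 4) (B 6) Q X)
        (trans (cong₂ (λ y z → y - + 4 * z - (+ 2 * Q - + 2 * X))
            (cong₂ (λ y z → + 2 * y + + 2 * z) B-sum (sym B-alternating)) (sym B₀-B₄))
          (lemma₂ Q U A₀ A₂ s X)))
      (U-Q ⊕ - + 1 ⊗ A₀-A₂ ⊕ + 2 ⊗ X-A₂)
      where
      lemma₁ : ∀ a b c d q x → + 8 * c - (+ 2 * q - + 2 * x) ≡
        + 2 * (a + b + c + d) + + 2 * (a - b + c - d) - + 4 * (a - c) - (+ 2 * q - + 2 * x)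
      lemma₁ = solve-∀
      lemma₂ : ∀ q u a₀ a₂ s x → + 2 * (+ 1 + q) + + 2 * u - + 4 * a₀ - (+ 2 * q - + 2 * x) ≡
        + 2 * (u - + 1) - q + (- + 1 * (+ 4 * (a₀ - + 1) - q - + 4 * s * a₂) + + 2 * (x - + 2 * s * a₂))
      lemma₂ = solve-∀

    B₂ : p² ∣ + 8 * B 2 - (Q + + 4 * A₂)
    B₂ = ∣-by (trans (lemma₁ (B 0) (B 2) (B 4) (B 6) Q A₂)
        (trans (cong₂ (λ y z → y + + 4 * z - (Q + + 4 * A₂))
            (cong₂ (λ y z → + 2 * y - + 2 * z) B-sum (sym B-alternating)) (sym B₂-B₆))
          (lemma₂ Q U A₂)))
      (- + 1 ⊗ U-Q)
      where
      lemma₁ : ∀ a b c d q x → + 8 * b - (q + + 4 * x) ≡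
        + 2 * (a + b + c + d) - + 2 * (a - b + c - d) + + 4 * (b - d) - (q + + 4 * x)
      lemma₁ = solve-∀
      lemma₂ : ∀ q u a₂ → + 2 * (+ 1 + q) - + 2 * u + + 4 * a₂ - (q + + 4 * a₂) ≡ - + 1 * (+ 2 * (u - + 1) - q)
      lemma₂ = solve-∀

    B₆ : p² ∣ + 8 * B 6 - (Q - + 4 * A₂)
    B₆ = ∣-by (trans (lemma₁ (B 0) (B 2) (B 4) (B 6) Q A₂)
        (trans (cong₂ (λ y z → y - + 4 * z - (Q - + 4 * A₂))
            (cong₂ (λ y z → + 2 * y - + 2 * z) B-sum (sym B-alternating)) (sym B₂-B₆))
          (lemma₂ Q U A₂)))
      (- + 1 ⊗ U-Q)
      where
      lemma₁ : ∀ a b c d q x → + 8 * d - (q - + 4 * x) ≡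
        + 2 * (a + b + c + d) - + 2 * (a - b + c - d) - + 4 * (b - d) - (q - + 4 * x)
      lemma₁ = solve-∀
      lemma₂ : ∀ q u a₂ → + 2 * (+ 1 + q) - + 2 * u - + 4 * a₂ - (q - + 4 * a₂) ≡ - + 1 * (+ 2 * (u - + 1) - q)
      lemma₂ = solve-∀

  -- The index (p-1)/2, according to p modulo 8.

  <8 : ∀ {r} t → r ℕ.< 8 → r ℕ.+ t ℕ.* 8 ℕ.< suc t ℕ.* 8
  <8 t lt = ℕP.+-monoˡ-< (t ℕ.* 8) lt

  below : ∀ {c r i t} → c ℕ.< r → i ℕ.< suc t → c ℕ.+ i ℕ.* 8 ℕ.< r ℕ.+ t ℕ.* 8
  below c<r (s≤s i≤t) = ℕP.+-mono-<-≤ c<r (ℕP.*-monoˡ-≤ 8 i≤t)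

  quarter≤half : ∀ c t {m} → c ℕ.≤ m → c ℕ.+ t ℕ.* 4 ℕ.≤ m ℕ.+ t ℕ.* 8
  quarter≤half c t c≤m = ℕP.+-mono-≤ c≤m (ℕP.*-monoʳ-≤ t (ℕP.m≤m+n 4 4))

  Σ-multiples-8 : ∀ N s → Σ N (λ i → s (8 ℕ.* i)) ≡ Σ N (λ i → s (i ℕ.* 8))
  Σ-multiples-8 N s = Σ-cong N (λ i → cong s (ℕP.*-comm 8 i))

  module Case₁ (t : ℕ) (pr : Prime (1 ℕ.+ t ℕ.* 8)) where

    o : Odd (1 ℕ.+ t ℕ.* 8)
    o = odd-1+8t t

    open OddModulus (t ℕ.* 8) pr o
    open Solve (+ 1) (+ pell (t ℕ.* 8)) (relations₁ o (residue₁ t))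
    open Sums₈ (suc t) (<8 t (s≤s (s≤s z≤n)))
    open Solve₈ (t ℕ.* 8) pr o (+ 1) (+ pell (t ℕ.* 8)) (relations₁ o (residue₁ t)) (suc t) (<8 t (s≤s (s≤s z≤n)))

    -- Stretching turns `E - S₀ + S₃` into `6 (B 0 - 1) + 2 (B 6)`. Four times this is
    -- `3 (4Q + 2X) + (Q - 4 A₂)`, so 13 arises as 3·4 + 1, and `X ≡ 2 A₂` leaves `4X`.
    quad-half : ∀ N → p² ∣ + 4 * + quad (suc N ℕ.* p ℕ.∸ 1) (t ℕ.* 4) -
      (+ 4 + + suc N * (+ 13 * Q + + 4 * + pell (t ℕ.* 8)))
    quad-half N = ∣-by (lemma (+ quad (suc N ℕ.* p ℕ.∸ 1) (t ℕ.* 4)) (+ suc N) (Σ (suc t) (e p))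
        (Σ (suc t) (λ i → e p (i ℕ.* 4))) (Σ t (λ i → e p (3 ℕ.+ i ℕ.* 4)))
        (B 0) (B 6) Q (+ pell (t ℕ.* 8)) A₂)
      (+ 4 ⊗ difference (quad-mod-0 N t (quarter≤half 0 t z≤n))
        ⊕ + 4 * c ⊗ difference E ⊕ - + 4 * c ⊗ difference S₀ ⊕ + 4 * c ⊗ difference S₃
        ⊕ + 3 * c ⊗ B₀ ⊕ c ⊗ B₆ ⊕ + 2 * c ⊗ X-A₂)
      where
      c = + suc N
      E : Σ (suc t) (e p) ≡ + 1 + + 8 * (B 0 - + 1) [mod p² ]
      E = subst (λ z → Σ (suc t) (e p) ≡ + 1 + + 8 * (z - + 1) [mod p² ]) (Σ-multiples-8 (suc t) (e p))
        (Σ-e-multiples 8 t (s≤s z≤n) (s≤s (ℕP.≤-reflexive (ℕP.*-comm 8 t))))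
      S₀ : Σ (suc t) (λ i → e p (i ℕ.* 4)) ≡ + 1 + + 2 * (B 0 - + 1) [mod p² ]
      S₀ = Σ-e-double-0 t ℕP.≤-refl
      S₃ : Σ t (λ i → e p (3 ℕ.+ i ℕ.* 4)) ≡ + 2 * B 6 [mod p² ]
      S₃ = mod-trans (Σ-e-double t 3 (λ _ _ → s≤s z≤n)
          (λ i lt → ℕP.≤-trans (ℕP.+-monoˡ-≤ (i ℕ.* 8) (ℕP.m≤m+n 7 1)) (ℕP.m≤n⇒m≤1+n (ℕP.*-monoˡ-≤ 8 lt))))
        -- `B 6` has one term more than the stretched sum, at index `6 + 8t`, which exceeds p; its
        -- coefficient is 0.
        (≡⇒mod (cong (+ 2 *_) (sym (trans (cong (λ z → Σ t (λ i → e p (6 ℕ.+ i ℕ.* 8)) + z)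
          (e-vanish (ℕP.+-monoˡ-≤ (t ℕ.* 8) (s≤s (s≤s z≤n))))) (ℤP.+-identityʳ _)))))
      lemma : ∀ M c E S₀ S₃ B₀ B₆ Q X A₂ → + 4 * M - (+ 4 + c * (+ 13 * Q + + 4 * X)) ≡
        + 4 * (M - (+ 1 + c * (E - (S₀ - S₃)))) + (+ 4 * c * (E - (+ 1 + + 8 * (B₀ - + 1)))
        + (- + 4 * c * (S₀ - (+ 1 + + 2 * (B₀ - + 1))) + (+ 4 * c * (S₃ - + 2 * B₆)
        + (+ 3 * c * (+ 8 * (B₀ - + 1) - (+ 4 * Q + + 2 * X)) + (c * (+ 8 * B₆ - (Q - + 4 * A₂))
        + + 2 * c * (X - + 2 * + 1 * A₂))))))
      lemma = solve-∀

  module Case₃ (t : ℕ) (pr : Prime (3 ℕ.+ t ℕ.* 8)) where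

    o : Odd (3 ℕ.+ t ℕ.* 8)
    o = ss (odd-1+8t t)

    X : ℤ
    X = + pell (4 ℕ.+ t ℕ.* 8)

    open OddModulus (2 ℕ.+ t ℕ.* 8) pr o
    open Solve (- + 1) X (relations₃ o (residue₃ t))
    open Sums₈ (suc t) (<8 t (ℕP.m≤m+n 4 4))
    open Solve₈ (2 ℕ.+ t ℕ.* 8) pr o (- + 1) X (relations₃ o (residue₃ t)) (suc t) (<8 t (ℕP.m≤m+n 4 4))

    -- Stretching leaves `-(6 (B 0 - 1) + 2 (B 2))`. As now `X ≡ -2 A₂`, the term `4 A₂` in `B₂`
    -- again reduces `6X` to `4X`.
    quad-half : ∀ N → p² ∣ + 4 * + quad (suc N ℕ.* p ℕ.∸ 1) (1 ℕ.+ t ℕ.* 4) -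
      (- + 4 - + suc N * (+ 13 * Q + + 4 * X))
    quad-half N = ∣-by (lemma (+ quad (suc N ℕ.* p ℕ.∸ 1) (1 ℕ.+ t ℕ.* 4)) (+ suc N) (Σ (suc t) (e p))
        (Σ (suc t) (λ i → e p (i ℕ.* 4))) (Σ (suc t) (λ i → e p (1 ℕ.+ i ℕ.* 4)))
        (B 0) (B 2) Q X A₂)
      (+ 4 ⊗ difference (quad-mod-1 N t (quarter≤half 1 t (s≤s z≤n)))
        ⊕ - + 4 * c ⊗ difference E ⊕ + 4 * c ⊗ difference S₀ ⊕ - + 4 * c ⊗ difference S₁
        ⊕ - + 3 * c ⊗ B₀ ⊕ - c ⊗ B₂ ⊕ - + 2 * c ⊗ X-A₂)
      where
      c = + suc N
      t*8< : t ℕ.* 8 ℕ.< p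
      t*8< = ℕP.m≤n+m (suc (t ℕ.* 8)) 2
      E : Σ (suc t) (e p) ≡ + 1 + + 8 * (B 0 - + 1) [mod p² ]
      E = subst (λ z → Σ (suc t) (e p) ≡ + 1 + + 8 * (z - + 1) [mod p² ]) (Σ-multiples-8 (suc t) (e p))
        (Σ-e-multiples 8 t (s≤s z≤n) (subst (ℕ._< p) (ℕP.*-comm t 8) t*8<))
      S₀ : Σ (suc t) (λ i → e p (i ℕ.* 4)) ≡ + 1 + + 2 * (B 0 - + 1) [mod p² ]
      S₀ = Σ-e-double-0 t t*8<
      S₁ : Σ (suc t) (λ i → e p (1 ℕ.+ i ℕ.* 4)) ≡ + 2 * B 2 [mod p² ]
      S₁ = Σ-e-double (suc t) 1 (λ _ _ → s≤s z≤n) (λ i lt → below {2} {3} (ℕP.n<1+n 2) lt)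
      lemma : ∀ M c E S₀ S₁ B₀ B₂ Q X A₂ → + 4 * M - (- + 4 - c * (+ 13 * Q + + 4 * X)) ≡
        + 4 * (M - (- + 1 + c * (- E - (S₁ - S₀)))) + (- + 4 * c * (E - (+ 1 + + 8 * (B₀ - + 1)))
        + (+ 4 * c * (S₀ - (+ 1 + + 2 * (B₀ - + 1))) + (- + 4 * c * (S₁ - + 2 * B₂)
        + (- + 3 * c * (+ 8 * (B₀ - + 1) - (+ 4 * Q + + 2 * X)) + (- c * (+ 8 * B₂ - (Q + + 4 * A₂))
        + - + 2 * c * (X - + 2 * - + 1 * A₂))))))
      lemma = solve-∀

  module Case₅ (t : ℕ) (pr : Prime (5 ℕ.+ t ℕ.* 8)) where

    o : Odd (5 ℕ.+ t ℕ.* 8)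
    o = ss (ss (odd-1+8t t))

    X : ℤ
    X = + pell (6 ℕ.+ t ℕ.* 8)

    open OddModulus (4 ℕ.+ t ℕ.* 8) pr o
    open Solve (+ 1) X (relations₅ o (residue₅ t))
    open Sums₈ (suc t) (<8 t (ℕP.m≤m+n 6 2))
    open Solve₈ (4 ℕ.+ t ℕ.* 8) pr o (+ 1) X (relations₅ o (residue₅ t)) (suc t) (<8 t (ℕP.m≤m+n 6 2))

    -- For an index that is 2 modulo 4 neither the constant 1 nor the spread series contributes.
    -- What remains is `2 (B 2) - 2 (B 4)`, and `4 A₂ ≡ 2X`.
    quad-half : ∀ N → p² ∣ + 4 * + quad (suc N ℕ.* p ℕ.∸ 1) (2 ℕ.+ t ℕ.* 4) - (- (+ suc N * (Q - + 4 * X)))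
    quad-half N = ∣-by (lemma (+ quad (suc N ℕ.* p ℕ.∸ 1) (2 ℕ.+ t ℕ.* 4)) (+ suc N)
        (Σ (suc t) (λ i → e p (1 ℕ.+ i ℕ.* 4))) (Σ (suc t) (λ i → e p (2 ℕ.+ i ℕ.* 4)))
        (B 2) (B 4) Q X A₂)
      (+ 4 ⊗ difference (quad-mod-2 N t (quarter≤half 2 t (ℕP.m≤m+n 2 2)))
        ⊕ + 4 * c ⊗ difference S₁ ⊕ - + 4 * c ⊗ difference S₂
        ⊕ c ⊗ B₂ ⊕ - c ⊗ B₄ ⊕ - + 2 * c ⊗ X-A₂)
      where
      c = + suc N
      S₁ : Σ (suc t) (λ i → e p (1 ℕ.+ i ℕ.* 4)) ≡ + 2 * B 2 [mod p² ]
      S₁ = Σ-e-double (suc t) 1 (λ _ _ → s≤s z≤n) (λ i lt → below {2} {5} (ℕP.m≤m+n 3 2) lt)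
      S₂ : Σ (suc t) (λ i → e p (2 ℕ.+ i ℕ.* 4)) ≡ + 2 * B 4 [mod p² ]
      S₂ = Σ-e-double (suc t) 2 (λ _ _ → s≤s z≤n) (λ i lt → below {4} {5} (ℕP.n<1+n 4) lt)
      lemma : ∀ M c S₁ S₂ B₂ B₄ Q X A₂ → + 4 * M - (- (c * (Q - + 4 * X))) ≡
        + 4 * (M - (+ 0 + c * (+ 0 - (S₂ - S₁)))) + (+ 4 * c * (S₁ - + 2 * B₂)
        + (- + 4 * c * (S₂ - + 2 * B₄) + (c * (+ 8 * B₂ - (Q + + 4 * A₂))
        + (- c * (+ 8 * B₄ - (+ 2 * Q - + 2 * X)) + - + 2 * c * (X - + 2 * + 1 * A₂)))))
      lemma = solve-∀

  module Case₇ (t : ℕ) (pr : Prime (7 ℕ.+ t ℕ.* 8)) where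

    o : Odd (7 ℕ.+ t ℕ.* 8)
    o = ss (ss (ss (odd-1+8t t)))

    X : ℤ
    X = + pell (6 ℕ.+ t ℕ.* 8)

    open OddModulus (6 ℕ.+ t ℕ.* 8) pr o
    open Solve (- + 1) X (relations₇ o (residue₇ t))
    open Sums₈ (suc t) (<8 t (ℕP.n<1+n 7))
    open Solve₈ (6 ℕ.+ t ℕ.* 8) pr o (- + 1) X (relations₇ o (residue₇ t)) (suc t) (<8 t (ℕP.n<1+n 7))

    -- Again only the unspread row contributes, with `2 (B 4) - 2 (B 6)`, and here `4 A₂ ≡ -2X`.
    quad-half : ∀ N → p² ∣ + 4 * + quad (suc N ℕ.* p ℕ.∸ 1) (3 ℕ.+ t ℕ.* 4) - + suc N * (Q - + 4 * X)
    quad-half N = ∣-by (lemma (+ quad (suc N ℕ.* p ℕ.∸ 1) (3 ℕ.+ t ℕ.* 4)) (+ suc N)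
        (Σ (suc t) (λ i → e p (2 ℕ.+ i ℕ.* 4))) (Σ (suc t) (λ i → e p (3 ℕ.+ i ℕ.* 4)))
        (B 4) (B 6) Q X A₂)
      (+ 4 ⊗ difference (quad-mod-3 N t (quarter≤half 3 t (ℕP.m≤m+n 3 3)))
        ⊕ + 4 * c ⊗ difference S₂ ⊕ - + 4 * c ⊗ difference S₃
        ⊕ c ⊗ B₄ ⊕ - c ⊗ B₆ ⊕ + 2 * c ⊗ X-A₂)
      where
      c = + suc N
      S₂ : Σ (suc t) (λ i → e p (2 ℕ.+ i ℕ.* 4)) ≡ + 2 * B 4 [mod p² ]
      S₂ = Σ-e-double (suc t) 2 (λ _ _ → s≤s z≤n) (λ i lt → below {4} {7} (ℕP.m≤m+n 5 2) lt)
      S₃ : Σ (suc t) (λ i → e p (3 ℕ.+ i ℕ.* 4)) ≡ + 2 * B 6 [mod p² ]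
      S₃ = Σ-e-double (suc t) 3 (λ _ _ → s≤s z≤n) (λ i lt → below {6} {7} (ℕP.n<1+n 6) lt)
      lemma : ∀ M c S₂ S₃ B₄ B₆ Q X A₂ → + 4 * M - c * (Q - + 4 * X) ≡
        + 4 * (M - (+ 0 + c * (+ 0 - (S₃ - S₂)))) + (+ 4 * c * (S₂ - + 2 * B₄)
        + (- + 4 * c * (S₃ - + 2 * B₆) + (c * (+ 8 * B₄ - (+ 2 * Q - + 2 * X))
        + (- c * (+ 8 * B₆ - (Q - + 4 * A₂)) + + 2 * c * (X - + 2 * - + 1 * A₂)))))
      lemma = solve-∀

  -- The index p - 1, according to p modulo 4.

  module Case₁₄ (t : ℕ) (pr : Prime (1 ℕ.+ t ℕ.* 4)) where

    open OddModulus (t ℕ.* 4) pr (odd-1+4t t)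
    open Sums₄ (suc t) (ℕP.+-monoˡ-≤ (t ℕ.* 4) (ℕP.m≤m+n 2 2))

    -- Only `E` is truncated, and stretching by 4 gives `3 (D 0 - 1) + D 3` in total. With
    -- `v p = - U` this equals `Q + 2 (U - 1)`, and `U-Q` supplies a second `Q`.
    quad-full : ∀ N → p² ∣ + 2 * + quad (suc N ℕ.* p ℕ.∸ 1) (t ℕ.* 4) - (+ 2 + + 4 * (+ suc N * Q))
    quad-full N = ∣-by (trans (lemma₁ M c E (D 0) (D 1) (D 2) (D 3) S₃ Q)
        (trans (cong₂ (λ y z → + 2 * (M - (+ 1 + c * (E - (D 0 - S₃))))
              + (+ 2 * c * (E - (+ 1 + + 4 * (D 0 - + 1))) + (+ 2 * c * (S₃ - D 3) + z + c * y)))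
            (cong₂ (λ y z → + 3 * y + z) D₀+D₂ D₁+D₃) (cong₂ (λ y z → c * (+ 3 * y - z - + 6 - + 4 * Q)) (sym D₀-D₂) (trans (sym D₁-D₃) (uv-1+4t t))))
          (lemma₂ (+ 2 * (M - (+ 1 + c * (E - (D 0 - S₃))))) (+ 2 * c * (E - (+ 1 + + 4 * (D 0 - + 1)))) (S₃ - D 3) c Q U)))
      (+ 2 ⊗ difference (quad-mod-0 N t ℕP.≤-refl) ⊕ + 2 * c ⊗ difference E≡ ⊕ + 2 * c ⊗ difference S₃≡ ⊕ + 2 * c ⊗ U-Q)
      where
      c = + suc N
      M = + quad (suc N ℕ.* p ℕ.∸ 1) (t ℕ.* 4)
      E = Σ (suc t) (e p)
      S₃ = Σ t (λ i → e p (3 ℕ.+ i ℕ.* 4))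
      E≡ : E ≡ + 1 + + 4 * (D 0 - + 1) [mod p² ]
      E≡ = subst (λ z → E ≡ + 1 + + 4 * (z - + 1) [mod p² ]) (Σ-cong (suc t) (λ i → cong (e p) (ℕP.*-comm 4 i)))
        (Σ-e-multiples 4 t (s≤s z≤n) (s≤s (ℕP.≤-reflexive (ℕP.*-comm 4 t))))
      S₃≡ : S₃ ≡ D 3 [mod p² ]
      S₃≡ = ≡⇒mod (sym (trans (cong (λ z → S₃ + z) (e-vanish (ℕP.+-monoˡ-≤ (t ℕ.* 4) (s≤s (s≤s z≤n))))) (ℤP.+-identityʳ S₃)))
      lemma₁ : ∀ M c E D₀ D₁ D₂ D₃ S₃ Q → + 2 * M - (+ 2 + + 4 * (c * Q)) ≡
        + 2 * (M - (+ 1 + c * (E - (D₀ - S₃)))) + (+ 2 * c * (E - (+ 1 + + 4 * (D₀ - + 1)))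
        + (+ 2 * c * (S₃ - D₃) + c * (+ 3 * (D₀ - D₂) - (D₁ - D₃) - + 6 - + 4 * Q) + c * (+ 3 * (D₀ + D₂) + (D₁ + D₃))))
      lemma₁ = solve-∀
      lemma₂ : ∀ x y w c Q U → x + (y + (+ 2 * c * w + c * (+ 3 * U - - U - + 6 - + 4 * Q) + c * (+ 3 * (+ 1 + Q) + - (+ 1 + Q))))
        ≡ x + (y + (+ 2 * c * w + + 2 * c * (+ 2 * (U - + 1) - Q)))
      lemma₂ = solve-∀

  module Case₃₄ (t : ℕ) (pr : Prime (3 ℕ.+ t ℕ.* 4)) where

    open OddModulus (2 ℕ.+ t ℕ.* 4) pr (ss (odd-1+4t t))
    open Sums₄ (suc t) (ℕP.+-monoˡ-≤ (t ℕ.* 4) ℕP.≤-refl)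

    -- The classes are complete from the start: `D 1 - D 2` equals `U - 1 - Q` because `v p = U`,
    -- and `U - 1` is half of `Q` modulo p².
    quad-full : ∀ N → p² ∣ + 2 * + quad (suc N ℕ.* p ℕ.∸ 1) (2 ℕ.+ t ℕ.* 4) - (- (+ suc N * Q))
    quad-full N = ∣-by (trans (lemma₁ M c (D 0) (D 1) (D 2) (D 3) Q)
        (trans (cong₂ (λ y z → + 2 * (M - (+ 0 + c * (+ 0 - (D 2 - D 1)))) + (c * y + c * z + c * Q))
            (cong₂ (λ y z → z - y) D₀+D₂ D₁+D₃) (cong₂ (λ y z → y + z) (sym D₀-D₂) (trans (sym D₁-D₃) (uv-3+4t t))))
          (lemma₂ (+ 2 * (M - (+ 0 + c * (+ 0 - (D 2 - D 1))))) c Q U)))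
      (+ 2 ⊗ difference (quad-mod-2 N t ℕP.≤-refl) ⊕ c ⊗ U-Q)
      where
      c = + suc N
      M = + quad (suc N ℕ.* p ℕ.∸ 1) (2 ℕ.+ t ℕ.* 4)
      lemma₁ : ∀ M c D₀ D₁ D₂ D₃ Q → + 2 * M - (- (c * Q)) ≡
        + 2 * (M - (+ 0 + c * (+ 0 - (D₂ - D₁)))) + (c * (D₁ + D₃ - (D₀ + D₂)) + c * (D₀ - D₂ + (D₁ - D₃)) + c * Q)
      lemma₁ = solve-∀
      lemma₂ : ∀ x c Q U → x + (c * (- (+ 1 + Q) - (+ 1 + Q)) + c * (U + U) + c * Q) ≡ x + c * (+ 2 * (U - + 1) - Q)
      lemma₂ = solve-∀

  -- The quadratic character of 2.

  ℒ-cong : ∀ n {χ ψ} → χ ≗ ψ → ℒ n χ ≡ ℒ n ψ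
  ℒ-cong zero    eq = eq 0
  ℒ-cong (suc n) eq = cong₂ _-_ (ℒ-cong n eq) (ℒ-cong n (eq ∘ suc))

  ℒ-linear : ∀ n χ c ψ → ℒ n (λ j → χ j + c * ψ j) ≡ ℒ n χ + c * ℒ n ψ
  ℒ-linear zero    χ c ψ = refl
  ℒ-linear (suc n) χ c ψ = trans (cong₂ _-_ (ℒ-linear n χ c ψ) (ℒ-linear n (χ ∘ suc) c (ψ ∘ suc)))
    (lemma (ℒ n χ) (ℒ n (χ ∘ suc)) c (ℒ n ψ) (ℒ n (ψ ∘ suc)))
    where
    lemma : ∀ a a′ c b b′ → a + c * b - (a′ + c * b′) ≡ a - a′ + c * (b - b′)
    lemma = solve-∀

  -- The binomial theorem. The constant `c` absorbs the factor `x` that each shift produces.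
  ℒ-power : ∀ n c x → ℒ n (λ j → c * x ^ j) ≡ c * (+ 1 - x) ^ n
  ℒ-power zero    c x = refl
  ℒ-power (suc n) c x = begin
    ℒ n (λ j → c * x ^ j) - ℒ n (λ j → c * (x * x ^ j))
      ≡⟨ cong (λ z → ℒ n (λ j → c * x ^ j) - z) (ℒ-cong n (λ j → sym (ℤP.*-assoc c x (x ^ j)))) ⟩
    ℒ n (λ j → c * x ^ j) - ℒ n (λ j → c * x * x ^ j)
      ≡⟨ cong₂ _-_ (ℒ-power n c x) (ℒ-power n (c * x) x) ⟩
    c * (+ 1 - x) ^ n - c * x * (+ 1 - x) ^ n
      ≡⟨ lemma c x ((+ 1 - x) ^ n) ⟩
    c * ((+ 1 - x) * (+ 1 - x) ^ n) ∎
    where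
    open ≡-Reasoning
    lemma : ∀ c x y → c * y - c * x * y ≡ c * ((+ 1 - x) * y)
    lemma = solve-∀

  ℒ-index : ∀ n χ → ℒ (suc n) (λ j → + j * χ j) ≡ - (+ suc n * ℒ n (χ ∘ suc))
  ℒ-index zero    χ = lemma (χ 0) (χ 1)
    where
    lemma : ∀ a b → + 0 * a - + 1 * b ≡ - (+ 1 * b)
    lemma = solve-∀
  ℒ-index (suc n) χ = begin
    ℒ (suc n) (λ j → + j * χ j) - ℒ (suc n) (λ j → (+ 1 + + j) * χ (suc j))
      ≡⟨ cong (λ z → ℒ (suc n) (λ j → + j * χ j) - z) (ℒ-cong (suc n) (λ j → split (+ j) (χ (suc j)))) ⟩
    ℒ (suc n) (λ j → + j * χ j) - ℒ (suc n) (λ j → + j * χ (suc j) + + 1 * χ (suc j))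
      ≡⟨ cong₂ _-_ (ℒ-index n χ)
          (trans (ℒ-linear (suc n) (λ j → + j * χ (suc j)) (+ 1) (χ ∘ suc))
            (cong (_+ + 1 * ℒ (suc n) (χ ∘ suc)) (ℒ-index n (χ ∘ suc)))) ⟩
    - (+ suc n * a) - (- (+ suc n * b) + + 1 * (a - b))
      ≡⟨ lemma (+ suc n) a b ⟩
    - ((+ 1 + + suc n) * (a - b)) ∎
    where
    open ≡-Reasoning
    a = ℒ n (χ ∘ suc)
    b = ℒ n (χ ∘ suc ∘ suc)
    split : ∀ j x → (+ 1 + j) * x ≡ j * x + + 1 * x
    split = solve-∀
    lemma : ∀ n a b → - (n * a) - (- (n * b) + + 1 * (a - b)) ≡ - ((+ 1 + n) * (a - b))
    lemma = solve-∀

  ℒ-mod-cong : ∀ {m} n χ ψ → (∀ j → j ℕ.≤ n → χ j ≡ ψ j [mod m ]) → ℒ n χ ≡ ℒ n ψ [mod m ]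
  ℒ-mod-cong zero    χ ψ eq = eq 0 z≤n
  ℒ-mod-cong (suc n) χ ψ eq = mod-- (ℒ-mod-cong n χ ψ (λ j le → eq j (ℕP.m≤n⇒m≤1+n le)))
    (ℒ-mod-cong n (χ ∘ suc) (ψ ∘ suc) (λ j le → eq (suc j) (s≤s le)))

  ℒ-const : ∀ n c → ℒ (suc n) (λ _ → c) ≡ + 0
  ℒ-const n c = ℤP.+-inverseʳ (ℒ n (λ _ → c))

  shifted : ℕ → ℕ → Series
  shifted c m j = (+ (j ℕ.+ c)) ^ m

  ℒ-shifted-suc : ∀ n c m → ℒ (suc n) (shifted c (suc m)) ≡
    - (+ suc n * ℒ n (shifted (suc c) m)) + + c * ℒ (suc n) (shifted c m)
  ℒ-shifted-suc n c m = begin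
    ℒ (suc n) (shifted c (suc m))
      ≡⟨ ℒ-cong (suc n) (λ j → ℤP.*-distribʳ-+ (shifted c m j) (+ j) (+ c)) ⟩
    ℒ (suc n) (λ j → + j * shifted c m j + + c * shifted c m j)
      ≡⟨ ℒ-linear (suc n) (λ j → + j * shifted c m j) (+ c) (shifted c m) ⟩
    ℒ (suc n) (λ j → + j * shifted c m j) + + c * ℒ (suc n) (shifted c m)
      ≡⟨ cong (_+ + c * ℒ (suc n) (shifted c m)) (trans (ℒ-index n (shifted c m))
          (cong (λ z → - (+ suc n * z)) (ℒ-cong n (λ j → cong (λ i → (+ i) ^ m) (sym (ℕP.+-suc j c)))))) ⟩
    - (+ suc n * ℒ n (shifted (suc c) m)) + + c * ℒ (suc n) (shifted c m) ∎
    where open ≡-Reasoning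

  -- The n-th difference of a polynomial of degree below n vanishes. The offset `c` varies because
  -- lowering the degree through `ℒ-index` moves the argument by one.
  ℒ-low-degree : ∀ m n c → m ℕ.< n → ℒ n (shifted c m) ≡ + 0
  ℒ-low-degree zero    (suc n) c _        = ℒ-const n (+ 1)
  ℒ-low-degree (suc m) (suc n) c (s≤s lt) = trans (ℒ-shifted-suc n c m)
    (trans (cong₂ (λ y z → - (+ suc n * y) + + c * z) (ℒ-low-degree m n (suc c) lt)
        (ℒ-low-degree m (suc n) c (ℕP.m<n⇒m<1+n lt)))
      (cong₂ (λ y z → - y + z) (ℤP.*-zeroʳ (+ suc n)) (ℤP.*-zeroʳ (+ c))))

  ^-odd-neg : ∀ {m} → Odd m → ∀ x → (- x) ^ m ≡ - (x ^ m)
  ^-odd-neg one            x = lemma x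
    where
    lemma : ∀ x → - x * + 1 ≡ - (x * + 1)
    lemma = solve-∀
  ^-odd-neg (ss {m} o) x = trans (cong (λ z → - x * (- x * z)) (^-odd-neg o x)) (lemma x (x ^ m))
    where
    lemma : ∀ x y → - x * (- x * - y) ≡ - (x * (x * y))
    lemma = solve-∀

  ^-odd : ∀ {m} → Odd m → ∀ x → x ^ m ≡ x * (x * x) ^ ⌊ m /2⌋
  ^-odd one        x = refl
  ^-odd (ss {m} o) x = trans (cong (λ z → x * (x * z)) (^-odd o x)) (lemma x ((x * x) ^ ⌊ m /2⌋))
    where
    lemma : ∀ x y → x * (x * (x * y)) ≡ x * (x * x * y)
    lemma = solve-∀

  mod-^ : ∀ {m a b} k → a ≡ b [mod m ] → a ^ k ≡ b ^ k [mod m ]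
  mod-^ zero    eq = mod-refl
  mod-^ (suc k) eq = mod-* eq (mod-^ k eq)

  %-≡⇒∣ : ∀ p .{{_ : NonZero p}} a b → a % p ≡ b % p → + p ∣ + a - + b
  %-≡⇒∣ p a b eq = divides (+ (a / p) - + (b / p)) (begin
    + a - + b
      ≡⟨ cong₂ _-_ (expand a) (expand b) ⟩
    (+ (a % p) + + (a / p) * + p) - (+ (b % p) + + (b / p) * + p)
      ≡⟨ cong (λ r → (+ r + + (a / p) * + p) - (+ (b % p) + + (b / p) * + p)) eq ⟩
    (+ (b % p) + + (a / p) * + p) - (+ (b % p) + + (b / p) * + p)
      ≡⟨ lemma (+ (b % p)) (+ (a / p)) (+ (b / p)) (+ p) ⟩
    (+ (a / p) - + (b / p)) * + p ∎)
    where
    open ≡-Reasoning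
    expand : ∀ a → + a ≡ + (a % p) + + (a / p) * + p
    expand a = trans (cong +_ (m≡m%n+[m/n]*n a p)) (cong (λ z → + (a % p) + z) (ℤP.pos-* (a / p) p))
    lemma : ∀ r a b p → (r + a * p) - (r + b * p) ≡ (a - b) * p
    lemma = solve-∀

  ∣⇒%-≡-≤ : ∀ p .{{_ : NonZero p}} {a b} → b ℕ.≤ a → + p ∣ + a - + b → a % p ≡ b % p
  ∣⇒%-≡-≤ p {a} {b} b≤a h
    with subst (λ z → p ℕD.∣ ℤ.∣ z ∣) (trans (ℤP.m-n≡m⊖n a b) (ℤP.⊖-≥ b≤a)) (∣⇒∣ᵤ h)
  ... | ℕD.divides q eq =
    trans (cong (_% p) (trans (sym (ℕP.m+[n∸m]≡n b≤a)) (cong (b ℕ.+_) eq))) ([m+kn]%n≡m%n b q p)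

  ∣⇒%-≡ : ∀ p .{{_ : NonZero p}} a b → + p ∣ + a - + b → a % p ≡ b % p
  ∣⇒%-≡ p a b h with ℕP.≤-total b a
  ... | inj₁ b≤a = ∣⇒%-≡-≤ p b≤a h
  ... | inj₂ a≤b = sym (∣⇒%-≡-≤ p a≤b (difference (mod-sym {a = + a} {+ b} (congruent h))))

  twoIsQR-true : ∀ p .{{_ : NonZero p}} x → + p ∣ x * x - + 2 → twoIsQR p ≡ true
  twoIsQR-true p x h = Equivalence.to T-≡ (any⁺ _ (lose (∈-upTo⁺ (ℤDM.n%ℕd<d x p))
    (ℕP.≡⇒≡ᵇ _ _ (∣⇒%-≡ p (r ℕ.* r) 2 (∣-by eq (∣m∣n⇒∣m-n h (∣n⇒∣m*n (+ 2 * + r * q + q * q * + p) (divides (+ 1) (sym (ℤP.*-identityˡ (+ p)))))))))))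
    where
    -- The search only visits 0, ..., p - 1, so the given integer root, possibly negative, is
    -- replaced by its remainder.
    r = x ℤDM.%ℕ p
    q = x ℤDM./ℕ p
    lemma : ∀ r q p → r * r - + 2 ≡ (r + q * p) * (r + q * p) - + 2 - (+ 2 * r * q + q * q * p) * p
    lemma = solve-∀
    eq : + (r ℕ.* r) - + 2 ≡ x * x - + 2 - (+ 2 * + r * q + q * q * + p) * + p
    eq = trans (cong (_- + 2) (ℤP.pos-* r r)) (trans (lemma (+ r) q (+ p))
      (cong (λ z → z * z - + 2 - (+ 2 * + r * q + q * q * + p) * + p) (sym (ℤDM.a≡a%ℕn+[a/ℕn]*n x p))))

  twoIsQR-false : ∀ p .{{_ : NonZero p}} → (∀ x → ¬ + p ∣ + x * + x - + 2) → twoIsQR p ≡ false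
  twoIsQR-false p none = ¬-not λ isQR → impossible (find (any⁻ isRoot (upTo p) (Equivalence.from T-≡ isQR)))
    where
    isRoot : ℕ → Bool.Bool
    isRoot x = (x ℕ.* x) % p ℕ.≡ᵇ 2 % p
    impossible : ¬ ∃ (λ x → x ∈ upTo p × Bool.T (isRoot x))
    impossible (x , _ , root) =
      none x (∣-by (cong (_- + 2) (sym (ℤP.pos-* x x))) (%-≡⇒∣ p (x ℕ.* x) 2 (ℕP.≡ᵇ⇒≡ ((x ℕ.* x) % p) (2 % p) root)))

  module Character (n : ℕ) (pr : Prime (suc n)) (o : Odd (suc n)) where

    open OddModulus n pr o

    -- Induction on `x`: `(1 + x)^p` is the pairing of row p with the powers of `-x`, so modulo p it
    -- is `1 - (-x)^p = 1 + x^p`.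
    fermat : ∀ x → (+ x) ^ p ≡ + x [mod + p ]
    fermat zero    = mod-refl
    fermat (suc x) = mod-trans (≡⇒mod (trans (cong (λ z → (+ 1 + z) ^ p) (sym (ℤP.neg-involutive (+ x))))
        (trans (sym (ℤP.*-identityˡ _)) (sym (ℒ-power p (+ 1) (- + x))))))
      (mod-trans (ℒ-mod (λ j → + 1 * (- + x) ^ j))
        (mod-trans (≡⇒mod (trans (cong (λ z → + 1 * + 1 - + 1 * z) (^-odd-neg o (+ x))) (lemma ((+ x) ^ p))))
          (mod-+ (mod-refl {a = + 1}) (fermat x))))
      where
      lemma : ∀ y → + 1 * + 1 - + 1 * - y ≡ + 1 + y
      lemma = solve-∀

    p∤1 : ¬ + p ∣ + 1
    p∤1 h = ¬prime[1] (subst Prime (ℕD.∣1⇒≡1 (∣⇒∣ᵤ h)) pr)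

    -- The m-th difference of `x^m` is `m!` up to sign; the factors, all below p, are cancelled one
    -- at a time.
    ℒ-leading : ∀ m c → m ℕ.< p → ¬ + p ∣ ℒ m (shifted c m)
    ℒ-leading zero    c _  = p∤1
    ℒ-leading (suc m) c lt div = ℒ-leading m (suc c) (ℕP.<⇒≤ lt) (cancel-∣ _ (p∤small lt)
      (∣-by (trans (lemma (+ suc m * ℒ m (shifted (suc c) m)) (+ c))
          (cong -_ (sym (trans (ℒ-shifted-suc m c m)
            (cong (λ z → - (+ suc m * ℒ m (shifted (suc c) m)) + + c * z) (ℒ-low-degree m (suc m) c ℕP.≤-refl))))))
        (∣m⇒∣-m div)))
      where
      lemma : ∀ a c → a ≡ - (- a + c * + 0)
      lemma = solve-∀

    -- If all k-th powers of 1, …, k + 1 were 1 modulo p, the k-th difference k! of x ↦ x^k would vanish.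
    non-power : ∀ k → 0 ℕ.< k → k ℕ.< p →
      ¬ (∀ j → j ℕ.≤ k → (+ suc j) ^ k ≡ + 1 [mod + p ])
    non-power k@(suc k′) _ lt all-one = ℒ-leading k 1 lt (mod⇒∣ (mod-trans
      (ℒ-mod-cong k (shifted 1 k) (λ _ → + 1)
        (λ j le → mod-trans (≡⇒mod (cong (λ i → (+ i) ^ k) (ℕP.+-comm j 1))) (all-one j le)))
      (≡⇒mod (ℒ-const k′ (+ 1)))))

    fermat-unit : ∀ j → suc j ℕ.< p → + p ∣ (+ suc j) ^ n - + 1
    fermat-unit j lt = cancel-∣ _ (p∤small lt) (∣-by (lemma (+ suc j) ((+ suc j) ^ n)) (difference (fermat (suc j))))
      where
      lemma : ∀ x y → x * (y - + 1) ≡ x * y - x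
      lemma = solve-∀

    -- By Fermat the k-th powers, with `k = (p-1)/2`, square to 1, so Euclid's lemma decides for
    -- each of 1, ..., k + 1 whether the power is 1 or -1. They cannot all be 1, and running through
    -- them yields a witness.
    minus-one-power : ∀ k → 0 ℕ.< k → k ℕ.+ k ≡ n → ∃ λ x → + p ∣ (+ x) ^ k + + 1
    minus-one-power k k>0 k+k≡n = from-search (search k ℕP.≤-refl)
      where
      2+k≤p : suc (suc k) ℕ.≤ p
      2+k≤p = s≤s (ℕP.≤-trans (ℕP.+-monoˡ-≤ k k>0) (ℕP.≤-reflexive k+k≡n))
      difference-of-squares : ∀ y → (y - + 1) * (y + + 1) ≡ y * y - + 1
      difference-of-squares = solve-∀
      factors : ∀ j → j ℕ.≤ k → + p ∣ ((+ suc j) ^ k - + 1) * ((+ suc j) ^ k + + 1)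
      factors j le = ∣-by (trans (difference-of-squares ((+ suc j) ^ k))
          (cong (_- + 1) (trans (sym (ℤP.^-distribˡ-+-* (+ suc j) k k)) (cong ((+ suc j) ^_) k+k≡n))))
        (fermat-unit j (ℕP.≤-trans (s≤s (s≤s le)) 2+k≤p))
      dichotomy : ∀ j → j ℕ.≤ k → (+ suc j) ^ k ≡ + 1 [mod + p ] ⊎ (+ p ∣ (+ suc j) ^ k + + 1)
      dichotomy j le = Sum.map₁ congruent (euclid ((+ suc j) ^ k - + 1) ((+ suc j) ^ k + + 1) (factors j le))
      Result : ℕ → Set
      Result N = (∀ j → j ℕ.≤ N → (+ suc j) ^ k ≡ + 1 [mod + p ]) ⊎ ∃ λ x → + p ∣ (+ x) ^ k + + 1
      extend : ∀ {N} → (∀ j → j ℕ.≤ N → (+ suc j) ^ k ≡ + 1 [mod + p ]) → (+ suc (suc N)) ^ k ≡ + 1 [mod + p ] →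
        ∀ j → j ℕ.≤ suc N → (+ suc j) ^ k ≡ + 1 [mod + p ]
      extend all-one next j le with ℕP.m≤n⇒m<n∨m≡n le
      ... | inj₁ (s≤s j≤N) = all-one j j≤N
      ... | inj₂ refl      = next
      combine : ∀ {N} → Result N → (+ suc (suc N)) ^ k ≡ + 1 [mod + p ] ⊎ (+ p ∣ (+ suc (suc N)) ^ k + + 1) →
        Result (suc N)
      combine (inj₂ found)       _        = inj₂ found
      combine {N} (inj₁ _)       (inj₂ h) = inj₂ (suc (suc N) , h)
      combine (inj₁ all-one)     (inj₁ h) = inj₁ (extend all-one h)
      search : ∀ N → N ℕ.≤ k → Result N
      search zero    le = Sum.map (λ { h zero _ → h }) (1 ,_) (dichotomy 0 z≤n)
      search (suc N) le = combine (search N (ℕP.<⇒≤ le)) (dichotomy (suc N) le)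
      from-search : Result k → ∃ λ x → + p ∣ (+ x) ^ k + + 1
      from-search (inj₁ all-one) = ⊥-elim (non-power k k>0 (ℕP.≤-trans (ℕP.n≤1+n (suc k)) 2+k≤p) all-one)
      from-search (inj₂ found)   = found

    -- Here `h p ≡ -1`. A root `x` of 2 would satisfy `x ≡ x^p = x (x²)^((p-1)/2) ≡ - x`, hence p
    -- would divide `x` and then 2.
    non-residue : 2 ℕ.< p → U ≡ - + 1 * h p → twoIsQR p ≡ false
    non-residue 2<p u-eq = twoIsQR-false p λ x x²-2 →
      let x≡-x : + x ≡ + x * - + 1 [mod + p ]
          x≡-x = mod-trans (mod-sym (fermat x)) (mod-trans (≡⇒mod (^-odd o (+ x)))
            (mod-* (mod-refl {a = + x}) (mod-trans (mod-^ ⌊ p /2⌋ (congruent x²-2)) h≡-1)))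
          p∣x : + p ∣ + x
          p∣x = cancel-∣ (+ x) (p∤small 2<p) (∣-by (lemma₁ (+ x)) (difference x≡-x))
      in p∤small 2<p (∣-by (lemma₂ (+ x)) (∣m∣n⇒∣m-n (∣m⇒∣m*n (+ x) p∣x) x²-2))
      where
      h≡-1 : h p ≡ - + 1 [mod + p ]
      h≡-1 = congruent (∣-by (trans (lemma (h p)) (cong (λ z → - (z - + 1)) (sym u-eq))) (∣m⇒∣-m U≡1))
        where
        lemma : ∀ h → h - - + 1 ≡ - (- + 1 * h - + 1)
        lemma = solve-∀
      lemma₁ : ∀ x → + 2 * x ≡ x - x * - + 1
      lemma₁ = solve-∀
      lemma₂ : ∀ x → + 2 ≡ x * x - (x * x - + 2)
      lemma₂ = solve-∀

    -- Here `h p ≡ 1`, so 2 is congruent to `2 h p = 2^((p+1)/2)`, which is a perfect square when p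
    -- ≡ 7 modulo 8.
    residue-by-root : ∀ x → U ≡ + 1 * h p → x * x ≡ + 2 * h p → twoIsQR p ≡ true
    residue-by-root x u-eq square = twoIsQR-true p x
      (∣-by (trans (cong (_- + 2) square) (trans (lemma (h p)) (cong (λ z → + 2 * (z - + 1)) (sym u-eq)))) (∣n⇒∣m*n (+ 2) U≡1))
      where
      lemma : ∀ h → + 2 * h - + 2 ≡ + 2 * (+ 1 * h - + 1)
      lemma = solve-∀

    -- For z a primitive 8th root of unity, (z + z⁻¹)² = 2.
    residue-by-ζ : ∀ t → 0 ℕ.< t → n ≡ t ℕ.* 8 → twoIsQR p ≡ true
    residue-by-ζ t t>0 n≡8t = from-power (minus-one-power (t ℕ.* 4)
        (ℕP.<-≤-trans t>0 (ℕP.m≤m*n t 4)) (trans (double t) (sym n≡8t)))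
      where
      double : ∀ t → t ℕ.* 4 ℕ.+ t ℕ.* 4 ≡ t ℕ.* 8
      double = ℕ-solve-∀
      quadruple : ∀ t → t ℕ.* 4 ≡ t ℕ.+ (t ℕ.+ (t ℕ.+ t))
      quadruple = ℕ-solve-∀
      fourth-power : ∀ x → x ^ (t ℕ.* 4) ≡ x ^ t * (x ^ t * (x ^ t * x ^ t))
      fourth-power x = trans (cong (x ^_) (quadruple t)) (trans (ℤP.^-distribˡ-+-* x t (t ℕ.+ (t ℕ.+ t)))
        (cong (x ^ t *_) (trans (ℤP.^-distribˡ-+-* x t (t ℕ.+ t)) (cong (x ^ t *_) (ℤP.^-distribˡ-+-* x t t)))))
      -- From `z⁴ = -1` follows `z⁻¹ = -z³`, so the root `z + z⁻¹` is written `z - z³`.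
      lemma : ∀ z → (z - z * (z * z)) * (z - z * (z * z)) - + 2 ≡ (z * z - + 2) * (z * (z * (z * z)) + + 1)
      lemma = solve-∀
      from-power : (∃ λ x → + p ∣ (+ x) ^ (t ℕ.* 4) + + 1) → twoIsQR p ≡ true
      from-power (x , x⁴ᵗ) = twoIsQR-true p (z - z * (z * z))
        (∣-by (trans (lemma z) (cong (λ y → (z * z - + 2) * (y + + 1)) (sym (fourth-power (+ x))))) (∣n⇒∣m*n (z * z - + 2) x⁴ᵗ))
        where
        z = (+ x) ^ t

  half-1+8t : ∀ t → ⌊ 1 ℕ.+ t ℕ.* 8 /2⌋ ≡ t ℕ.* 4
  half-1+8t zero    = refl
  half-1+8t (suc t) = cong (4 ℕ.+_) (half-1+8t t)

  twoIsQR₁ : ∀ t → Prime (1 ℕ.+ t ℕ.* 8) → twoIsQR (1 ℕ.+ t ℕ.* 8) ≡ true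
  twoIsQR₁ t pr = Character.residue-by-ζ (t ℕ.* 8) pr (odd-1+8t t) t (positive t pr) refl
    where
    positive : ∀ t → Prime (1 ℕ.+ t ℕ.* 8) → 0 ℕ.< t
    positive zero    pr = ⊥-elim (¬prime[1] pr)
    positive (suc t) pr = s≤s z≤n

  twoIsQR₃ : ∀ t → Prime (3 ℕ.+ t ℕ.* 8) → twoIsQR (3 ℕ.+ t ℕ.* 8) ≡ false
  twoIsQR₃ t pr = Character.non-residue (2 ℕ.+ t ℕ.* 8) pr (ss (odd-1+8t t)) (s≤s (s≤s (s≤s z≤n))) (Twist.u-eq (residue₃ t))

  twoIsQR₅ : ∀ t → Prime (5 ℕ.+ t ℕ.* 8) → twoIsQR (5 ℕ.+ t ℕ.* 8) ≡ false
  twoIsQR₅ t pr = Character.non-residue (4 ℕ.+ t ℕ.* 8) pr (ss (ss (odd-1+8t t))) (s≤s (s≤s (s≤s z≤n))) (Twist.u-eq (residue₅ t))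

  twoIsQR₇ : ∀ t → Prime (7 ℕ.+ t ℕ.* 8) → twoIsQR (7 ℕ.+ t ℕ.* 8) ≡ true
  twoIsQR₇ t pr = Character.residue-by-root (6 ℕ.+ t ℕ.* 8) pr (ss (ss (ss (odd-1+8t t)))) ((+ 2) ^ (2 ℕ.+ t ℕ.* 2))
      (Twist.u-eq (residue₇ t)) square
    where
    identity : ∀ t → 2 ℕ.+ t ℕ.* 2 ℕ.+ (2 ℕ.+ t ℕ.* 2) ≡ 4 ℕ.+ t ℕ.* 4
    identity = ℕ-solve-∀
    square : (+ 2) ^ (2 ℕ.+ t ℕ.* 2) * (+ 2) ^ (2 ℕ.+ t ℕ.* 2) ≡ + 2 * h (7 ℕ.+ t ℕ.* 8)
    square = trans (sym (ℤP.^-distribˡ-+-* (+ 2) (2 ℕ.+ t ℕ.* 2) (2 ℕ.+ t ℕ.* 2)))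
      (cong ((+ 2) ^_) (trans (identity t) (cong (4 ℕ.+_) (sym (half-1+8t t)))))

open IntegerCongruences

open import Data.Nat using (_^_)
open import Data.Rational as ℚ using (ℚ; 1ℚ; _+_; _*_; -_; _-_; ↥_; ↧_; toℚᵘ)
import Data.Rational.Properties as ℚP
open import Data.Rational.Unnormalised as ℚᵘ using (mkℚᵘ; *≡*; _≃_)
import Data.Rational.Unnormalised.Properties as ℚᵘP
open import Data.Rational.Solver using () renaming (module +-*-Solver to ℚ-Solver)
open ℚ-Solver using (_:+_; _:*_; :-_; _:-_; _:=_)

-- From integer divisibility to congruences of rationals.

fromℤ : ℤ → ℚ
fromℤ z = z ℚ./ 1

-- Rational arithmetic normalises by a gcd that does not compute on variables, so the identity is
-- checked on unnormalised fractions.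
fromℤ-+ : ∀ a b → fromℤ a + fromℤ b ≡ fromℤ (a ℤ.+ b)
fromℤ-+ a b = ℚP.toℚᵘ-injective (begin
  toℚᵘ (fromℤ a + fromℤ b)             ≈⟨ ℚP.toℚᵘ-homo-+ (fromℤ a) (fromℤ b) ⟩
  toℚᵘ (fromℤ a) ℚᵘ.+ toℚᵘ (fromℤ b)   ≈⟨ ℚᵘP.+-cong (ℚP.toℚᵘ-fromℚᵘ (mkℚᵘ a 0)) (ℚP.toℚᵘ-fromℚᵘ (mkℚᵘ b 0)) ⟩
  mkℚᵘ a 0 ℚᵘ.+ mkℚᵘ b 0               ≈⟨ *≡* (lemma a b) ⟩
  mkℚᵘ (a ℤ.+ b) 0                     ≈⟨ ℚP.toℚᵘ-fromℚᵘ (mkℚᵘ (a ℤ.+ b) 0) ⟨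
  toℚᵘ (fromℤ (a ℤ.+ b))               ∎)
  where
  open ℚᵘP.≃-Reasoning
  lemma : ∀ a b → (a ℤ.* + 1 ℤ.+ b ℤ.* + 1) ℤ.* + 1 ≡ (a ℤ.+ b) ℤ.* + 1
  lemma = solve-∀

fromℤ-* : ∀ a b → fromℤ a * fromℤ b ≡ fromℤ (a ℤ.* b)
fromℤ-* a b = ℚP.toℚᵘ-injective (begin
  toℚᵘ (fromℤ a * fromℤ b)             ≈⟨ ℚP.toℚᵘ-homo-* (fromℤ a) (fromℤ b) ⟩
  toℚᵘ (fromℤ a) ℚᵘ.* toℚᵘ (fromℤ b)   ≈⟨ ℚᵘP.*-cong (ℚP.toℚᵘ-fromℚᵘ (mkℚᵘ a 0)) (ℚP.toℚᵘ-fromℚᵘ (mkℚᵘ b 0)) ⟩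
  mkℚᵘ a 0 ℚᵘ.* mkℚᵘ b 0               ≈⟨ *≡* refl ⟩
  mkℚᵘ (a ℤ.* b) 0                     ≈⟨ ℚP.toℚᵘ-fromℚᵘ (mkℚᵘ (a ℤ.* b) 0) ⟨
  toℚᵘ (fromℤ (a ℤ.* b))               ∎)
  where open ℚᵘP.≃-Reasoning

fromℤ-neg : ∀ a → - fromℤ a ≡ fromℤ (ℤ.- a)
fromℤ-neg a = ℚP.toℚᵘ-injective (begin
  toℚᵘ (- fromℤ a)       ≈⟨ ℚP.toℚᵘ-homo‿- (fromℤ a) ⟩
  ℚᵘ.- toℚᵘ (fromℤ a)    ≈⟨ ℚᵘP.-‿cong (ℚP.toℚᵘ-fromℚᵘ (mkℚᵘ a 0)) ⟩
  mkℚᵘ (ℤ.- a) 0         ≈⟨ ℚP.toℚᵘ-fromℚᵘ (mkℚᵘ (ℤ.- a) 0) ⟨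
  toℚᵘ (fromℤ (ℤ.- a))   ∎)
  where open ℚᵘP.≃-Reasoning

fromℤ-- : ∀ a b → fromℤ a - fromℤ b ≡ fromℤ (a ℤ.- b)
fromℤ-- a b = trans (cong (λ z → fromℤ a + z) (fromℤ-neg b)) (fromℤ-+ a (ℤ.- b))

p*[z/p] : ∀ p .{{_ : NonZero p}} z → ι p * (z ℚ./ p) ≡ fromℤ z
p*[z/p] p@(suc n) z = ℚP.toℚᵘ-injective (begin
  toℚᵘ (ι p * (z ℚ./ p))            ≈⟨ ℚP.toℚᵘ-homo-* (ι p) (z ℚ./ p) ⟩
  toℚᵘ (ι p) ℚᵘ.* toℚᵘ (z ℚ./ p)    ≈⟨ ℚᵘP.*-cong (ℚP.toℚᵘ-fromℚᵘ (mkℚᵘ (+ p) 0)) (ℚP.toℚᵘ-fromℚᵘ (mkℚᵘ z n)) ⟩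
  mkℚᵘ (+ p) 0 ℚᵘ.* mkℚᵘ z n        ≈⟨ *≡* (trans (lemma (+ p) z) (cong (λ m → z ℤ.* + m) (sym (ℕP.+-identityʳ p)))) ⟩
  mkℚᵘ z 0                          ≈⟨ ℚP.toℚᵘ-fromℚᵘ (mkℚᵘ z 0) ⟨
  toℚᵘ (fromℤ z)                    ∎)
  where
  open ℚᵘP.≃-Reasoning
  lemma : ∀ p z → (p ℤ.* z) ℤ.* + 1 ≡ z ℤ.* p
  lemma = solve-∀

ι-*-↥ : ∀ d x z → ι d * x ≡ fromℤ z → + d ℤ.* ↥ x ≡ z ℤ.* ↧ x
ι-*-↥ d x@(ℚ.mkℚ _ _ _) z eq with unnormalised
  where
  open ℚᵘP.≃-Reasoning
  unnormalised : mkℚᵘ (+ d) 0 ℚᵘ.* toℚᵘ x ≃ mkℚᵘ z 0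
  unnormalised = begin
    mkℚᵘ (+ d) 0 ℚᵘ.* toℚᵘ x     ≈⟨ ℚᵘP.*-congʳ (ℚP.toℚᵘ-fromℚᵘ (mkℚᵘ (+ d) 0)) ⟨
    toℚᵘ (ι d) ℚᵘ.* toℚᵘ x       ≈⟨ ℚP.toℚᵘ-homo-* (ι d) x ⟨
    toℚᵘ (ι d * x)               ≡⟨ cong toℚᵘ eq ⟩
    toℚᵘ (fromℤ z)               ≈⟨ ℚP.toℚᵘ-fromℚᵘ (mkℚᵘ z 0) ⟩
    mkℚᵘ z 0                     ∎
... | *≡* eq′ = trans (sym (ℤP.*-identityʳ (+ d ℤ.* ↥ x))) (trans eq′ (cong (z ℤ.*_) (cong +_ (ℕP.+-identityʳ _))))

pos-^ : ∀ k → + (2 ℕ.^ k) ≡ (+ 2) ℤ.^ k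
pos-^ zero    = refl
pos-^ (suc k) = trans (ℤP.pos-* 2 (2 ℕ.^ k)) (cong (+ 2 ℤ.*_) (pos-^ k))

module Rational (n : ℕ) (pr : Prime (suc n)) where

  open PrimeModulus n pr

  -- Clearing denominators: `d` times the reduced numerator equals `z` times the reduced
  -- denominator, hence is divisible by p², and `d` is prime to p.
  modℚ-by : ∀ d z {a b} → ¬ + p ∣ + d → ι d * (a - b) ≡ fromℤ z → p² ∣ z → a ≡ b [modℚ p ℕ.^ 2 ]
  modℚ-by d z {a} {b} p∤d eq h = ∣⇒∣ᵤ (subst (_∣ ↥ (a - b)) (sym p^2)
    (cancel-∣² (↥ (a - b)) p∤d (∣-by (trans (ι-*-↥ d (a - b) z eq) (ℤP.*-comm z (↧ (a - b)))) (∣n⇒∣m*n (↧ (a - b)) h))))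
    where
    p^2 : + (p ℕ.^ 2) ≡ p²
    p^2 = trans (ℤP.pos-* p (p ℕ.* 1)) (cong (λ m → + p ℤ.* + m) (ℕP.*-identityʳ p))

  Q : ℤ
  Q = (+ 2) ℤ.^ n ℤ.- + 1

  p*fermatQuot2 : ι p * fermatQuot2 p ≡ fromℤ Q
  p*fermatQuot2 = trans (p*[z/p] p (+ (2 ℕ.^ n) ℤ.- + 1)) (cong (λ z → fromℤ (z ℤ.- + 1)) (pos-^ n))

  form₁ : ∀ M c → ι 2 * (ι M - (1ℚ + ι 2 * ι c * ι p * fermatQuot2 p)) ≡
    fromℤ (+ 2 ℤ.* + M ℤ.- (+ 2 ℤ.+ + 4 ℤ.* (+ c ℤ.* Q)))
  form₁ M c = begin
    ι 2 * (ι M - (1ℚ + ι 2 * ι c * ι p * fermatQuot2 p))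
      ≡⟨ lemma (ι 2) (ι M) 1ℚ (ι c) (ι p) (fermatQuot2 p) ⟩
    ι 2 * ι M - (ι 2 * 1ℚ + ι 2 * ι 2 * (ι c * (ι p * fermatQuot2 p)))
      ≡⟨ cong (λ z → ι 2 * ι M - (ι 2 * 1ℚ + ι 2 * ι 2 * (ι c * z))) p*fermatQuot2 ⟩
    ι 2 * ι M - (ι 2 + ι 4 * (ι c * fromℤ Q))
      ≡⟨ cong₂ _-_ (fromℤ-* (+ 2) (+ M)) (trans (cong (λ z → ι 2 + ι 4 * z) (fromℤ-* (+ c) Q))
          (trans (cong (λ z → ι 2 + z) (fromℤ-* (+ 4) (+ c ℤ.* Q))) (fromℤ-+ (+ 2) (+ 4 ℤ.* (+ c ℤ.* Q))))) ⟩
    fromℤ (+ 2 ℤ.* + M) - fromℤ (+ 2 ℤ.+ + 4 ℤ.* (+ c ℤ.* Q))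
      ≡⟨ fromℤ-- (+ 2 ℤ.* + M) _ ⟩
    fromℤ (+ 2 ℤ.* + M ℤ.- (+ 2 ℤ.+ + 4 ℤ.* (+ c ℤ.* Q))) ∎
    where
    open ≡-Reasoning
    lemma : ∀ d m o c p f → d * (m - (o + d * c * p * f)) ≡ d * m - (d * o + d * d * (c * (p * f)))
    lemma = ℚ-Solver.solve 6 (λ d m o c p f → d :* (m :- (o :+ d :* c :* p :* f)) := d :* m :- (d :* o :+ d :* d :* (c :* (p :* f)))) refl

  conclude₁ : ∀ M c → ¬ + p ∣ + 2 → p² ∣ + 2 ℤ.* + M ℤ.- (+ 2 ℤ.+ + 4 ℤ.* (+ c ℤ.* Q)) →
    ι M ≡ 1ℚ + ι 2 * ι c * ι p * fermatQuot2 p [modℚ p ℕ.^ 2 ]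
  conclude₁ M c p∤2 = modℚ-by 2 _ {ι M} p∤2 (form₁ M c)

  form₂ : ∀ M c → ι 2 * (ι M - - ((+ 1 ℚ./ 2) * ι c * ι p * fermatQuot2 p)) ≡
    fromℤ (+ 2 ℤ.* + M ℤ.- (ℤ.- (+ c ℤ.* Q)))
  form₂ M c = begin
    ι 2 * (ι M - - ((+ 1 ℚ./ 2) * ι c * ι p * fermatQuot2 p))
      ≡⟨ lemma (ι 2) (ι M) (+ 1 ℚ./ 2) (ι c) (ι p) (fermatQuot2 p) ⟩
    ι 2 * ι M - - (ι 2 * (+ 1 ℚ./ 2) * (ι c * (ι p * fermatQuot2 p)))
      -- The closed product `ι 2 * (+ 1 ℚ./ 2)` evaluates to 1ℚ.
      ≡⟨ cong (λ z → ι 2 * ι M - - z) (trans (ℚP.*-identityˡ _) (cong (ι c *_) p*fermatQuot2)) ⟩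
    ι 2 * ι M - - (ι c * fromℤ Q)
      ≡⟨ cong₂ (λ y z → y - - z) (fromℤ-* (+ 2) (+ M)) (fromℤ-* (+ c) Q) ⟩
    fromℤ (+ 2 ℤ.* + M) - - fromℤ (+ c ℤ.* Q)
      ≡⟨ cong (λ z → fromℤ (+ 2 ℤ.* + M) - z) (fromℤ-neg (+ c ℤ.* Q)) ⟩
    fromℤ (+ 2 ℤ.* + M) - fromℤ (ℤ.- (+ c ℤ.* Q))
      ≡⟨ fromℤ-- (+ 2 ℤ.* + M) _ ⟩
    fromℤ (+ 2 ℤ.* + M ℤ.- (ℤ.- (+ c ℤ.* Q))) ∎
    where
    open ≡-Reasoning
    lemma : ∀ d m k c p f → d * (m - - (k * c * p * f)) ≡ d * m - - (d * k * (c * (p * f)))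
    lemma = ℚ-Solver.solve 6 (λ d m k c p f → d :* (m :- :- (k :* c :* p :* f)) := d :* m :- :- (d :* k :* (c :* (p :* f)))) refl

  conclude₂ : ∀ M c → ¬ + p ∣ + 2 → p² ∣ + 2 ℤ.* + M ℤ.- (ℤ.- (+ c ℤ.* Q)) →
    ι M ≡ - ((+ 1 ℚ./ 2) * ι c * ι p * fermatQuot2 p) [modℚ p ℕ.^ 2 ]
  conclude₂ M c p∤2 = modℚ-by 2 _ {ι M} p∤2 (form₂ M c)

  -- The Pell number is a parameter because its index depends on the character of 2, which is
  -- supplied only in each residue class.
  module _ (X : ℤ) (p*pellQuot : ι p * pellQuot p ≡ fromℤ X) where

    sum-13/4 : ∀ c → ι 4 * (ι c * ι p * ((+ 13 ℚ./ 4) * fermatQuot2 p + pellQuot p)) ≡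
      fromℤ (+ c ℤ.* (+ 13 ℤ.* Q ℤ.+ + 4 ℤ.* X))
    sum-13/4 c = begin
      ι 4 * (ι c * ι p * ((+ 13 ℚ./ 4) * fermatQuot2 p + pellQuot p))
        ≡⟨ lemma (ι 4) (ι c) (ι p) (+ 13 ℚ./ 4) (fermatQuot2 p) (pellQuot p) ⟩
      ι c * (ι 4 * (+ 13 ℚ./ 4) * (ι p * fermatQuot2 p) + ι 4 * (ι p * pellQuot p))
        ≡⟨ cong₂ (λ y z → ι c * (ι 13 * y + ι 4 * z)) p*fermatQuot2 p*pellQuot ⟩
      ι c * (ι 13 * fromℤ Q + ι 4 * fromℤ X)
        ≡⟨ cong (ι c *_) (trans (cong₂ _+_ (fromℤ-* (+ 13) Q) (fromℤ-* (+ 4) X)) (fromℤ-+ (+ 13 ℤ.* Q) (+ 4 ℤ.* X))) ⟩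
      ι c * fromℤ (+ 13 ℤ.* Q ℤ.+ + 4 ℤ.* X)
        ≡⟨ fromℤ-* (+ c) (+ 13 ℤ.* Q ℤ.+ + 4 ℤ.* X) ⟩
      fromℤ (+ c ℤ.* (+ 13 ℤ.* Q ℤ.+ + 4 ℤ.* X)) ∎
      where
      open ≡-Reasoning
      lemma : ∀ d c p k f g → d * (c * p * (k * f + g)) ≡ c * (d * k * (p * f) + d * (p * g))
      lemma = ℚ-Solver.solve 6 (λ d c p k f g → d :* (c :* p :* (k :* f :+ g)) := c :* (d :* k :* (p :* f) :+ d :* (p :* g))) refl

    difference-1/4 : ∀ c → ι 4 * (ι c * ι p * ((+ 1 ℚ./ 4) * fermatQuot2 p - pellQuot p)) ≡
      fromℤ (+ c ℤ.* (Q ℤ.- + 4 ℤ.* X))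
    difference-1/4 c = begin
      ι 4 * (ι c * ι p * ((+ 1 ℚ./ 4) * fermatQuot2 p - pellQuot p))
        ≡⟨ lemma (ι 4) (ι c) (ι p) (+ 1 ℚ./ 4) (fermatQuot2 p) (pellQuot p) ⟩
      ι c * (ι 4 * (+ 1 ℚ./ 4) * (ι p * fermatQuot2 p) - ι 4 * (ι p * pellQuot p))
        ≡⟨ cong₂ (λ y z → ι c * (y - ι 4 * z)) (trans (ℚP.*-identityˡ _) p*fermatQuot2) p*pellQuot ⟩
      ι c * (fromℤ Q - ι 4 * fromℤ X)
        ≡⟨ cong (ι c *_) (trans (cong (λ z → fromℤ Q - z) (fromℤ-* (+ 4) X)) (fromℤ-- Q (+ 4 ℤ.* X))) ⟩
      ι c * fromℤ (Q ℤ.- + 4 ℤ.* X)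
        ≡⟨ fromℤ-* (+ c) (Q ℤ.- + 4 ℤ.* X) ⟩
      fromℤ (+ c ℤ.* (Q ℤ.- + 4 ℤ.* X)) ∎
      where
      open ≡-Reasoning
      lemma : ∀ d c p k f g → d * (c * p * (k * f - g)) ≡ c * (d * k * (p * f) - d * (p * g))
      lemma = ℚ-Solver.solve 6 (λ d c p k f g → d :* (c :* p :* (k :* f :- g)) := c :* (d :* k :* (p :* f) :- d :* (p :* g))) refl

    form₁₈ : ∀ M c → ι 4 * (ι M - (1ℚ + ι c * ι p * ((+ 13 ℚ./ 4) * fermatQuot2 p + pellQuot p))) ≡
      fromℤ (+ 4 ℤ.* + M ℤ.- (+ 4 ℤ.+ + c ℤ.* (+ 13 ℤ.* Q ℤ.+ + 4 ℤ.* X)))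
    form₁₈ M c = trans (lemma (ι 4) (ι M) 1ℚ (ι c * ι p * ((+ 13 ℚ./ 4) * fermatQuot2 p + pellQuot p)))
      (trans (cong₂ (λ y z → y - (ι 4 + z)) (fromℤ-* (+ 4) (+ M)) (sum-13/4 c))
        (trans (cong (λ z → fromℤ (+ 4 ℤ.* + M) - z) (fromℤ-+ (+ 4) (+ c ℤ.* (+ 13 ℤ.* Q ℤ.+ + 4 ℤ.* X)))) (fromℤ-- (+ 4 ℤ.* + M) _)))
      where
      lemma : ∀ d m o y → d * (m - (o + y)) ≡ d * m - (d * o + d * y)
      lemma = ℚ-Solver.solve 4 (λ d m o y → d :* (m :- (o :+ y)) := d :* m :- (d :* o :+ d :* y)) refl

    conclude₁₈ : ∀ M c → ¬ + p ∣ + 4 → p² ∣ + 4 ℤ.* + M ℤ.- (+ 4 ℤ.+ + c ℤ.* (+ 13 ℤ.* Q ℤ.+ + 4 ℤ.* X)) →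
      ι M ≡ 1ℚ + ι c * ι p * ((+ 13 ℚ./ 4) * fermatQuot2 p + pellQuot p) [modℚ p ℕ.^ 2 ]
    conclude₁₈ M c p∤4 = modℚ-by 4 _ {ι M} p∤4 (form₁₈ M c)

    form₃₈ : ∀ M c → ι 4 * (ι M - (- 1ℚ - ι c * ι p * ((+ 13 ℚ./ 4) * fermatQuot2 p + pellQuot p))) ≡
      fromℤ (+ 4 ℤ.* + M ℤ.- (ℤ.- + 4 ℤ.- + c ℤ.* (+ 13 ℤ.* Q ℤ.+ + 4 ℤ.* X)))
    form₃₈ M c = trans (lemma (ι 4) (ι M) 1ℚ (ι c * ι p * ((+ 13 ℚ./ 4) * fermatQuot2 p + pellQuot p)))
      (trans (cong₂ (λ y z → y - (- ι 4 - z)) (fromℤ-* (+ 4) (+ M)) (sum-13/4 c))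
        (trans (cong (λ z → fromℤ (+ 4 ℤ.* + M) - z) (fromℤ-- (ℤ.- + 4) (+ c ℤ.* (+ 13 ℤ.* Q ℤ.+ + 4 ℤ.* X)))) (fromℤ-- (+ 4 ℤ.* + M) _)))
      where
      lemma : ∀ d m o y → d * (m - (- o - y)) ≡ d * m - (- (d * o) - d * y)
      lemma = ℚ-Solver.solve 4 (λ d m o y → d :* (m :- (:- o :- y)) := d :* m :- (:- (d :* o) :- d :* y)) refl

    conclude₃₈ : ∀ M c → ¬ + p ∣ + 4 → p² ∣ + 4 ℤ.* + M ℤ.- (ℤ.- + 4 ℤ.- + c ℤ.* (+ 13 ℤ.* Q ℤ.+ + 4 ℤ.* X)) →
      ι M ≡ - 1ℚ - ι c * ι p * ((+ 13 ℚ./ 4) * fermatQuot2 p + pellQuot p) [modℚ p ℕ.^ 2 ]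
    conclude₃₈ M c p∤4 = modℚ-by 4 _ {ι M} p∤4 (form₃₈ M c)

    form₅₈ : ∀ M c → ι 4 * (ι M - - (ι c * ι p * ((+ 1 ℚ./ 4) * fermatQuot2 p - pellQuot p))) ≡
      fromℤ (+ 4 ℤ.* + M ℤ.- (ℤ.- (+ c ℤ.* (Q ℤ.- + 4 ℤ.* X))))
    form₅₈ M c = trans (lemma (ι 4) (ι M) (ι c * ι p * ((+ 1 ℚ./ 4) * fermatQuot2 p - pellQuot p)))
      (trans (cong₂ (λ y z → y - - z) (fromℤ-* (+ 4) (+ M)) (difference-1/4 c))
        (trans (cong (λ z → fromℤ (+ 4 ℤ.* + M) - z) (fromℤ-neg (+ c ℤ.* (Q ℤ.- + 4 ℤ.* X)))) (fromℤ-- (+ 4 ℤ.* + M) _)))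
      where
      lemma : ∀ d m y → d * (m - - y) ≡ d * m - - (d * y)
      lemma = ℚ-Solver.solve 3 (λ d m y → d :* (m :- :- y) := d :* m :- :- (d :* y)) refl

    conclude₅₈ : ∀ M c → ¬ + p ∣ + 4 → p² ∣ + 4 ℤ.* + M ℤ.- (ℤ.- (+ c ℤ.* (Q ℤ.- + 4 ℤ.* X))) →
      ι M ≡ - (ι c * ι p * ((+ 1 ℚ./ 4) * fermatQuot2 p - pellQuot p)) [modℚ p ℕ.^ 2 ]
    conclude₅₈ M c p∤4 = modℚ-by 4 _ {ι M} p∤4 (form₅₈ M c)

    form₇₈ : ∀ M c → ι 4 * (ι M - ι c * ι p * ((+ 1 ℚ./ 4) * fermatQuot2 p - pellQuot p)) ≡
      fromℤ (+ 4 ℤ.* + M ℤ.- + c ℤ.* (Q ℤ.- + 4 ℤ.* X))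
    form₇₈ M c = trans (lemma (ι 4) (ι M) (ι c * ι p * ((+ 1 ℚ./ 4) * fermatQuot2 p - pellQuot p)))
      (trans (cong₂ _-_ (fromℤ-* (+ 4) (+ M)) (difference-1/4 c)) (fromℤ-- (+ 4 ℤ.* + M) _))
      where
      lemma : ∀ d m y → d * (m - y) ≡ d * m - d * y
      lemma = ℚ-Solver.solve 3 (λ d m y → d :* (m :- y) := d :* m :- d :* y) refl

    conclude₇₈ : ∀ M c → ¬ + p ∣ + 4 → p² ∣ + 4 ℤ.* + M ℤ.- + c ℤ.* (Q ℤ.- + 4 ℤ.* X) →
      ι M ≡ ι c * ι p * ((+ 1 ℚ./ 4) * fermatQuot2 p - pellQuot p) [modℚ p ℕ.^ 2 ]
    conclude₇₈ M c p∤4 = modℚ-by 4 _ {ι M} p∤4 (form₇₈ M c)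

-- The six cases of the theorem.

residue-form : ∀ p m r .{{_ : NonZero m}} → p % m ≡ r → p ≡ r ℕ.+ p ℕ./ m ℕ.* m
residue-form p m r eq = trans (m≡m%n+[m/n]*n p m) (cong (ℕ._+ p ℕ./ m ℕ.* m) eq)

halve : ∀ {m} k → m ≡ k ℕ.* 2 → m ℕ./ 2 ≡ k
halve k refl = m*n/n≡m k 2

-- Division by 2 is stuck on a symbolic `t`; this supplies the index in the form used by the integer
-- congruences, with p = 2c + 1 + 8t.
half : ∀ c t → (c ℕ.* 2 ℕ.+ t ℕ.* 8) ℕ./ 2 ≡ c ℕ.+ t ℕ.* 4
half c t = halve (c ℕ.+ t ℕ.* 4) (identity c t)
  where
  identity : ∀ c t → c ℕ.* 2 ℕ.+ t ℕ.* 8 ≡ (c ℕ.+ t ℕ.* 4) ℕ.* 2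
  identity = ℕ-solve-∀

p∤2 : ∀ {n} (pr : Prime (suc n)) → 5 ≤ suc n → ¬ + suc n ∣ + 2
p∤2 {n} pr le = PrimeModulus.p∤small n pr (ℕP.≤-trans (ℕP.m≤m+n 3 2) le)

p∤4 : ∀ {n} (pr : Prime (suc n)) → 5 ≤ suc n → ¬ + suc n ∣ + 4
p∤4 {n} pr le = PrimeModulus.p∤small n pr le

full₁ : ∀ p N t .{{_ : NonZero p}} → Prime p → 5 ≤ p → p ≡ 1 ℕ.+ t ℕ.* 4 →
  ι (quad (suc N ℕ.* p ∸ 1) (p ∸ 1)) ≡ 1ℚ + ι 2 * ι (suc N) * ι p * fermatQuot2 p [modℚ p ^ 2 ]
full₁ p N t pr 5≤p refl = conclude₁ (quad (suc N ℕ.* p ∸ 1) (t ℕ.* 4)) (suc N) (p∤2 pr 5≤p) (Case₁₄.quad-full t pr N)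
  where open Rational (t ℕ.* 4) pr

full₃ : ∀ p N t .{{_ : NonZero p}} → Prime p → 5 ≤ p → p ≡ 3 ℕ.+ t ℕ.* 4 →
  ι (quad (suc N ℕ.* p ∸ 1) (p ∸ 1)) ≡ - ((+ 1 ℚ./ 2) * ι (suc N) * ι p * fermatQuot2 p) [modℚ p ^ 2 ]
full₃ p N t pr 5≤p refl = conclude₂ (quad (suc N ℕ.* p ∸ 1) (2 ℕ.+ t ℕ.* 4)) (suc N) (p∤2 pr 5≤p) (Case₃₄.quad-full t pr N)
  where open Rational (2 ℕ.+ t ℕ.* 4) pr

half₁ : ∀ p N t .{{_ : NonZero p}} → Prime p → 5 ≤ p → p ≡ 1 ℕ.+ t ℕ.* 8 →
  ι (quad (suc N ℕ.* p ∸ 1) ((p ∸ 1) ℕ./ 2)) ≡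
    1ℚ + ι (suc N) * ι p * ((+ 13 ℚ./ 4) * fermatQuot2 p + pellQuot p) [modℚ p ^ 2 ]
half₁ p N t pr 5≤p refl = subst
  (λ k → ι (quad (suc N ℕ.* p ∸ 1) k) ≡ 1ℚ + ι (suc N) * ι p * ((+ 13 ℚ./ 4) * fermatQuot2 p + pellQuot p) [modℚ p ^ 2 ])
  (sym (half 0 t))
  (conclude₁₈ (+ pell (t ℕ.* 8)) p*pellQuot (quad (suc N ℕ.* p ∸ 1) (t ℕ.* 4)) (suc N) (p∤4 pr 5≤p)
    (Case₁.quad-half t pr N))
  where
  open Rational (t ℕ.* 8) pr
  -- The known outcome of the search for a root of 2 selects the branch of `pellIndex`.
  p*pellQuot : ι p * pellQuot p ≡ fromℤ (+ pell (t ℕ.* 8))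
  p*pellQuot = trans (p*[z/p] p (+ pell (pellIndex p)))
    (cong (λ b → fromℤ (+ pell (if b then p ∸ 1 else p ℕ.+ 1))) (twoIsQR₁ t pr))

half₃ : ∀ p N t .{{_ : NonZero p}} → Prime p → 5 ≤ p → p ≡ 3 ℕ.+ t ℕ.* 8 →
  ι (quad (suc N ℕ.* p ∸ 1) ((p ∸ 1) ℕ./ 2)) ≡
    - 1ℚ - ι (suc N) * ι p * ((+ 13 ℚ./ 4) * fermatQuot2 p + pellQuot p) [modℚ p ^ 2 ]
half₃ p N t pr 5≤p refl = subst
  (λ k → ι (quad (suc N ℕ.* p ∸ 1) k) ≡ - 1ℚ - ι (suc N) * ι p * ((+ 13 ℚ./ 4) * fermatQuot2 p + pellQuot p) [modℚ p ^ 2 ])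
  (sym (half 1 t))
  (conclude₃₈ (+ pell (4 ℕ.+ t ℕ.* 8)) p*pellQuot (quad (suc N ℕ.* p ∸ 1) (1 ℕ.+ t ℕ.* 4)) (suc N) (p∤4 pr 5≤p)
    (Case₃.quad-half t pr N))
  where
  open Rational (2 ℕ.+ t ℕ.* 8) pr
  p*pellQuot : ι p * pellQuot p ≡ fromℤ (+ pell (4 ℕ.+ t ℕ.* 8))
  p*pellQuot = trans (p*[z/p] p (+ pell (pellIndex p)))
    (trans (cong (λ b → fromℤ (+ pell (if b then p ∸ 1 else p ℕ.+ 1))) (twoIsQR₃ t pr))
      (cong (λ i → fromℤ (+ pell i)) (ℕP.+-comm p 1)))

half₅ : ∀ p N t .{{_ : NonZero p}} → Prime p → 5 ≤ p → p ≡ 5 ℕ.+ t ℕ.* 8 →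
  ι (quad (suc N ℕ.* p ∸ 1) ((p ∸ 1) ℕ./ 2)) ≡
    - (ι (suc N) * ι p * ((+ 1 ℚ./ 4) * fermatQuot2 p - pellQuot p)) [modℚ p ^ 2 ]
half₅ p N t pr 5≤p refl = subst
  (λ k → ι (quad (suc N ℕ.* p ∸ 1) k) ≡ - (ι (suc N) * ι p * ((+ 1 ℚ./ 4) * fermatQuot2 p - pellQuot p)) [modℚ p ^ 2 ])
  (sym (half 2 t))
  (conclude₅₈ (+ pell (6 ℕ.+ t ℕ.* 8)) p*pellQuot (quad (suc N ℕ.* p ∸ 1) (2 ℕ.+ t ℕ.* 4)) (suc N) (p∤4 pr 5≤p)
    (Case₅.quad-half t pr N))
  where
  open Rational (4 ℕ.+ t ℕ.* 8) pr
  p*pellQuot : ι p * pellQuot p ≡ fromℤ (+ pell (6 ℕ.+ t ℕ.* 8))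
  p*pellQuot = trans (p*[z/p] p (+ pell (pellIndex p)))
    (trans (cong (λ b → fromℤ (+ pell (if b then p ∸ 1 else p ℕ.+ 1))) (twoIsQR₅ t pr))
      (cong (λ i → fromℤ (+ pell i)) (ℕP.+-comm p 1)))

half₇ : ∀ p N t .{{_ : NonZero p}} → Prime p → 5 ≤ p → p ≡ 7 ℕ.+ t ℕ.* 8 →
  ι (quad (suc N ℕ.* p ∸ 1) ((p ∸ 1) ℕ./ 2)) ≡
    ι (suc N) * ι p * ((+ 1 ℚ./ 4) * fermatQuot2 p - pellQuot p) [modℚ p ^ 2 ]
half₇ p N t pr 5≤p refl = subst
  (λ k → ι (quad (suc N ℕ.* p ∸ 1) k) ≡ ι (suc N) * ι p * ((+ 1 ℚ./ 4) * fermatQuot2 p - pellQuot p) [modℚ p ^ 2 ])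
  (sym (half 3 t))
  (conclude₇₈ (+ pell (6 ℕ.+ t ℕ.* 8)) p*pellQuot (quad (suc N ℕ.* p ∸ 1) (3 ℕ.+ t ℕ.* 4)) (suc N) (p∤4 pr 5≤p)
    (Case₇.quad-half t pr N))
  where
  open Rational (6 ℕ.+ t ℕ.* 8) pr
  p*pellQuot : ι p * pellQuot p ≡ fromℤ (+ pell (6 ℕ.+ t ℕ.* 8))
  p*pellQuot = trans (p*[z/p] p (+ pell (pellIndex p)))
    (cong (λ b → fromℤ (+ pell (if b then p ∸ 1 else p ℕ.+ 1))) (twoIsQR₇ t pr))

theoremA : (p n : ℕ) → .{{_ : NonZero p}} → Prime p → 5 ≤ p → 1 ≤ n →
    ((p % 4 ≡ 1 → ι (quad (n ℕ.* p ∸ 1) (p ∸ 1)) ≡ 1ℚ + ι 2 * ι n * ι p * fermatQuot2 p [modℚ p ^ 2 ])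
    × (p % 4 ≡ 3 → ι (quad (n ℕ.* p ∸ 1) (p ∸ 1)) ≡ - ((+ 1 ℚ./ 2) * ι n * ι p * fermatQuot2 p) [modℚ p ^ 2 ]))
    × ((p % 8 ≡ 1 → ι (quad (n ℕ.* p ∸ 1) ((p ∸ 1) ℕ./ 2)) ≡ 1ℚ + ι n * ι p * ((+ 13 ℚ./ 4) * fermatQuot2 p + pellQuot p) [modℚ p ^ 2 ])
    × (p % 8 ≡ 3 → ι (quad (n ℕ.* p ∸ 1) ((p ∸ 1) ℕ./ 2)) ≡ - 1ℚ - ι n * ι p * ((+ 13 ℚ./ 4) * fermatQuot2 p + pellQuot p) [modℚ p ^ 2 ])
    × (p % 8 ≡ 5 → ι (quad (n ℕ.* p ∸ 1) ((p ∸ 1) ℕ./ 2)) ≡ - (ι n * ι p * ((+ 1 ℚ./ 4) * fermatQuot2 p - pellQuot p)) [modℚ p ^ 2 ])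
    × (p % 8 ≡ 7 → ι (quad (n ℕ.* p ∸ 1) ((p ∸ 1) ℕ./ 2)) ≡ ι n * ι p * ((+ 1 ℚ./ 4) * fermatQuot2 p - pellQuot p) [modℚ p ^ 2 ]))
theoremA p (suc N) pr 5≤p 1≤n =
  ((λ r → full₁ p N (p ℕ./ 4) pr 5≤p (residue-form p 4 1 r)) ,
   (λ r → full₃ p N (p ℕ./ 4) pr 5≤p (residue-form p 4 3 r))) ,
  ((λ r → half₁ p N (p ℕ./ 8) pr 5≤p (residue-form p 8 1 r)) ,
   (λ r → half₃ p N (p ℕ./ 8) pr 5≤p (residue-form p 8 3 r)) ,
   (λ r → half₅ p N (p ℕ./ 8) pr 5≤p (residue-form p 8 5 r)) ,
   (λ r → half₇ p N (p ℕ./ 8) pr 5≤p (residue-form p 8 7 r)))
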